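{- For every fixed integer $p\ge 3$, $$f_{p+1}(n,m)=\Phi_p(\lambda)\,n^2+O_p(n)\qquad\text{for all integers } n\ge 1 \text{ and } m \text{ with } t_{p-1}(n)<m\le t_p(n),$$ where $\lambda=\dfrac{m-t_{p-1}(n)}{t_p(n)-t_{p-1}(n)}\in(0,1]$.
   Context: All graphs are finite and simple. For a $K_{p+1}$-free graph $G$, a non-edge $xy$ (an unordered pair of distinct non-adjacent vertices) is $K_{p+1}$-saturating if $G+xy$ contains a copy of $K_{p+1}$. $f_{p+1}(G)$ is the number of $K_{p+1}$-saturating non-edges of $G$, and $f_{p+1}(n,m)$ is the minimum of $f_{p+1}(G)$ over all $K_{p+1}$-free graphs $G$ with $n$ vertices and $m$ edges. $T_r(n)$ is the complete balanced $r$-partite graph on $n$ vertices and $t_r(n)=e(T_r(n))$ is its number of edges. Let $D_p=4p^2-11p+8$. For $\lambda\in(0,1]$, $x_p(\lambda)$ is the unique positive root $x$ of $$p^3D_px^4-2p^2(p-2)^2x^3-2p(p-2)\lambda x-\lambda^2=0,$$ and $$y_p(\lambda)=\frac{\lambda}{2p(p-1)x_p(\lambda)}+\frac{p-2}{p-1}\left(1-\frac{x_p(\lambda)}2\right),\qquad \Phi_p(\lambda)=\frac12\left(x_p(\lambda)^2+\frac{y_p(\lambda)^2}{p-1}\right).$$ $O_p(n)$ denotes a quantity bounded in absolute value by $C_p n$, where the constant $C_p$ depends only on $p$ (uniformly in $n$ and $m$). -}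

module Defs where

open import Data.Bool using (Bool; false; _∨_; not; T; T?)
open import Data.Bool.Properties using (∨-comm)
open import Data.Fin as Fin using (Fin; toℕ)
import Data.Fin.Properties as Fin
open import Data.Fin.Subset using (Subset; _∈_; ∣_∣)
open import Data.Fin.Subset.Properties using (_∈?_; anySubset?)
import Data.Integer as ℤ
open import Data.List using (List; length; filter; allFin; cartesianProduct)
open import Data.Nat as ℕ using (ℕ; zero; suc)
open import Data.Nat.Divisibility as ℕ using (_∣?_)
import Data.Nat.Properties as ℕ
open import Data.Product using (Σ-syntax; ∃-syntax; _×_; _,_)
open import Data.Rational as ℚ using (ℚ; 0ℚ; 1ℚ; ½)
import Data.Rational.Properties as ℚ
open import Data.Rational.Solver using (module +-*-Solver)
open import Data.Sum using (inj₁; inj₂)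
open import Level using (0ℓ)
open import Relation.Binary.PropositionalEquality
open import Relation.Nullary using (Dec; yes; no; ¬_; does; contradiction)
open import Relation.Nullary.Decidable using (_×-dec_; _→-dec_; ¬?; dec-false)
open import Relation.Unary using (Pred; Decidable)

record Graph (n : ℕ) : Set where
  field
    adj        : Fin n → Fin n → Bool
    adj-sym    : ∀ u v → adj u v ≡ adj v u
    adj-irrefl : ∀ v → adj v v ≡ false

open Graph public

Adj : ∀ {n} → Graph n → Fin n → Fin n → Set
Adj G u v = T (adj G u v)

-- Unordered pairs of distinct vertices, each listed once as (u , v) with u < v.

pairs : ∀ n → List (Fin n × Fin n)
pairs n = filter (λ (u , v) → u Fin.<? v) (cartesianProduct (allFin n) (allFin n))

edges : ∀ {n} → Graph n → ℕ
edges {n} G = length (filter (λ (u , v) → T? (adj G u v)) (pairs n))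

IsClique : ∀ {n} → Graph n → Subset n → Set
IsClique G S = ∀ u → u ∈ S → ∀ v → v ∈ S → u ≢ v → Adj G u v

-- G contains a copy of the complete graph on k vertices.

HasClique : ∀ {n} → ℕ → Graph n → Set
HasClique {n} k G = ∃[ S ] (∣ S ∣ ≡ k × IsClique G S)

hasClique? : ∀ {n} k (G : Graph n) → Dec (HasClique k G)
hasClique? k G = anySubset? λ S → (∣ S ∣ ℕ.≟ k) ×-dec
  Fin.all? λ u → (u ∈? S) →-dec Fin.all? λ v → (v ∈? S) →-dec
    (¬? (u Fin.≟ v) →-dec T? (adj G u v))

addEdge : ∀ {n} (G : Graph n) (x y : Fin n) → x ≢ y → Graph n
addEdge G x y x≢y = record
  { adj        = λ u v → adj G u v ∨ (is x y u v ∨ is x y v u)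
  ; adj-sym    = λ u v → cong₂ _∨_ (adj-sym G u v) (∨-comm (is x y u v) (is x y v u))
  ; adj-irrefl = λ v → cong₂ _∨_ (adj-irrefl G v) (cong₂ _∨_ (loopless v) (loopless v))
  }
  where
  is : ∀ {n} → Fin n → Fin n → Fin n → Fin n → Bool
  is x y u v = does ((u Fin.≟ x) ×-dec (v Fin.≟ y))

  loopless : ∀ v → is x y v v ≡ false
  loopless v = dec-false ((v Fin.≟ x) ×-dec (v Fin.≟ y))
    λ (v≡x , v≡y) → x≢y (trans (sym v≡x) v≡y)

IsSaturating : ∀ {n} → ℕ → Graph n → Fin n × Fin n → Set
IsSaturating k G (x , y) =
  Σ[ x≢y ∈ x ≢ y ] (¬ Adj G x y × HasClique k (addEdge G x y x≢y))

isSaturating? : ∀ {n} k (G : Graph n) → Decidable (IsSaturating k G)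
isSaturating? k G (x , y) with x Fin.≟ y
... | yes x≡y = no λ (x≢y , _) → x≢y x≡y
... | no  x≢y with ¬? (T? (adj G x y)) ×-dec hasClique? k (addEdge G x y x≢y)
...   | yes s = yes (x≢y , s)
...   | no ¬s = no λ (_ , s) → ¬s s

-- The number f_k(G) of K_k-saturating non-edges of G.

satCount : ∀ {n} → ℕ → Graph n → ℕ
satCount {n} k G = length (filter (isSaturating? k G) (pairs n))

IsMinimum : Pred ℕ 0ℓ → ℕ → Set
IsMinimum P k = P k × (∀ j → P j → k ℕ.≤ j)

-- j is the value f_k(G) for some K_k-free G with n vertices and m edges.

SatValue : (k n m : ℕ) → Pred ℕ 0ℓ
SatValue k n m j =
  Σ[ G ∈ Graph n ] (¬ HasClique k G × edges G ≡ m × satCount k G ≡ j)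

-- v is the value f_k(n,m).

IsMinSat : (k n m v : ℕ) → Set
IsMinSat k n m = IsMinimum (SatValue k n m)

-- The parts of T_r(n) are the residue classes modulo r among 0, …, n-1,
-- whose sizes differ by at most one.

turán : (r n : ℕ) → Graph n
turán r n = record
  { adj        = λ u v → not (same u v)
  ; adj-sym    = λ u v →
      cong (λ d → not (does (r ∣? d))) (ℕ.∣-∣-comm (toℕ u) (toℕ v))
  ; adj-irrefl = λ v → loopless v
  }
  where
  same : Fin n → Fin n → Bool
  same u v = does (r ∣? ℕ.∣ toℕ u - toℕ v ∣)

  loopless : ∀ v → not (same v v) ≡ false
  loopless v rewrite ℕ.∣n-n∣≡0 (toℕ v) with r ∣? 0
  ... | yes _   = refl
  ... | no  r∤0 = contradiction (r ℕ.∣0) r∤0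

t : (r n : ℕ) → ℕ
t r n = edges (turán r n)

-- Total reciprocal, with the junk value 0 at 0.

recip : ℚ → ℚ
recip q with q ℚ.≟ 0ℚ
... | yes _   = 0ℚ
... | no  q≢0 = (ℚ.1/ q) {{ℚ.≢-nonZero q≢0}}

infixl 7 _÷_

_÷_ : ℚ → ℚ → ℚ
a ÷ b = a ℚ.* recip b

ℕ→ℚ : ℕ → ℚ
ℕ→ℚ k = ℤ.+ k ℚ./ 1

>⇒≢0 : ∀ {q} → 0ℚ ℚ.< q → q ≢ 0ℚ
>⇒≢0 0<q q≡0 = ℚ.<-irrefl (sym q≡0) 0<q

recip-inverse : ∀ {q} → 0ℚ ℚ.< q → q ℚ.* recip q ≡ 1ℚ
recip-inverse {q} 0<q with q ℚ.≟ 0ℚ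
... | yes q≡0 = contradiction q≡0 (>⇒≢0 0<q)
... | no  q≢0 = ℚ.*-inverseʳ q {{ℚ.≢-nonZero q≢0}}

recip-pos : ∀ {q} → 0ℚ ℚ.< q → 0ℚ ℚ.< recip q
recip-pos {q} 0<q with q ℚ.≟ 0ℚ
... | yes q≡0 = contradiction q≡0 (>⇒≢0 0<q)
... | no  q≢0 =
  ℚ.positive⁻¹ _ {{ℚ.1/pos⇒pos q {{ℚ.positive 0<q}}}}

private
  open +-*-Solver using (solve; _:+_; _:*_; _:-_; :-_; _:=_; con)

  *-pos : ∀ {a b} → 0ℚ ℚ.< a → 0ℚ ℚ.< b → 0ℚ ℚ.< a ℚ.* b
  *-pos {a} {b} 0<a 0<b =
    ℚ.positive⁻¹ (a ℚ.* b) {{ℚ.pos*pos⇒pos a {{ℚ.positive 0<a}} b {{ℚ.positive 0<b}}}}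

  0<½ : 0ℚ ℚ.< ½
  0<½ = ℚ.positive⁻¹ ½

  0<1 : 0ℚ ℚ.< 1ℚ
  0<1 = ℚ.positive⁻¹ 1ℚ

  half+half : ∀ ε → ε ℚ.* ½ ℚ.+ ε ℚ.* ½ ≡ ε
  half+half = solve 1 (λ ε → ε :* con ½ :+ ε :* con ½ := ε) refl

  *-mono : ∀ {a b c d} → 0ℚ ℚ.≤ c → 0ℚ ℚ.≤ b → a ℚ.≤ b → c ℚ.≤ d →
           a ℚ.* c ℚ.≤ b ℚ.* d
  *-mono {b = b} {c} 0≤c 0≤b a≤b c≤d = ℚ.≤-trans
    (ℚ.*-monoʳ-≤-nonNeg c {{ℚ.nonNegative 0≤c}} a≤b)
    (ℚ.*-monoˡ-≤-nonNeg b {{ℚ.nonNegative 0≤b}} c≤d)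

-- Real numbers, as Cauchy sequences of rationals with a modulus of
-- convergence, considered up to the equivalence _≃_ below.

IsCauchy : (ℕ → ℚ) → Set
IsCauchy a = ∀ ε → 0ℚ ℚ.< ε →
  ∃[ N ] (∀ i j → N ℕ.≤ i → N ℕ.≤ j → ℚ.∣ a i ℚ.- a j ∣ ℚ.≤ ε)

record ℝ : Set where
  constructor mkℝ
  field
    seq    : ℕ → ℚ
    cauchy : IsCauchy seq

open ℝ public

infix 4 _≃_ _≤_ _<_

_≃_ : ℝ → ℝ → Set
x ≃ y = ∀ ε → 0ℚ ℚ.< ε →
  ∃[ N ] (∀ i → N ℕ.≤ i → ℚ.∣ seq x i ℚ.- seq y i ∣ ℚ.≤ ε)

_≤_ : ℝ → ℝ → Set
x ≤ y = ∀ ε → 0ℚ ℚ.< ε →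
  ∃[ N ] (∀ i → N ℕ.≤ i → seq x i ℚ.≤ seq y i ℚ.+ ε)

_<_ : ℝ → ℝ → Set
x < y = Σ[ δ ∈ ℚ ] (0ℚ ℚ.< δ ×
  ∃[ N ] (∀ i → N ℕ.≤ i → seq x i ℚ.+ δ ℚ.≤ seq y i))

fromℚ : ℚ → ℝ
fromℚ q = mkℝ (λ _ → q) λ ε 0<ε → 0 , λ _ _ _ _ →
  subst (ℚ._≤ ε) (cong ℚ.∣_∣ (sym (ℚ.+-inverseʳ q))) (ℚ.<⇒≤ 0<ε)

fromℕ : ℕ → ℝ
fromℕ k = fromℚ (ℕ→ℚ k)

0ℝ 1ℝ : ℝ
0ℝ = fromℕ 0
1ℝ = fromℕ 1

private
  +-cauchy : ∀ a b → IsCauchy a → IsCauchy b → IsCauchy (λ i → a i ℚ.+ b i)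
  +-cauchy a b ca cb ε 0<ε
    with ca (ε ℚ.* ½) (*-pos 0<ε 0<½) | cb (ε ℚ.* ½) (*-pos 0<ε 0<½)
  ... | M , hM | N , hN = M ℕ.⊔ N , λ i j i≥ j≥ → begin
    ℚ.∣ (a i ℚ.+ b i) ℚ.- (a j ℚ.+ b j) ∣
      ≡⟨ cong ℚ.∣_∣ (regroup (a i) (b i) (a j) (b j)) ⟩
    ℚ.∣ (a i ℚ.- a j) ℚ.+ (b i ℚ.- b j) ∣
      ≤⟨ ℚ.∣p+q∣≤∣p∣+∣q∣ (a i ℚ.- a j) (b i ℚ.- b j) ⟩
    ℚ.∣ a i ℚ.- a j ∣ ℚ.+ ℚ.∣ b i ℚ.- b j ∣
      ≤⟨ ℚ.+-mono-≤
           (hM i j (ℕ.m⊔n≤o⇒m≤o M N i≥) (ℕ.m⊔n≤o⇒m≤o M N j≥))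
           (hN i j (ℕ.m⊔n≤o⇒n≤o M N i≥) (ℕ.m⊔n≤o⇒n≤o M N j≥)) ⟩
    ε ℚ.* ½ ℚ.+ ε ℚ.* ½
      ≡⟨ half+half ε ⟩
    ε ∎
    where
    open ℚ.≤-Reasoning
    regroup : ∀ a b c d → (a ℚ.+ b) ℚ.- (c ℚ.+ d) ≡ (a ℚ.- c) ℚ.+ (b ℚ.- d)
    regroup = solve 4 (λ a b c d →
      (a :+ b) :- (c :+ d) := (a :- c) :+ (b :- d)) refl

  neg-cauchy : ∀ a → IsCauchy a → IsCauchy (λ i → ℚ.- a i)
  neg-cauchy a ca ε 0<ε with ca ε 0<ε
  ... | N , h = N , λ i j i≥ j≥ →
    subst (ℚ._≤ ε)
      (trans (sym (ℚ.∣-p∣≡∣p∣ (a i ℚ.- a j)))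
             (cong ℚ.∣_∣ (ℚ.neg-distrib-+ (a i) (ℚ.- a j))))
      (h i j i≥ j≥)

  bounded : ∀ a → IsCauchy a →
    Σ[ B ∈ ℚ ] (0ℚ ℚ.< B × ∃[ N ] (∀ i → N ℕ.≤ i → ℚ.∣ a i ∣ ℚ.≤ B))
  bounded a ca with ca 1ℚ 0<1
  ... | N , h = 1ℚ ℚ.+ ℚ.∣ a N ∣
              , ℚ.+-mono-<-≤ 0<1 (ℚ.0≤∣p∣ (a N))
              , N , λ i i≥ → begin
    ℚ.∣ a i ∣
      ≡⟨ cong ℚ.∣_∣ (split (a i) (a N)) ⟩
    ℚ.∣ (a i ℚ.- a N) ℚ.+ a N ∣
      ≤⟨ ℚ.∣p+q∣≤∣p∣+∣q∣ (a i ℚ.- a N) (a N) ⟩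
    ℚ.∣ a i ℚ.- a N ∣ ℚ.+ ℚ.∣ a N ∣
      ≤⟨ ℚ.+-monoˡ-≤ ℚ.∣ a N ∣ (h i N i≥ ℕ.≤-refl) ⟩
    1ℚ ℚ.+ ℚ.∣ a N ∣ ∎
    where
    open ℚ.≤-Reasoning
    split : ∀ a b → a ≡ (a ℚ.- b) ℚ.+ b
    split = solve 2 (λ a b → a := (a :- b) :+ b) refl

  *-÷-cancel : ∀ {B} ε → 0ℚ ℚ.< B → B ℚ.* (ε ÷ B) ≡ ε
  *-÷-cancel {B} ε 0<B = begin
    B ℚ.* (ε ℚ.* recip B) ≡⟨ swap B ε (recip B) ⟩
    ε ℚ.* (B ℚ.* recip B) ≡⟨ cong (ε ℚ.*_) (recip-inverse 0<B) ⟩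
    ε ℚ.* 1ℚ              ≡⟨ ℚ.*-identityʳ ε ⟩
    ε                     ∎
    where
    open ≡-Reasoning
    swap : ∀ a b c → a ℚ.* (b ℚ.* c) ≡ b ℚ.* (a ℚ.* c)
    swap = solve 3 (λ a b c → a :* (b :* c) := b :* (a :* c)) refl

  *-estimate : ∀ {A B e} p q r s → 0ℚ ℚ.< A → 0ℚ ℚ.< B →
    ℚ.∣ p ∣ ℚ.≤ A → ℚ.∣ s ∣ ℚ.≤ B →
    ℚ.∣ p ℚ.- r ∣ ℚ.≤ e ÷ B → ℚ.∣ q ℚ.- s ∣ ℚ.≤ e ÷ A →
    ℚ.∣ p ℚ.* q ℚ.- r ℚ.* s ∣ ℚ.≤ e ℚ.+ e
  *-estimate {A} {B} {e} p q r s 0<A 0<B p≤A s≤B pr qs = begin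
    ℚ.∣ p ℚ.* q ℚ.- r ℚ.* s ∣
      ≡⟨ cong ℚ.∣_∣ (regroup p q r s) ⟩
    ℚ.∣ p ℚ.* (q ℚ.- s) ℚ.+ s ℚ.* (p ℚ.- r) ∣
      ≤⟨ ℚ.∣p+q∣≤∣p∣+∣q∣ (p ℚ.* (q ℚ.- s)) (s ℚ.* (p ℚ.- r)) ⟩
    ℚ.∣ p ℚ.* (q ℚ.- s) ∣ ℚ.+ ℚ.∣ s ℚ.* (p ℚ.- r) ∣
      ≡⟨ cong₂ ℚ._+_ (ℚ.∣p*q∣≡∣p∣*∣q∣ p (q ℚ.- s))
                     (ℚ.∣p*q∣≡∣p∣*∣q∣ s (p ℚ.- r)) ⟩
    ℚ.∣ p ∣ ℚ.* ℚ.∣ q ℚ.- s ∣ ℚ.+ ℚ.∣ s ∣ ℚ.* ℚ.∣ p ℚ.- r ∣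
      ≤⟨ ℚ.+-mono-≤
           (*-mono {ℚ.∣ p ∣} {A} {ℚ.∣ q ℚ.- s ∣} {e ÷ A}
             (ℚ.0≤∣p∣ (q ℚ.- s)) (ℚ.<⇒≤ 0<A) p≤A qs)
           (*-mono {ℚ.∣ s ∣} {B} {ℚ.∣ p ℚ.- r ∣} {e ÷ B}
             (ℚ.0≤∣p∣ (p ℚ.- r)) (ℚ.<⇒≤ 0<B) s≤B pr) ⟩
    A ℚ.* (e ÷ A) ℚ.+ B ℚ.* (e ÷ B)
      ≡⟨ cong₂ ℚ._+_ (*-÷-cancel e 0<A) (*-÷-cancel e 0<B) ⟩
    e ℚ.+ e ∎
    where
    open ℚ.≤-Reasoning
    regroup : ∀ a b c d →
      a ℚ.* b ℚ.- c ℚ.* d ≡ a ℚ.* (b ℚ.- d) ℚ.+ d ℚ.* (a ℚ.- c)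
    regroup = solve 4 (λ a b c d →
      a :* b :- c :* d := a :* (b :- d) :+ d :* (a :- c)) refl

  *-cauchy : ∀ a b → IsCauchy a → IsCauchy b → IsCauchy (λ i → a i ℚ.* b i)
  *-cauchy a b ca cb ε 0<ε =
    let A , 0<A , K , hA = bounded a ca
        B , 0<B , L , hB = bounded b cb
        0<½ε   = *-pos 0<ε 0<½
        M , hM = ca ((ε ℚ.* ½) ÷ B) (*-pos 0<½ε (recip-pos 0<B))
        N , hN = cb ((ε ℚ.* ½) ÷ A) (*-pos 0<½ε (recip-pos 0<A))
    in (K ℕ.⊔ L) ℕ.⊔ (M ℕ.⊔ N) , λ i j i≥ j≥ →
    let iKL = ℕ.m⊔n≤o⇒m≤o (K ℕ.⊔ L) (M ℕ.⊔ N) i≥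
        jKL = ℕ.m⊔n≤o⇒m≤o (K ℕ.⊔ L) (M ℕ.⊔ N) j≥
        iMN = ℕ.m⊔n≤o⇒n≤o (K ℕ.⊔ L) (M ℕ.⊔ N) i≥
        jMN = ℕ.m⊔n≤o⇒n≤o (K ℕ.⊔ L) (M ℕ.⊔ N) j≥
    in subst (ℚ.∣ a i ℚ.* b i ℚ.- a j ℚ.* b j ∣ ℚ.≤_) (half+half ε)
         (*-estimate {A} {B} {ε ℚ.* ½} (a i) (b i) (a j) (b j) 0<A 0<B
           (hA i (ℕ.m⊔n≤o⇒m≤o K L iKL)) (hB j (ℕ.m⊔n≤o⇒n≤o K L jKL))
           (hM i j (ℕ.m⊔n≤o⇒m≤o M N iMN) (ℕ.m⊔n≤o⇒m≤o M N jMN))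
           (hN i j (ℕ.m⊔n≤o⇒n≤o M N iMN) (ℕ.m⊔n≤o⇒n≤o M N jMN)))

  ∣∣-cauchy : ∀ a → IsCauchy a → IsCauchy (λ i → ℚ.∣ a i ∣)
  ∣∣-cauchy a ca ε 0<ε with ca ε 0<ε
  ... | N , h = N , λ i j i≥ j≥ → ∣∣-lip (a i) (a j) (h i j i≥ j≥) (h j i j≥ i≥)
    where
    open ℚ.≤-Reasoning
    split : ∀ a b → a ≡ (a ℚ.- b) ℚ.+ b
    split = solve 2 (λ a b → a := (a :- b) :+ b) refl

    cancel : ∀ e b → (e ℚ.+ b) ℚ.- b ≡ e
    cancel = solve 2 (λ e b → (e :+ b) :- b := e) refl

    swap : ∀ b a → b ℚ.- a ≡ ℚ.- (a ℚ.- b)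
    swap = solve 2 (λ b a → b :- a := :- (a :- b)) refl

    one-side : ∀ p q → ℚ.∣ p ℚ.- q ∣ ℚ.≤ ε → ℚ.∣ p ∣ ℚ.- ℚ.∣ q ∣ ℚ.≤ ε
    one-side p q le = begin
      ℚ.∣ p ∣ ℚ.- ℚ.∣ q ∣
        ≡⟨ cong (λ z → ℚ.∣ z ∣ ℚ.- ℚ.∣ q ∣) (split p q) ⟩
      ℚ.∣ (p ℚ.- q) ℚ.+ q ∣ ℚ.- ℚ.∣ q ∣
        ≤⟨ ℚ.+-monoˡ-≤ (ℚ.- ℚ.∣ q ∣) (ℚ.∣p+q∣≤∣p∣+∣q∣ (p ℚ.- q) q) ⟩
      (ℚ.∣ p ℚ.- q ∣ ℚ.+ ℚ.∣ q ∣) ℚ.- ℚ.∣ q ∣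
        ≡⟨ cancel ℚ.∣ p ℚ.- q ∣ ℚ.∣ q ∣ ⟩
      ℚ.∣ p ℚ.- q ∣
        ≤⟨ le ⟩
      ε ∎

    ∣∣-lip : ∀ p q → ℚ.∣ p ℚ.- q ∣ ℚ.≤ ε → ℚ.∣ q ℚ.- p ∣ ℚ.≤ ε →
             ℚ.∣ ℚ.∣ p ∣ ℚ.- ℚ.∣ q ∣ ∣ ℚ.≤ ε
    ∣∣-lip p q le₁ le₂ with ℚ.∣p∣≡p∨∣p∣≡-p (ℚ.∣ p ∣ ℚ.- ℚ.∣ q ∣)
    ... | inj₁ eq = ℚ.≤-trans (ℚ.≤-reflexive eq) (one-side p q le₁)
    ... | inj₂ eq = ℚ.≤-trans
      (ℚ.≤-reflexive (trans eq (sym (swap ℚ.∣ q ∣ ℚ.∣ p ∣)))) (one-side q p le₂)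

  recip-cauchy : ∀ a → IsCauchy a → ∀ δ → 0ℚ ℚ.< δ →
    ∃[ N ] (∀ i → N ℕ.≤ i → δ ℚ.≤ a i) → IsCauchy (λ i → recip (a i))
  recip-cauchy a ca δ 0<δ (N , δ≤a) ε 0<ε =
    let M , h = ca (ε ℚ.* (δ ℚ.* δ)) (*-pos 0<ε (*-pos 0<δ 0<δ))
    in N ℕ.⊔ M , λ i j i≥ j≥ →
    estimate (a i) (a j)
      (δ≤a i (ℕ.m⊔n≤o⇒m≤o N M i≥)) (δ≤a j (ℕ.m⊔n≤o⇒m≤o N M j≥))
      (h j i (ℕ.m⊔n≤o⇒n≤o N M j≥) (ℕ.m⊔n≤o⇒n≤o N M i≥))
    where
    open ℚ.≤-Reasoning
    regroup : ∀ p q r s → r ℚ.* (q ℚ.* s) ℚ.- s ℚ.* (p ℚ.* r)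
                        ≡ (r ℚ.* s) ℚ.* (q ℚ.- p)
    regroup = solve 4 (λ p q r s →
      r :* (q :* s) :- s :* (p :* r) := (r :* s) :* (q :- p)) refl

    collect : ∀ d e r s → (r ℚ.* s) ℚ.* (e ℚ.* (d ℚ.* d))
                        ≡ e ℚ.* ((d ℚ.* r) ℚ.* (d ℚ.* s))
    collect = solve 4 (λ d e r s →
      (r :* s) :* (e :* (d :* d)) := e :* ((d :* r) :* (d :* s))) refl

    estimate : ∀ p q → δ ℚ.≤ p → δ ℚ.≤ q →
      ℚ.∣ q ℚ.- p ∣ ℚ.≤ ε ℚ.* (δ ℚ.* δ) → ℚ.∣ recip p ℚ.- recip q ∣ ℚ.≤ ε
    estimate p q δ≤p δ≤q le = begin
      ℚ.∣ r ℚ.- s ∣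
        ≡⟨ cong ℚ.∣_∣ (cong₂ ℚ._-_ (expand r 0<q) (expand s 0<p)) ⟩
      ℚ.∣ r ℚ.* (q ℚ.* s) ℚ.- s ℚ.* (p ℚ.* r) ∣
        ≡⟨ cong ℚ.∣_∣ (regroup p q r s) ⟩
      ℚ.∣ (r ℚ.* s) ℚ.* (q ℚ.- p) ∣
        ≡⟨ ℚ.∣p*q∣≡∣p∣*∣q∣ (r ℚ.* s) (q ℚ.- p) ⟩
      ℚ.∣ r ℚ.* s ∣ ℚ.* ℚ.∣ q ℚ.- p ∣
        ≡⟨ cong (ℚ._* ℚ.∣ q ℚ.- p ∣) (ℚ.0≤p⇒∣p∣≡p 0≤rs) ⟩
      (r ℚ.* s) ℚ.* ℚ.∣ q ℚ.- p ∣
        ≤⟨ ℚ.*-monoˡ-≤-nonNeg (r ℚ.* s) {{ℚ.nonNegative 0≤rs}} le ⟩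
      (r ℚ.* s) ℚ.* (ε ℚ.* (δ ℚ.* δ))
        ≡⟨ collect δ ε r s ⟩
      ε ℚ.* ((δ ℚ.* r) ℚ.* (δ ℚ.* s))
        ≤⟨ ℚ.*-monoˡ-≤-nonNeg ε {{ℚ.nonNegative (ℚ.<⇒≤ 0<ε)}}
             (*-mono (ℚ.<⇒≤ (*-pos 0<δ 0<s)) (ℚ.<⇒≤ 0<1)
               (below-one δ≤p 0<p) (below-one δ≤q 0<q)) ⟩
      ε ℚ.* (1ℚ ℚ.* 1ℚ)
        ≡⟨ ℚ.*-identityʳ ε ⟩
      ε ∎
      where
      r s : ℚ
      r = recip p
      s = recip q

      0<p : 0ℚ ℚ.< p
      0<p = ℚ.<-≤-trans 0<δ δ≤p

      0<q : 0ℚ ℚ.< q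
      0<q = ℚ.<-≤-trans 0<δ δ≤q

      0<s : 0ℚ ℚ.< s
      0<s = recip-pos 0<q

      0≤rs : 0ℚ ℚ.≤ r ℚ.* s
      0≤rs = ℚ.<⇒≤ (*-pos (recip-pos 0<p) 0<s)

      expand : ∀ z {w} → 0ℚ ℚ.< w → z ≡ z ℚ.* (w ℚ.* recip w)
      expand z 0<w =
        sym (trans (cong (z ℚ.*_) (recip-inverse 0<w)) (ℚ.*-identityʳ z))

      below-one : ∀ {w} → δ ℚ.≤ w → 0ℚ ℚ.< w → δ ℚ.* recip w ℚ.≤ 1ℚ
      below-one {w} δ≤w 0<w = ℚ.≤-trans
        (ℚ.*-monoʳ-≤-nonNeg (recip w)
          {{ℚ.nonNegative (ℚ.<⇒≤ (recip-pos 0<w))}} δ≤w)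
        (ℚ.≤-reflexive (recip-inverse 0<w))

infix  8 -_
infixr 8 _^_
infixl 7 _*_
infixl 6 _+_ _-_

_+_ _*_ : ℝ → ℝ → ℝ
x + y = mkℝ (λ i → seq x i ℚ.+ seq y i)
  (+-cauchy (seq x) (seq y) (cauchy x) (cauchy y))
x * y = mkℝ (λ i → seq x i ℚ.* seq y i)
  (*-cauchy (seq x) (seq y) (cauchy x) (cauchy y))

-_ : ℝ → ℝ
- x = mkℝ (λ i → ℚ.- seq x i) (neg-cauchy (seq x) (cauchy x))

_-_ : ℝ → ℝ → ℝ
x - y = x + (- y)

_^_ : ℝ → ℕ → ℝ
x ^ zero  = 1ℝ
x ^ suc k = x * x ^ k

abs : ℝ → ℝ
abs x = mkℝ (λ i → ℚ.∣ seq x i ∣) (∣∣-cauchy (seq x) (cauchy x))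

-- If x > 0 then all but finitely many terms of x are at least some fixed
-- positive rational, so the junk value of recip occurs only finitely often.

inv : (x : ℝ) → 0ℝ < x → ℝ
inv x (δ , 0<δ , N , h) = mkℝ (λ i → recip (seq x i))
  (recip-cauchy (seq x) (cauchy x) δ 0<δ
    (N , λ i i≥ → subst (ℚ._≤ seq x i) (ℚ.+-identityˡ δ) (h i i≥)))

-- λ as a function of p, n and m; for t_{p-1}(n) < m ≤ t_p(n) the denominator
-- is positive.

density : (p n m : ℕ) → ℚ
density p n m = (ℕ→ℚ m ℚ.- ℕ→ℚ (t (p ℕ.∸ 1) n))
              ÷ (ℕ→ℚ (t p n) ℚ.- ℕ→ℚ (t (p ℕ.∸ 1) n))

D : ℕ → ℝ
D p = fromℕ 4 * fromℕ p ^ 2 - fromℕ 11 * fromℕ p + fromℕ 8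

quartic : ℕ → ℚ → ℝ → ℝ
quartic p l x =
    P ^ 3 * D p * x ^ 4
  - fromℕ 2 * P ^ 2 * (P - fromℕ 2) ^ 2 * x ^ 3
  - fromℕ 2 * P * (P - fromℕ 2) * fromℚ l * x
  - fromℚ l ^ 2
  where
  P : ℝ
  P = fromℕ p

-- x is x_p(l).

record IsUniquePositiveRoot (p : ℕ) (l : ℚ) (x : ℝ) : Set where
  field
    positive : 0ℝ < x
    root     : quartic p l x ≃ 0ℝ
    unique   : ∀ x′ → 0ℝ < x′ → quartic p l x′ ≃ 0ℝ → x′ ≃ x

open IsUniquePositiveRoot public

-- In the next two definitions the divisions by 2p(p-1) and p-1 are made in ℚ;
-- these numbers are nonzero for p ≥ 2.

y[_] : (p : ℕ) (l : ℚ) (x : ℝ) → 0ℝ < x → ℝ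
y[ p ] l x x>0 =
    fromℚ (l ÷ (ℕ→ℚ 2 ℚ.* ℕ→ℚ p ℚ.* (ℕ→ℚ p ℚ.- 1ℚ))) * inv x x>0
  + fromℚ ((ℕ→ℚ p ℚ.- ℕ→ℚ 2) ÷ (ℕ→ℚ p ℚ.- 1ℚ)) * (1ℝ - fromℚ ½ * x)

Φ[_] : (p : ℕ) (l : ℚ) (x : ℝ) → 0ℝ < x → ℝ
Φ[ p ] l x x>0 =
  fromℚ ½ * (x ^ 2 + fromℚ (1ℚ ÷ (ℕ→ℚ p ℚ.- 1ℚ)) * y[ p ] l x x>0 ^ 2)

{-# OPTIONS --safe #-}

-- Write p = r + 1. For the lower bound, take a maximal fractional packing of
-- K_p's with total load at most 1 at every vertex, of total weight τ n, and
-- let ν be the spare load. For a clique c of the packing let V_i(c) be the set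
-- of vertices that can replace its i-th vertex. The V_i(c) are disjoint, two
-- vertices in the same V_i(c) are saturating, and a vertex sends at most p - 2
-- edges to c, plus one if it lies in some V_i(c). By maximality ν is supported
-- on a K_p-free set and misses one of the V_i(c): otherwise p - 1 copies of c
-- could be traded for p cliques. Counting edges between the packing and ν, and
-- inside ν by Turán's theorem, bounds m in terms of τ and the masses of the
-- V_i(c); counting saturating pairs inside the V_i(c) bounds f from below in
-- the same terms. Together they give f ≥ ½ (x² + y² / r) n² - O(n) for some x
-- and y with x y ≥ μ + a (x - x² / 2), where a = (r - 1) / r and
-- μ = λ / (2 p r), and the minimum of this convex problem is at x = x_p(λ).
-- To stay with integers, every vertex gets a large capacity L instead of 1.
--
-- The bound is attained by x n independent vertices that are joined to the
-- first y n vertices of the Turán graph with r parts on the other vertices.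

module Submission where

open import Data.Bool using (Bool; true; false; T; not; _∧_; _∨_; if_then_else_)
open import Data.Bool.Properties using (T?; ∨-comm; ∨-idem; ∧-zeroʳ; ∧-identityʳ)
open import Data.Empty using (⊥; ⊥-elim)
open import Data.Fin as Fin using (Fin; zero; suc; toℕ; finToFun; funToFin)
import Data.Fin.Properties as Fin
open import Data.Fin.Subset as Subset using (Subset; ∣_∣)
open import Data.Fin.Subset.Properties using (anySubset?)
open import Data.Integer as ℤ using ()
import Data.Integer.Properties as ℤ
open import Data.List as List using (List; []; _∷_; length; filter; allFin; cartesianProduct)
open import Data.Nat as ℕ using (ℕ; zero; suc; z≤n; s≤s; _∸_)
import Data.Nat.Base
open import Data.Nat.Divisibility as ℕ using (_∣?_; _∣_)
open import Data.Nat.DivMod as ℕ using ()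
import Data.Nat.Properties as ℕ
import Data.Nat.Tactic.RingSolver as ℕ-Ring
open import Data.Product using (Σ-syntax; ∃; ∃-syntax; _×_; _,_; proj₁; proj₂)
open import Data.Rational as ℚ using (ℚ; 0ℚ; 1ℚ; ½; toℚᵘ; mkℚ)
import Data.Rational.Base
import Data.Rational.Properties as ℚ
open import Data.Rational.Unnormalised as ℚᵘ using (mkℚᵘ)
import Data.Rational.Unnormalised.Properties as ℚᵘ
open import Data.Sum using (_⊎_; inj₁; inj₂; [_,_]′)
open import Data.Unit using (tt)
open import Data.Vec as Vec using ([]; _∷_)
import Data.Vec.Properties as Vec
open import Function using (_∘_; id)
open import Level using (0ℓ)
open import Relation.Binary.PropositionalEquality hiding ([_])
open import Relation.Nullary using (Dec; yes; no; ¬_; does; contradiction)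
open import Relation.Nullary.Decidable using (_×-dec_; _→-dec_; ¬?; decidable-stable; map′; dec⇒maybe)
open import Relation.Unary using (Decidable)
open import Tactic.RingSolver using (solve-∀)
open import Tactic.RingSolver.Core.AlmostCommutativeRing using (AlmostCommutativeRing; fromCommutativeRing)
open import Algebra.Properties.Semiring.Sum ℕ.+-*-semiring as Sum using ()

import Defs
open import Defs using (Graph; adj; adj-sym; adj-irrefl; Adj; pairs; edges; satCount; HasClique;
  hasClique?; IsSaturating; isSaturating?; addEdge; turán; t; IsMinimum; SatValue; IsMinSat;
  ℕ→ℚ; recip; recip-inverse; recip-pos; _÷_; density)

-- Finite sums and weighted Turán theorem

module _ where
  open Data.Nat.Base using (_+_; _*_; _≤_; _<_)

  -- Opaque, so that unification can read the summand off a sum.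

  opaque
    sum : ∀ {n} → (Fin n → ℕ) → ℕ
    sum f = Sum.sum f

    sum-suc : ∀ {n} (f : Fin (suc n) → ℕ) → sum f ≡ f zero + sum (f ∘ suc)
    sum-suc f = refl

    sum-empty : (f : Fin 0 → ℕ) → sum f ≡ 0
    sum-empty f = refl

    sum-cong : ∀ {n} {f g : Fin n → ℕ} → (∀ i → f i ≡ g i) → sum f ≡ sum g
    sum-cong = Sum.sum-cong-≗

    sum-+ : ∀ {n} (f g : Fin n → ℕ) → sum (λ i → f i + g i) ≡ sum f + sum g
    sum-+ = Sum.∑-distrib-+

    sum-swap : ∀ {m n} (f : Fin m → Fin n → ℕ) →
      sum (λ i → sum (f i)) ≡ sum (λ j → sum λ i → f i j)
    sum-swap = Sum.∑-comm

    *-sum : ∀ {n} a (f : Fin n → ℕ) → a * sum f ≡ sum (λ i → a * f i)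
    *-sum = Sum.*-distribˡ-sum

    sum-* : ∀ {n} a (f : Fin n → ℕ) → sum f * a ≡ sum (λ i → f i * a)
    sum-* = Sum.*-distribʳ-sum

    sum-mono : ∀ {n} {f g : Fin n → ℕ} → (∀ i → f i ≤ g i) → sum f ≤ sum g
    sum-mono {zero}  f≤g = z≤n
    sum-mono {suc n} f≤g = ℕ.+-mono-≤ (f≤g zero) (sum-mono (f≤g ∘ suc))

    sum-zero : ∀ {n} {f : Fin n → ℕ} → (∀ i → f i ≡ 0) → sum f ≡ 0
    sum-zero {n} f≡0 = trans (sum-cong f≡0) (Sum.sum-replicate-zero n)

    sum-const : ∀ n c → sum {n} (λ _ → c) ≡ n * c
    sum-const zero    c = refl
    sum-const (suc n) c = cong (c +_) (sum-const n c)

    term≤sum : ∀ {n} (f : Fin n → ℕ) i → f i ≤ sum f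
    term≤sum f zero    = ℕ.m≤m+n (f zero) _
    term≤sum f (suc i) = ℕ.≤-trans (term≤sum (f ∘ suc) i) (ℕ.m≤n+m _ (f zero))

    two-terms≤sum : ∀ {n} (f : Fin n → ℕ) {i j} → i ≢ j → f i + f j ≤ sum f
    two-terms≤sum f {zero}  {zero}  i≢j = contradiction refl i≢j
    two-terms≤sum f {zero}  {suc j} i≢j = ℕ.+-monoʳ-≤ (f zero) (term≤sum (f ∘ suc) j)
    two-terms≤sum f {suc i} {zero}  i≢j = ℕ.≤-trans
      (ℕ.≤-reflexive (ℕ.+-comm (f (suc i)) (f zero))) (ℕ.+-monoʳ-≤ (f zero) (term≤sum (f ∘ suc) i))
    two-terms≤sum f {suc i} {suc j} i≢j = ℕ.≤-trans
      (two-terms≤sum (f ∘ suc) (i≢j ∘ cong suc)) (ℕ.m≤n+m _ (f zero))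

    sum-at-most-one : ∀ {n} (f : Fin n → ℕ) → (∀ i → f i ≤ 1) →
      (∀ i j → 0 < f i → 0 < f j → i ≡ j) → sum f ≤ 1
    sum-at-most-one {zero}  f f≤1 uniq = z≤n
    sum-at-most-one {suc n} f f≤1 uniq with f zero in eq
    ... | zero  = sum-at-most-one (f ∘ suc) (f≤1 ∘ suc)
                    λ i j fi fj → Fin.suc-injective (uniq (suc i) (suc j) fi fj)
    ... | suc k = subst (λ s → suc k + s ≤ 1) (sym (sum-zero rest))
                    (subst (_≤ 1) (trans eq (sym (ℕ.+-identityʳ (suc k)))) (f≤1 zero))
      where
      rest : ∀ i → f (suc i) ≡ 0
      rest i with f (suc i) in eq′
      ... | zero = refl
      ... | suc _ with () ← uniq zero (suc i) (subst (0 <_) (sym eq) (s≤s z≤n))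
                              (subst (0 <_) (sym eq′) (s≤s z≤n))

    sum-δ : ∀ {n} (v : Fin n) (f : Fin n → ℕ) →
      sum (λ u → (if does (u Fin.≟ v) then 1 else 0) * f u) ≡ f v
    sum-δ {suc n} zero    f = trans (cong (f zero + 0 +_) (sum-zero {n} {λ u → 0} (λ _ → refl)))
      (trans (ℕ.+-identityʳ _) (ℕ.+-identityʳ _))
    sum-δ {suc n} (suc v) f = sum-δ v (f ∘ suc)

module _ where
  open Data.Nat.Base using (_+_; _*_; _≤_)

  argmax : ∀ {n} {P : Fin n → Set} → Decidable P → (f : Fin n → ℕ) →
    (∀ v → ¬ P v) ⊎ (∃[ v ] (P v × ∀ u → P u → f u ≤ f v))
  argmax {zero}  P? f = inj₁ λ ()
  argmax {suc n} P? f with P? zero | argmax (P? ∘ suc) (f ∘ suc)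
  ... | no ¬p | inj₁ none = inj₁ λ { zero → ¬p ; (suc i) → none i }
  ... | no ¬p | inj₂ (v , pv , best) =
    inj₂ (suc v , pv , λ { zero p → contradiction p ¬p ; (suc i) → best i })
  ... | yes p | inj₁ none =
    inj₂ (zero , p , λ { zero _ → ℕ.≤-refl ; (suc i) q → contradiction q (none i) })
  ... | yes p | inj₂ (v , pv , best) with ℕ.≤-total (f zero) (f (suc v))
  ...   | inj₁ le = inj₂ (suc v , pv , λ { zero _ → le ; (suc i) → best i })
  ...   | inj₂ ge = inj₂ (zero , p ,
    λ { zero _ → ℕ.≤-refl ; (suc i) q → ℕ.≤-trans (best i q) ge })

χ : Bool → ℕ
χ b = if b then 1 else 0

χ≤1 : ∀ b → χ b ℕ.≤ 1
χ≤1 true  = s≤s z≤n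
χ≤1 false = z≤n

χ-true : ∀ {b} → 0 ℕ.< χ b → T b
χ-true {true} _ = tt

χ-false : ∀ {b} → ¬ T b → χ b ≡ 0
χ-false {true}  ¬t = contradiction tt ¬t
χ-false {false} ¬t = refl

χ-mono : ∀ {b c} → (T b → T c) → χ b ℕ.≤ χ c
χ-mono {false}        f = z≤n
χ-mono {true} {true}  f = s≤s z≤n
χ-mono {true} {false} f = ⊥-elim (f tt)

χ-pos : ∀ {b} → T b → 1 ℕ.≤ χ b
χ-pos {true} _ = s≤s z≤n

χ-one : ∀ {b} → T b → χ b ≡ 1
χ-one {true} _ = refl

χ-not : ∀ b → χ b ℕ.+ χ (not b) ≡ 1
χ-not true  = refl
χ-not false = refl

*-swap : ∀ a b c → a ℕ.* (b ℕ.* c) ≡ b ℕ.* (a ℕ.* c)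
*-swap = ℕ-Ring.solve-∀

T-does⁻ : ∀ {a} {P : Set a} (P? : Dec P) → T (does P?) → P
T-does⁻ (yes p) _ = p

T-does⁺ : ∀ {a} {P : Set a} (P? : Dec P) → P → T (does P?)
T-does⁺ (yes _) _ = tt
T-does⁺ (no ¬p) p = contradiction p ¬p

module _ {n : ℕ} where

  ⟨_,_⟩[_] : (f g : Fin n → ℕ) → (Fin n → Fin n → Bool) → ℕ
  ⟨ f , g ⟩[ R ] = sum λ u → f u ℕ.* sum λ v → g v ℕ.* χ (R u v)

  module _ (R : Fin n → Fin n → Bool) where
    open Data.Nat.Base using (_+_; _*_; _≤_)
    open ≡-Reasoning

    ⟨⟩-+ˡ : ∀ f f′ g → ⟨ (λ u → f u + f′ u) , g ⟩[ R ] ≡ ⟨ f , g ⟩[ R ] + ⟨ f′ , g ⟩[ R ]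
    ⟨⟩-+ˡ f f′ g = trans (sum-cong λ u → ℕ.*-distribʳ-+ _ (f u) (f′ u)) (sum-+ _ _)

    ⟨⟩-+ʳ : ∀ f g g′ → ⟨ f , (λ u → g u + g′ u) ⟩[ R ] ≡ ⟨ f , g ⟩[ R ] + ⟨ f , g′ ⟩[ R ]
    ⟨⟩-+ʳ f g g′ = trans (sum-cong λ u → trans
      (cong (f u *_) (trans (sum-cong λ v → ℕ.*-distribʳ-+ _ (g v) (g′ v)) (sum-+ _ _)))
      (ℕ.*-distribˡ-+ (f u) _ _)) (sum-+ _ _)

    ⟨⟩-comm : (∀ u v → R u v ≡ R v u) → ∀ f g → ⟨ f , g ⟩[ R ] ≡ ⟨ g , f ⟩[ R ]
    ⟨⟩-comm R-sym f g = begin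
      sum (λ u → f u * sum λ v → g v * χ (R u v))
        ≡⟨ sum-cong (λ u → *-sum (f u) _) ⟩
      sum (λ u → sum λ v → f u * (g v * χ (R u v)))
        ≡⟨ sum-swap (λ u v → f u * (g v * χ (R u v))) ⟩
      sum (λ v → sum λ u → f u * (g v * χ (R u v)))
        ≡⟨ sum-cong (λ v → sum-cong λ u → trans
             (cong (λ b → f u * (g v * χ b)) (R-sym u v)) (*-swap (f u) (g v) (χ (R v u)))) ⟩
      sum (λ v → sum λ u → g v * (f u * χ (R v u)))
        ≡⟨ sum-cong (λ v → *-sum (g v) _) ⟨
      sum (λ v → g v * sum λ u → f u * χ (R v u)) ∎

    ⟨⟩-square : (∀ u v → R u v ≡ R v u) → ∀ f g →
      ⟨ (λ u → f u + g u) , (λ u → f u + g u) ⟩[ R ]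
        ≡ ⟨ f , f ⟩[ R ] + 2 * ⟨ f , g ⟩[ R ] + ⟨ g , g ⟩[ R ]
    ⟨⟩-square R-sym f g = begin
      ⟨ (λ u → f u + g u) , (λ u → f u + g u) ⟩[ R ]
        ≡⟨ ⟨⟩-+ˡ f g (λ u → f u + g u) ⟩
      ⟨ f , (λ u → f u + g u) ⟩[ R ] + ⟨ g , (λ u → f u + g u) ⟩[ R ]
        ≡⟨ cong₂ _+_ (⟨⟩-+ʳ f f g) (⟨⟩-+ʳ g f g) ⟩
      (⟨ f , f ⟩[ R ] + ⟨ f , g ⟩[ R ]) + (⟨ g , f ⟩[ R ] + ⟨ g , g ⟩[ R ])
        ≡⟨ cong (λ x → (⟨ f , f ⟩[ R ] + ⟨ f , g ⟩[ R ]) + (x + ⟨ g , g ⟩[ R ])) (⟨⟩-comm R-sym g f) ⟩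
      (⟨ f , f ⟩[ R ] + ⟨ f , g ⟩[ R ]) + (⟨ f , g ⟩[ R ] + ⟨ g , g ⟩[ R ])
        ≡⟨ collect ⟨ f , f ⟩[ R ] ⟨ f , g ⟩[ R ] ⟨ g , g ⟩[ R ] ⟩
      ⟨ f , f ⟩[ R ] + 2 * ⟨ f , g ⟩[ R ] + ⟨ g , g ⟩[ R ] ∎
      where
      collect : ∀ a b c → (a + b) + (b + c) ≡ a + 2 * b + c
      collect = ℕ-Ring.solve-∀

Clique : ∀ {n} → Graph n → (k : ℕ) → Set
Clique {n} G k = Σ[ c ∈ (Fin k → Fin n) ] (∀ i j → i ≢ j → Adj G (c i) (c j))

module _ {n : ℕ} (G : Graph n) where
  open Data.Nat.Base using (_+_; _*_; _≤_)

  cons-clique : ∀ {k} v ((c , _) : Clique G k) → (∀ i → Adj G v (c i)) →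
    Σ[ (c′ , _) ∈ Clique G (suc k) ] (c′ zero ≡ v × (∀ i → c′ (suc i) ≡ c i))
  cons-clique {k} v (c , cl) adj-v = (c′ , cl′) , refl , λ _ → refl
    where
    c′ : Fin (suc k) → Fin n
    c′ zero    = v
    c′ (suc i) = c i
    cl′ : ∀ i j → i ≢ j → Adj G (c′ i) (c′ j)
    cl′ zero    zero    i≢j = contradiction refl i≢j
    cl′ zero    (suc j) i≢j = adj-v j
    cl′ (suc i) zero    i≢j = subst T (adj-sym G v (c i)) (adj-v i)
    cl′ (suc i) (suc j) i≢j = cl i j (i≢j ∘ cong suc)

  -- The number q plays the size of a part. The step splits off the
  -- non-neighbours of a vertex of maximum degree; if k is their total weight,
  -- it comes down to (k - q)(k - q - 1) ≥ 0.

  weighted-turán : ∀ r q (ν : Fin n → ℕ) →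
    (∀ ((c , _) : Clique G (suc r)) → ¬ (∀ i → 0 ℕ.< ν (c i))) →
    ⟨ ν , ν ⟩[ adj G ] + (2 * q + 1) * sum ν ≤ sum ν * sum ν + r * (q * (q + 1))
  weighted-turán r q ν free with argmax (λ v → 0 ℕ.<? ν v) (λ u → sum λ v → ν v * χ (adj G u v))
  weighted-turán r q ν free | inj₁ none =
    subst (λ x → x + (2 * q + 1) * sum ν ≤ sum ν * sum ν + r * (q * (q + 1)))
      (sym (sum-zero λ u → cong (_* sum λ v → ν v * χ (adj G u v)) (ν≡0 u)))
      (subst (λ x → (2 * q + 1) * x ≤ x * x + r * (q * (q + 1))) (sym (sum-zero ν≡0))
        (subst (_≤ r * (q * (q + 1))) (sym (ℕ.*-zeroʳ (2 * q + 1))) z≤n))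
    where
    ν≡0 : ∀ v → ν v ≡ 0
    ν≡0 v = ℕ.n≤0⇒n≡0 (ℕ.≮⇒≥ (none v))
  weighted-turán zero q ν free | inj₂ (v , ν>0 , best) =
    ⊥-elim (free ((λ _ → v) , λ { zero zero i≢j → contradiction refl i≢j }) λ _ → ν>0)
  weighted-turán (suc r) q ν free | inj₂ (v , ν>0 , best) = begin
    ⟨ ν , ν ⟩[ adj G ] + (2 * q + 1) * sum ν
      ≤⟨ ℕ.+-mono-≤ degree-bound (ℕ.≤-reflexive (cong ((2 * q + 1) *_) ν-split)) ⟩
    ⟨ in′ , in′ ⟩[ adj G ] + 2 * (k * D) + (2 * q + 1) * (D + k)
      ≡⟨ regroup ⟨ in′ , in′ ⟩[ adj G ] (2 * (k * D)) (2 * q + 1) D k ⟩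
    (⟨ in′ , in′ ⟩[ adj G ] + (2 * q + 1) * D) + (2 * (k * D) + (2 * q + 1) * k)
      ≤⟨ ℕ.+-mono-≤ (weighted-turán r q in′ free′) (ℕ.+-monoʳ-≤ (2 * (k * D)) (integer-square k q)) ⟩
    (D * D + r * (q * (q + 1))) + (2 * (k * D) + (k * k + q * (q + 1)))
      ≡⟨ collect D k r (q * (q + 1)) ⟩
    (D + k) * (D + k) + suc r * (q * (q + 1))
      ≡⟨ cong (λ x → x * x + suc r * (q * (q + 1))) ν-split ⟨
    sum ν * sum ν + suc r * (q * (q + 1)) ∎
    where
    open ℕ.≤-Reasoning
    in′ out : Fin n → ℕ
    in′ u = ν u * χ (adj G v u)
    out u = ν u * χ (not (adj G v u))
    D k : ℕ
    D = sum in′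
    k = sum out
    split : ∀ u → ν u ≡ in′ u + out u
    split u with adj G v u
    ... | true  = sym (trans (cong₂ _+_ (ℕ.*-identityʳ (ν u)) (ℕ.*-zeroʳ (ν u))) (ℕ.+-identityʳ _))
    ... | false = sym (cong₂ _+_ (ℕ.*-zeroʳ (ν u)) (ℕ.*-identityʳ (ν u)))
    ν-split : sum ν ≡ D + k
    ν-split = trans (sum-cong split) (sum-+ in′ out)
    integer-square : ∀ k q → (2 * q + 1) * k ≤ k * k + q * (q + 1)
    integer-square k q with ℕ.≤-total k q
    ... | inj₁ k≤q with d , refl ← ℕ.m≤n⇒∃[o]m+o≡n k≤q =
      subst ((2 * (k + d) + 1) * k ≤_) (eq k d) (ℕ.m≤m+n _ (d * (d + 1)))
      where
      eq : ∀ k d → (2 * (k + d) + 1) * k + d * (d + 1) ≡ k * k + (k + d) * (k + d + 1)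
      eq = ℕ-Ring.solve-∀
    ... | inj₂ q≤k with ℕ.m≤n⇒∃[o]m+o≡n q≤k
    ...   | zero , refl = ℕ.≤-reflexive (eq q)
      where
      eq : ∀ q → (2 * q + 1) * (q + 0) ≡ (q + 0) * (q + 0) + q * (q + 1)
      eq = ℕ-Ring.solve-∀
    ...   | suc d , refl =
      subst ((2 * q + 1) * (q + suc d) ≤_) (eq q d) (ℕ.m≤m+n _ (d * (d + 1)))
      where
      eq : ∀ q d → (2 * q + 1) * (q + suc d) + d * (d + 1) ≡ (q + suc d) * (q + suc d) + q * (q + 1)
      eq q d = trans (cong (λ z → (2 * q + 1) * z + d * (d + 1)) (ℕ.+-suc q d)) (trans (eq′ q d)
        (cong (λ z → z * z + q * (q + 1)) (sym (ℕ.+-suc q d))))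
        where
        eq′ : ∀ q d → (2 * q + 1) * (1 + (q + d)) + d * (d + 1)
                    ≡ (1 + (q + d)) * (1 + (q + d)) + q * (q + 1)
        eq′ = ℕ-Ring.solve-∀
    degree-bound : ⟨ ν , ν ⟩[ adj G ] ≤ ⟨ in′ , in′ ⟩[ adj G ] + 2 * (k * D)
    degree-bound = begin
      ⟨ ν , ν ⟩[ adj G ]
        ≡⟨ sum-cong (λ u → cong₂ _*_ (split u)
             (sum-cong λ w → cong (_* χ (adj G u w)) (split w))) ⟩
      ⟨ (λ u → in′ u + out u) , (λ u → in′ u + out u) ⟩[ adj G ]
        ≡⟨ ⟨⟩-square (adj G) (adj-sym G) in′ out ⟩
      ⟨ in′ , in′ ⟩[ adj G ] + 2 * ⟨ in′ , out ⟩[ adj G ] + ⟨ out , out ⟩[ adj G ]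
        ≡⟨ cong (λ x → ⟨ in′ , in′ ⟩[ adj G ] + 2 * x + ⟨ out , out ⟩[ adj G ])
             (⟨⟩-comm (adj G) (adj-sym G) in′ out) ⟩
      ⟨ in′ , in′ ⟩[ adj G ] + 2 * ⟨ out , in′ ⟩[ adj G ] + ⟨ out , out ⟩[ adj G ]
        ≤⟨ ℕ.m≤m+n _ _ ⟩
      (⟨ in′ , in′ ⟩[ adj G ] + 2 * ⟨ out , in′ ⟩[ adj G ] + ⟨ out , out ⟩[ adj G ]) + ⟨ out , out ⟩[ adj G ]
        ≡⟨ regroup′ ⟨ in′ , in′ ⟩[ adj G ] ⟨ out , in′ ⟩[ adj G ] ⟨ out , out ⟩[ adj G ] ⟩
      ⟨ in′ , in′ ⟩[ adj G ] + 2 * (⟨ out , in′ ⟩[ adj G ] + ⟨ out , out ⟩[ adj G ])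
        ≡⟨ cong (λ x → ⟨ in′ , in′ ⟩[ adj G ] + 2 * x) (⟨⟩-+ʳ (adj G) out in′ out) ⟨
      ⟨ in′ , in′ ⟩[ adj G ] + 2 * ⟨ out , (λ u → in′ u + out u) ⟩[ adj G ]
        ≡⟨ cong (λ x → ⟨ in′ , in′ ⟩[ adj G ] + 2 * x)
             (sum-cong (λ u → cong (out u *_) (sum-cong λ w → cong (_* χ (adj G u w)) (split w)))) ⟨
      ⟨ in′ , in′ ⟩[ adj G ] + 2 * ⟨ out , ν ⟩[ adj G ]
        ≤⟨ ℕ.+-monoʳ-≤ ⟨ in′ , in′ ⟩[ adj G ] (ℕ.*-monoʳ-≤ 2 (sum-mono bound)) ⟩
      ⟨ in′ , in′ ⟩[ adj G ] + 2 * sum (λ u → out u * D)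
        ≡⟨ cong (λ x → ⟨ in′ , in′ ⟩[ adj G ] + 2 * x) (sum-* D out) ⟨
      ⟨ in′ , in′ ⟩[ adj G ] + 2 * (k * D) ∎
      where
      regroup′ : ∀ a b c → (a + 2 * b + c) + c ≡ a + 2 * (b + c)
      regroup′ = ℕ-Ring.solve-∀
      bound : ∀ u → out u * sum (λ w → ν w * χ (adj G u w)) ≤ out u * D
      bound u with 0 ℕ.<? ν u
      ... | yes pos = ℕ.*-monoʳ-≤ (out u) (best u pos)
      ... | no ¬pos = subst (λ x → x * χ (not (adj G v u)) * sum (λ w → ν w * χ (adj G u w)) ≤ out u * D)
                        (sym (ℕ.n≤0⇒n≡0 (ℕ.≮⇒≥ ¬pos))) z≤n
    regroup : ∀ a b c d k → a + b + c * (d + k) ≡ (a + c * d) + (b + c * k)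
    regroup = ℕ-Ring.solve-∀
    collect : ∀ d k r s → (d * d + r * s) + (2 * (k * d) + (k * k + s)) ≡ (d + k) * (d + k) + (1 + r) * s
    collect = ℕ-Ring.solve-∀
    in-pos : ∀ u → 0 ℕ.< in′ u → 0 ℕ.< ν u × Adj G v u
    in-pos u pos with ν u | adj G v u
    ... | suc _ | true  = s≤s z≤n , tt
    ... | suc m | false = contradiction (subst (0 ℕ.<_) (ℕ.*-zeroʳ (suc m)) pos) λ ()
    ... | zero  | true  = contradiction pos λ ()
    ... | zero  | false = contradiction pos λ ()
    free′ : ∀ ((c , _) : Clique G (suc r)) → ¬ (∀ i → 0 ℕ.< in′ (c i))
    free′ (c , cl) pos with cons-clique v (c , cl) (λ i → proj₂ (in-pos (c i) (pos i)))
    ... | C , eq₀ , eq₊ = free C λ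
      { zero    → subst (λ x → 0 ℕ.< ν x) (sym eq₀) ν>0
      ; (suc i) → subst (λ x → 0 ℕ.< ν x) (sym (eq₊ i)) (proj₁ (in-pos (c i) (pos i))) }

-- Clique packings

module _ where
  open Data.Nat.Base using (_+_; _*_; _≤_; _<_)
  open ℕ.≤-Reasoning

  am-gm : ∀ a b → 2 * (a * b) ≤ a * a + b * b
  am-gm a b with ℕ.≤-total a b
  ... | inj₁ a≤b with d , refl ← ℕ.m≤n⇒∃[o]m+o≡n a≤b =
    ℕ.≤-trans (ℕ.m≤m+n _ (d * d)) (ℕ.≤-reflexive (eq a d))
    where
    eq : ∀ a d → 2 * (a * (a + d)) + d * d ≡ a * a + (a + d) * (a + d)
    eq = ℕ-Ring.solve-∀
  ... | inj₂ b≤a with d , refl ← ℕ.m≤n⇒∃[o]m+o≡n b≤a =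
    ℕ.≤-trans (ℕ.m≤m+n _ (d * d)) (ℕ.≤-reflexive (eq b d))
    where
    eq : ∀ b d → 2 * ((b + d) * b) + d * d ≡ (b + d) * (b + d) + b * b
    eq = ℕ-Ring.solve-∀

  sum-others : ∀ {r} (i₀ : Fin (suc r)) → sum (λ i → χ (not (does (i Fin.≟ i₀)))) ≡ r
  sum-others {r} i₀ = ℕ.suc-injective (begin-equality
    1 + sum (λ i → χ (not (does (i Fin.≟ i₀))))
      ≡⟨ cong (_+ sum (λ i → χ (not (does (i Fin.≟ i₀))))) (sum-δ i₀ (λ _ → 1)) ⟨
    sum (λ i → χ (does (i Fin.≟ i₀)) * 1) + sum (λ i → χ (not (does (i Fin.≟ i₀))))
      ≡⟨ sum-+ _ _ ⟨
    sum (λ i → χ (does (i Fin.≟ i₀)) * 1 + χ (not (does (i Fin.≟ i₀))))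
      ≡⟨ sum-cong (λ i → trans (cong (_+ χ (not (does (i Fin.≟ i₀)))) (ℕ.*-identityʳ _)) (χ-not (does (i Fin.≟ i₀)))) ⟩
    sum {suc r} (λ _ → 1)
      ≡⟨ sum-const (suc r) 1 ⟩
    suc r * 1
      ≡⟨ ℕ.*-identityʳ (suc r) ⟩
    suc r ∎)

IsTuple : ∀ {n} → Graph n → ∀ {k} → (Fin k → Fin n) → Set
IsTuple G c = ∀ i j → i ≢ j → Adj G (c i) (c j)

isTuple? : ∀ {n} (G : Graph n) {k} (c : Fin k → Fin n) → Dec (IsTuple G c)
isTuple? G c = Fin.all? λ i → Fin.all? λ j → ¬? (i Fin.≟ j) →-dec T? (adj G (c i) (c j))

module Swap {n : ℕ} (G : Graph n) where

  -- swaps c i u: replacing the i-th vertex of the clique c by u gives a clique.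

  swaps? : ∀ {k} (c : Fin k → Fin n) i u → Dec (∀ j → j ≢ i → Adj G u (c j))
  swaps? c i u = Fin.all? λ j → ¬? (j Fin.≟ i) →-dec T? (adj G u (c j))

  swaps : ∀ {k} (c : Fin k → Fin n) → Fin k → Fin n → Bool
  swaps c i u = does (swaps? c i u)

load : ∀ {n p K} → (Fin K → Fin p → Fin n) → (Fin K → ℕ) → Fin n → ℕ
load q μ u = sum λ k → μ k ℕ.* sum λ i → χ (does (u Fin.≟ q k i))

module Packing {n : ℕ} (G : Graph n) (r : ℕ) (free : ¬ Clique G (suc (suc r)))
  {K : ℕ} (q : Fin K → Fin (suc r) → Fin n) (μ : Fin K → ℕ)
  (tuple : ∀ k → 0 ℕ.< μ k → IsTuple G (q k)) where

  open Swap G public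
  open Data.Nat.Base using (_+_; _*_; _≤_; _<_)
  open ℕ.≤-Reasoning

  private
    p : ℕ
    p = suc r

  total : ℕ
  total = sum μ

  mass : Fin n → ℕ
  mass = load q μ

  swapSum : (Fin n → ℕ) → Fin K → Fin p → ℕ
  swapSum g k i = sum λ v → g v * χ (swaps (q k) i v)

  swapTotal : (Fin n → ℕ) → ℕ
  swapTotal g = sum λ k → μ k * sum (swapSum g k)

  μ-mono : ∀ k {x y} → (IsTuple G (q k) → x ≤ y) → μ k * x ≤ μ k * y
  μ-mono k {x} {y} x≤y with 0 ℕ.<? μ k
  ... | yes μ>0 = ℕ.*-monoʳ-≤ (μ k) (x≤y (tuple k μ>0))
  ... | no ¬μ>0 rewrite ℕ.n≤0⇒n≡0 (ℕ.≮⇒≥ ¬μ>0) = z≤n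

  sum-mass : ∀ h → sum (λ u → mass u * h u) ≡ sum λ k → μ k * sum λ i → h (q k i)
  sum-mass h = begin-equality
    sum (λ u → mass u * h u)
      ≡⟨ sum-cong (λ u → trans (sum-* (h u) _) (sum-cong λ k →
           trans (ℕ.*-assoc (μ k) _ (h u)) (cong (μ k *_) (sum-* (h u) _)))) ⟩
    sum (λ u → sum λ k → μ k * sum λ i → χ (does (u Fin.≟ q k i)) * h u)
      ≡⟨ sum-swap _ ⟩
    sum (λ k → sum λ u → μ k * sum λ i → χ (does (u Fin.≟ q k i)) * h u)
      ≡⟨ sum-cong (λ k → trans (sym (*-sum (μ k) _)) (cong (μ k *_) (sum-swap _))) ⟩
    sum (λ k → μ k * sum λ i → sum λ u → χ (does (u Fin.≟ q k i)) * h u)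
      ≡⟨ sum-cong (λ k → cong (μ k *_) (sum-cong λ i → sum-δ (q k i) h)) ⟩
    sum (λ k → μ k * sum λ i → h (q k i)) ∎

  mass-total : sum mass ≡ p * total
  mass-total = begin-equality
    sum mass                            ≡⟨ sum-cong (λ u → ℕ.*-identityʳ (mass u)) ⟨
    sum (λ u → mass u * 1)              ≡⟨ sum-mass (λ _ → 1) ⟩
    sum (λ k → μ k * sum {p} λ i → 1)   ≡⟨ sum-cong (λ k → cong (μ k *_)
                                             (trans (sum-const p 1) (ℕ.*-identityʳ p))) ⟩
    sum (λ k → μ k * p)                 ≡⟨ sum-* p μ ⟨
    total * p                           ≡⟨ ℕ.*-comm total p ⟩
    p * total                           ∎

  swaps-disjoint : ∀ c → IsTuple G {p} c → ∀ u → sum (λ i → χ (swaps c i u)) ≤ 1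
  swaps-disjoint c cl u = sum-at-most-one _ (λ i → χ≤1 _) uniq
    where
    uniq : ∀ i j → 0 < χ (swaps c i u) → 0 < χ (swaps c j u) → i ≡ j
    uniq i j si sj with i Fin.≟ j
    ... | yes i≡j = i≡j
    ... | no  i≢j = ⊥-elim (free (proj₁ (cons-clique G u (c , cl) all)))
      where
      all : ∀ k → Adj G u (c k)
      all k with k Fin.≟ i
      ... | no k≢i = T-does⁻ (swaps? c i u) (χ-true si) k k≢i
      ... | yes refl = T-does⁻ (swaps? c j u) (χ-true sj) k i≢j

  adjacent-count : ∀ c → IsTuple G {p} c → ∀ u →
    suc (sum (λ i → χ (adj G (c i) u))) ≤ r + sum (λ i → χ (swaps c i u))
  adjacent-count c cl u = ℕ.s≤s⁻¹ (begin
    2 + A      ≤⟨ ℕ.+-monoˡ-≤ A two ⟩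
    B + S + A  ≡⟨ regroup B S A ⟩
    A + B + S  ≡⟨ cong (_+ S) total′ ⟩
    p + S      ∎)
    where
    A B S : ℕ
    A = sum λ i → χ (adj G (c i) u)
    B = sum λ i → χ (not (adj G (c i) u))
    S = sum λ i → χ (swaps c i u)
    regroup : ∀ a b c → a + b + c ≡ c + a + b
    regroup = ℕ-Ring.solve-∀
    total′ : A + B ≡ p
    total′ = begin-equality
      A + B ≡⟨ sum-+ _ _ ⟨
      sum (λ i → χ (adj G (c i) u) + χ (not (adj G (c i) u))) ≡⟨ sum-cong (λ i → χ-not (adj G (c i) u)) ⟩
      sum {p} (λ _ → 1) ≡⟨ trans (sum-const p 1) (ℕ.*-identityʳ p) ⟩
      p ∎
    non-adj : ∀ i → ¬ Adj G u (c i) → χ (not (adj G (c i) u)) ≡ 1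
    non-adj i ¬a with adj G (c i) u in eq
    ... | false = refl
    ... | true = contradiction (subst T (trans (sym eq) (adj-sym G (c i) u)) tt) ¬a
    two : 2 ≤ B + S
    two with Fin.any? (λ i → ¬? (T? (adj G u (c i))))
    ... | no none = ⊥-elim (free (proj₁ (cons-clique G u (c , cl)
                      λ i → decidable-stable (T? _) λ ¬a → none (i , ¬a))))
    ... | yes (i , ¬a) with Fin.any? (λ j → ¬? (j Fin.≟ i) ×-dec ¬? (T? (adj G u (c j))))
    ...   | yes (j , j≢i , ¬b) = ℕ.≤-trans (ℕ.≤-trans
              (ℕ.≤-reflexive (sym (cong₂ _+_ (non-adj j ¬b) (non-adj i ¬a))))
              (two-terms≤sum _ j≢i)) (ℕ.m≤m+n B S)
    ...   | no none = ℕ.+-mono-≤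
              (ℕ.≤-trans (ℕ.≤-reflexive (sym (non-adj i ¬a))) (term≤sum _ i))
              (ℕ.≤-trans (χ-pos (T-does⁺ (swaps? c i u)
                λ j j≢i → decidable-stable (T? _) λ ¬b → none (j , j≢i , ¬b)))
                (term≤sum (λ i → χ (swaps c i u)) i))

  swapSum-comm : ∀ g k → sum (swapSum g k) ≡ sum λ v → g v * sum λ i → χ (swaps (q k) i v)
  swapSum-comm g k = trans (sum-swap _) (sum-cong λ v → sym (*-sum (g v) _))

  swapTotal-mass : swapTotal mass ≤ p * (total * total)
  swapTotal-mass = begin
    swapTotal mass
      ≤⟨ sum-mono (λ k → μ-mono k λ cl → begin
           sum (swapSum mass k) ≡⟨ swapSum-comm mass k ⟩
           sum (λ v → mass v * sum λ i → χ (swaps (q k) i v))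
             ≤⟨ sum-mono (λ v → ℕ.*-monoʳ-≤ (mass v) (swaps-disjoint (q k) cl v)) ⟩
           sum (λ v → mass v * 1) ≡⟨ sum-cong (λ v → ℕ.*-identityʳ (mass v)) ⟩
           sum mass ≡⟨ mass-total ⟩
           p * total ∎) ⟩
    sum (λ k → μ k * (p * total)) ≡⟨ sum-* _ μ ⟨
    total * (p * total)           ≡⟨ *-swap total p total ⟩
    p * (total * total)           ∎

  ⟨mass,_⟩-bound : ∀ g → ⟨ mass , g ⟩[ adj G ] + total * sum g ≤ r * (total * sum g) + swapTotal g
  ⟨mass, g ⟩-bound = begin
    ⟨ mass , g ⟩[ adj G ] + total * sum g
      ≡⟨ cong₂ _+_ (sum-mass _) (sum-* (sum g) μ) ⟩
    sum (λ k → μ k * sum λ i → sum λ v → g v * χ (adj G (q k i) v)) + sum (λ k → μ k * sum g)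
      ≡⟨ trans (sym (sum-+ _ _)) (sum-cong λ k → sym (ℕ.*-distribˡ-+ (μ k) _ _)) ⟩
    sum (λ k → μ k * (sum (λ i → sum λ v → g v * χ (adj G (q k i) v)) + sum g))
      ≤⟨ sum-mono (λ k → μ-mono k (clique-bound k)) ⟩
    sum (λ k → μ k * (r * sum g + sum (swapSum g k)))
      ≡⟨ trans (sum-cong λ k → ℕ.*-distribˡ-+ (μ k) _ _) (sum-+ _ _) ⟩
    sum (λ k → μ k * (r * sum g)) + swapTotal g
      ≡⟨ cong (_+ swapTotal g) (trans (sym (sum-* _ μ)) (*-swap total r (sum g))) ⟩
    r * (total * sum g) + swapTotal g ∎
    where
    clique-bound : ∀ k → IsTuple G (q k) →
      sum (λ i → sum λ v → g v * χ (adj G (q k i) v)) + sum g ≤ r * sum g + sum (swapSum g k)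
    clique-bound k cl = begin
      sum (λ i → sum λ v → g v * χ (adj G (q k i) v)) + sum g
        ≡⟨ cong (_+ sum g) (trans (sum-swap _) (sum-cong λ v → sym (*-sum (g v) _))) ⟩
      sum (λ v → g v * sum λ i → χ (adj G (q k i) v)) + sum g
        ≡⟨ trans (sym (sum-+ _ _)) (sum-cong λ v →
             trans (ℕ.+-comm _ (g v)) (sym (ℕ.*-suc (g v) _))) ⟩
      sum (λ v → g v * suc (sum λ i → χ (adj G (q k i) v)))
        ≤⟨ sum-mono (λ v → ℕ.*-monoʳ-≤ (g v) (adjacent-count (q k) cl v)) ⟩
      sum (λ v → g v * (r + sum λ i → χ (swaps (q k) i v)))
        ≡⟨ trans (sum-cong λ v → trans (ℕ.*-distribˡ-+ (g v) r _) 
             (cong (_+ g v * sum (λ i → χ (swaps (q k) i v))) (ℕ.*-comm (g v) r)))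
             (sum-+ _ _) ⟩
      sum (λ v → r * g v) + sum (λ v → g v * sum λ i → χ (swaps (q k) i v))
        ≡⟨ cong₂ _+_ (*-sum r g) (swapSum-comm g k) ⟨
      r * sum g + sum (swapSum g k) ∎

  module _ (ν : Fin n → ℕ) where

    edge-bound :
      ⟨ (λ u → mass u + ν u) , (λ u → mass u + ν u) ⟩[ adj G ] + (p * (total * total) + 2 * (total * sum ν))
      ≤ (r * (p * (total * total) + 2 * (total * sum ν)) + (swapTotal mass + 2 * swapTotal ν))
        + ⟨ ν , ν ⟩[ adj G ]
    edge-bound = begin
      ⟨ (λ u → mass u + ν u) , (λ u → mass u + ν u) ⟩[ adj G ] + (p * (total * total) + 2 * (total * sum ν))
        ≡⟨ cong₂ _+_ (⟨⟩-square (adj G) (adj-sym G) mass ν)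
             (cong (_+ 2 * (total * sum ν)) (sym mass-square)) ⟩
      (⟨ mass , mass ⟩[ adj G ] + 2 * ⟨ mass , ν ⟩[ adj G ] + ⟨ ν , ν ⟩[ adj G ])
        + (total * sum mass + 2 * (total * sum ν))
        ≡⟨ regroup ⟨ mass , mass ⟩[ adj G ] ⟨ mass , ν ⟩[ adj G ] ⟨ ν , ν ⟩[ adj G ]
             (total * sum mass) (total * sum ν) ⟩
      (⟨ mass , mass ⟩[ adj G ] + total * sum mass)
        + 2 * (⟨ mass , ν ⟩[ adj G ] + total * sum ν) + ⟨ ν , ν ⟩[ adj G ]
        ≤⟨ ℕ.+-monoˡ-≤ _ (ℕ.+-mono-≤ ⟨mass, mass ⟩-bound (ℕ.*-monoʳ-≤ 2 ⟨mass, ν ⟩-bound)) ⟩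
      (r * (total * sum mass) + swapTotal mass)
        + 2 * (r * (total * sum ν) + swapTotal ν) + ⟨ ν , ν ⟩[ adj G ]
        ≡⟨ cong (_+ ⟨ ν , ν ⟩[ adj G ]) (trans
             (regroup′ r (total * sum mass) (swapTotal mass) (total * sum ν) (swapTotal ν))
             (cong (λ x → r * (x + 2 * (total * sum ν)) + (swapTotal mass + 2 * swapTotal ν)) mass-square)) ⟩
      (r * (p * (total * total) + 2 * (total * sum ν)) + (swapTotal mass + 2 * swapTotal ν))
        + ⟨ ν , ν ⟩[ adj G ] ∎
      where
      mass-square : total * sum mass ≡ p * (total * total)
      mass-square = trans (cong (total *_) mass-total) (*-swap total p total)
      regroup : ∀ a b c x y → (a + 2 * b + c) + (x + 2 * y) ≡ (a + x) + 2 * (b + y) + c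
      regroup = ℕ-Ring.solve-∀
      regroup′ : ∀ r x a y b → (r * x + a) + 2 * (r * y + b) ≡ r * (x + 2 * y) + (a + 2 * b)
      regroup′ = ℕ-Ring.solve-∀

    module Saturation (σ : Fin n → Fin n → Bool) (σ-sym : ∀ u v → σ u v ≡ σ v u)
      (σ-swaps : ∀ (c : Fin (suc r) → Fin n) → IsTuple G c → ∀ i u v → T (swaps c i u) → T (swaps c i v) → T (σ u v)) where

      own-swap : ∀ {c} → IsTuple G {p} c → ∀ i → T (swaps c i (c i))
      own-swap {c} cl i = T-does⁺ (swaps? c i (c i)) λ j j≢i → cl i j (j≢i ∘ sym)

      mass-pairs : ∀ g → swapTotal g ≤ ⟨ mass , g ⟩[ σ ]
      mass-pairs g = begin
        swapTotal g
          ≤⟨ sum-mono (λ k → μ-mono k λ cl → sum-mono λ i → sum-mono λ v →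
               ℕ.*-monoʳ-≤ (g v) (χ-mono (σ-swaps (q k) cl i (q k i) v (own-swap cl i)))) ⟩
        sum (λ k → μ k * sum λ i → sum λ v → g v * χ (σ (q k i) v))
          ≡⟨ sum-mass _ ⟨
        ⟨ mass , g ⟩[ σ ] ∎

      saturation-bound : swapTotal mass + 2 * swapTotal ν + ⟨ ν , ν ⟩[ σ ]
        ≤ ⟨ (λ u → mass u + ν u) , (λ u → mass u + ν u) ⟩[ σ ]
      saturation-bound = begin
        swapTotal mass + 2 * swapTotal ν + ⟨ ν , ν ⟩[ σ ]
          ≤⟨ ℕ.+-monoˡ-≤ _ (ℕ.+-mono-≤ (mass-pairs mass) (ℕ.*-monoʳ-≤ 2 (mass-pairs ν))) ⟩
        ⟨ mass , mass ⟩[ σ ] + 2 * ⟨ mass , ν ⟩[ σ ] + ⟨ ν , ν ⟩[ σ ]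
          ≡⟨ ⟨⟩-square σ σ-sym mass ν ⟨
        ⟨ (λ u → mass u + ν u) , (λ u → mass u + ν u) ⟩[ σ ] ∎

      swap-squares : sum (λ k → μ k * sum λ i → swapSum ν k i * swapSum ν k i) ≤ total * ⟨ ν , ν ⟩[ σ ]
      swap-squares = begin
        sum (λ k → μ k * sum λ i → swapSum ν k i * swapSum ν k i)
          ≤⟨ sum-mono (λ k → μ-mono k (clique-bound k)) ⟩
        sum (λ k → μ k * ⟨ ν , ν ⟩[ σ ])
          ≡⟨ sum-* _ μ ⟨
        total * ⟨ ν , ν ⟩[ σ ] ∎
        where
        clique-bound : ∀ k → IsTuple G (q k) →
          sum (λ i → swapSum ν k i * swapSum ν k i) ≤ ⟨ ν , ν ⟩[ σ ]
        clique-bound k cl = begin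
          sum (λ i → swapSum ν k i * swapSum ν k i)
            ≡⟨ sum-cong (λ i → sum-* (swapSum ν k i) _) ⟩
          sum (λ i → sum λ u → ν u * χ (swaps (q k) i u) * swapSum ν k i)
            ≤⟨ sum-mono (λ i → sum-mono λ u → pair-bound i u) ⟩
          sum (λ i → sum λ u → ν u * σ-weight u * χ (swaps (q k) i u))
            ≡⟨ trans (sum-swap _) (sum-cong λ u → sym (*-sum (ν u * σ-weight u) _)) ⟩
          sum (λ u → ν u * σ-weight u * sum λ i → χ (swaps (q k) i u))
            ≤⟨ sum-mono (λ u → ℕ.≤-trans
                 (ℕ.*-monoʳ-≤ (ν u * σ-weight u) (swaps-disjoint (q k) cl u))
                 (ℕ.≤-reflexive (ℕ.*-identityʳ _))) ⟩
          ⟨ ν , ν ⟩[ σ ] ∎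
          where
          σ-weight : Fin n → ℕ
          σ-weight u = sum λ v → ν v * χ (σ u v)
          pair-bound : ∀ i u → ν u * χ (swaps (q k) i u) * swapSum ν k i
                             ≤ ν u * σ-weight u * χ (swaps (q k) i u)
          pair-bound i u with swaps (q k) i u in eq
          ... | false = ℕ.≤-reflexive (trans (cong (_* swapSum ν k i) (ℕ.*-zeroʳ (ν u))) (sym (ℕ.*-zeroʳ (ν u * σ-weight u))))
          ... | true = begin
            ν u * 1 * swapSum ν k i ≡⟨ cong (_* swapSum ν k i) (ℕ.*-identityʳ (ν u)) ⟩
            ν u * swapSum ν k i
              ≤⟨ ℕ.*-monoʳ-≤ (ν u) (sum-mono λ v → ℕ.*-monoʳ-≤ (ν v)
                   (χ-mono (σ-swaps (q k) cl i u v (subst T (sym eq) tt)))) ⟩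
            ν u * σ-weight u ≡⟨ ℕ.*-identityʳ _ ⟨
            ν u * σ-weight u * 1 ∎

      -- If at most r of the p positions of c can be filled from ν, the r-th
      -- part of the square of their sum bounds the sum of squares; here in
      -- linearised form with slope a/b. The exceptional cliques, with μ k < r,
      -- have p = r + 1 such positions.

      swap-sum-bound : (∀ k → r ≤ μ k → ∃[ i ] swapSum ν k i ≡ 0) → ∀ a b →
        2 * (a * (b * swapTotal ν))
          ≤ b * b * (total * ⟨ ν , ν ⟩[ σ ]) + (r * total + r * K) * (a * a)
      swap-sum-bound unfillable a b = begin
        2 * (a * (b * swapTotal ν))
          ≡⟨ trans (assoc a b (swapTotal ν)) (*-sum (2 * (a * b)) _) ⟩
        sum (λ k → 2 * (a * b) * (μ k * sum (swapSum ν k)))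
          ≤⟨ sum-mono clique-bound ⟩
        sum (λ k → b * b * (μ k * squares k) + (r * μ k + r) * (a * a))
          ≡⟨ trans (sum-+ _ _) (cong₂ _+_ (sym (*-sum (b * b) _))
               (trans (sym (sum-* (a * a) _)) (cong (_* (a * a)) (trans (sum-+ _ _)
                 (cong₂ _+_ (sym (*-sum r μ)) (trans (sum-const K r) (ℕ.*-comm K r))))))) ⟩
        b * b * sum (λ k → μ k * squares k) + (r * total + r * K) * (a * a)
          ≤⟨ ℕ.+-monoˡ-≤ _ (ℕ.*-monoʳ-≤ (b * b) swap-squares) ⟩
        b * b * (total * ⟨ ν , ν ⟩[ σ ]) + (r * total + r * K) * (a * a) ∎
        where
        squares : Fin K → ℕ
        squares k = sum λ i → swapSum ν k i * swapSum ν k i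
        assoc : ∀ a b s → 2 * (a * (b * s)) ≡ 2 * (a * b) * s
        assoc = ℕ-Ring.solve-∀
        tangent : ∀ x → 2 * (a * b) * x ≤ b * b * (x * x) + a * a
        tangent x = ℕ.≤-trans (ℕ.≤-reflexive (eq a b x)) (ℕ.≤-trans (am-gm (b * x) a) (ℕ.≤-reflexive (eq′ a b x)))
          where
          eq : ∀ a b x → 2 * (a * b) * x ≡ 2 * (b * x * a)
          eq = ℕ-Ring.solve-∀
          eq′ : ∀ a b x → b * x * (b * x) + a * a ≡ b * b * (x * x) + a * a
          eq′ = ℕ-Ring.solve-∀
        tangents : ∀ k (e : Fin p → ℕ) → (∀ i → 2 * (a * b) * swapSum ν k i
            ≤ b * b * (swapSum ν k i * swapSum ν k i) + e i * (a * a)) →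
          2 * (a * b) * sum (swapSum ν k) ≤ b * b * squares k + sum e * (a * a)
        tangents k e le = begin
          2 * (a * b) * sum (swapSum ν k)
            ≡⟨ *-sum (2 * (a * b)) _ ⟩
          sum (λ i → 2 * (a * b) * swapSum ν k i)
            ≤⟨ sum-mono le ⟩
          sum (λ i → b * b * (swapSum ν k i * swapSum ν k i) + e i * (a * a))
            ≡⟨ trans (sum-+ _ _) (cong₂ _+_ (sym (*-sum (b * b) _)) (sym (sum-* (a * a) e))) ⟩
          b * b * squares k + sum e * (a * a) ∎
        clique-bound : ∀ k → 2 * (a * b) * (μ k * sum (swapSum ν k))
                           ≤ b * b * (μ k * squares k) + (r * μ k + r) * (a * a)
        clique-bound k with r ℕ.≤? μ k
        ... | yes r≤μ with i₀ , zero-at ← unfillable k r≤μ = begin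
          2 * (a * b) * (μ k * sum (swapSum ν k))
            ≡⟨ *-swap (2 * (a * b)) (μ k) _ ⟩
          μ k * (2 * (a * b) * sum (swapSum ν k))
            ≤⟨ ℕ.*-monoʳ-≤ (μ k) (tangents k _ other) ⟩
          μ k * (b * b * squares k + sum (λ i → χ (not (does (i Fin.≟ i₀)))) * (a * a))
            ≡⟨ cong (λ x → μ k * (b * b * squares k + x * (a * a))) (sum-others i₀) ⟩
          μ k * (b * b * squares k + r * (a * a))
            ≤⟨ ℕ.m≤m+n _ (r * (a * a)) ⟩
          μ k * (b * b * squares k + r * (a * a)) + r * (a * a)
            ≡⟨ collect (μ k) (b * b) (squares k) r (a * a) ⟩
          b * b * (μ k * squares k) + (r * μ k + r) * (a * a) ∎
          where
          collect : ∀ m b s r a → m * (b * s + r * a) + r * a ≡ b * (m * s) + (r * m + r) * a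
          collect = ℕ-Ring.solve-∀
          other : ∀ i → 2 * (a * b) * swapSum ν k i
            ≤ b * b * (swapSum ν k i * swapSum ν k i) + χ (not (does (i Fin.≟ i₀))) * (a * a)
          other i with i Fin.≟ i₀
          ... | no _ = ℕ.≤-trans (tangent (swapSum ν k i))
                         (ℕ.≤-reflexive (cong (b * b * (swapSum ν k i * swapSum ν k i) +_) (sym (ℕ.+-identityʳ (a * a)))))
          ... | yes refl = subst (λ x → 2 * (a * b) * x ≤ b * b * (x * x) + 0) (sym zero-at)
            (ℕ.≤-trans (ℕ.≤-reflexive (ℕ.*-zeroʳ (2 * (a * b)))) z≤n)
        ... | no r≰μ = begin
          2 * (a * b) * (μ k * sum (swapSum ν k))
            ≡⟨ *-swap (2 * (a * b)) (μ k) _ ⟩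
          μ k * (2 * (a * b) * sum (swapSum ν k))
            ≤⟨ ℕ.*-monoʳ-≤ (μ k) (tangents k (λ _ → 1) λ i → ℕ.≤-trans (tangent (swapSum ν k i))
                 (ℕ.≤-reflexive (cong (b * b * (swapSum ν k i * swapSum ν k i) +_) (sym (ℕ.+-identityʳ (a * a)))))) ⟩
          μ k * (b * b * squares k + sum {p} (λ _ → 1) * (a * a))
            ≡⟨ cong (λ x → μ k * (b * b * squares k + x * (a * a)))
                 (trans (sum-const p 1) (ℕ.*-identityʳ p)) ⟩
          μ k * (b * b * squares k + p * (a * a))
            ≡⟨ expand (μ k) (b * b) (squares k) r (a * a) ⟩
          b * b * (μ k * squares k) + (r * μ k + μ k) * (a * a)
            ≤⟨ ℕ.+-monoʳ-≤ _ (ℕ.*-monoˡ-≤ (a * a) (ℕ.+-monoʳ-≤ (r * μ k) (ℕ.<⇒≤ (ℕ.≰⇒> r≰μ)))) ⟩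
          b * b * (μ k * squares k) + (r * μ k + r) * (a * a) ∎
          where
          expand : ∀ m b s r a → m * (b * s + (1 + r) * a) ≡ b * (m * s) + (r * m + m) * a
          expand = ℕ-Ring.solve-∀

module _ where
  open Data.Nat.Base using (_+_; _*_; _≤_; _<_)

  sum-pos : ∀ {n} {f : Fin n → ℕ} → 0 < sum f → ∃[ i ] 0 < f i
  sum-pos {f = f} pos with Fin.any? (λ i → 0 ℕ.<? f i)
  ... | yes found = found
  ... | no  none  = contradiction
    (subst (0 <_) (sum-zero λ i → ℕ.n≤0⇒n≡0 (ℕ.≮⇒≥ λ fi → none (i , fi))) pos) λ ()

  unit : ∀ {K} → Fin K → Fin K → ℕ
  unit k k′ = χ (does (k′ Fin.≟ k))

  unit-pos : ∀ {K} {k k′ : Fin K} → 0 < unit k k′ → k′ ≡ k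
  unit-pos {k = k} {k′} = T-does⁻ (k′ Fin.≟ k) ∘ χ-true

  module _ {n p K : ℕ} (q : Fin K → Fin p → Fin n) where

    load-+ : ∀ μ μ′ u → load q (λ k → μ k + μ′ k) u ≡ load q μ u + load q μ′ u
    load-+ μ μ′ u = trans (sum-cong λ k → ℕ.*-distribʳ-+ _ (μ k) (μ′ k)) (sum-+ _ _)

    load-* : ∀ a μ u → load q (λ k → a * μ k) u ≡ a * load q μ u
    load-* a μ u = trans (sum-cong λ k → ℕ.*-assoc a (μ k) _) (sym (*-sum a _))

    load-sum : ∀ {m} (μ : Fin m → Fin K → ℕ) u →
      load q (λ k → sum λ i → μ i k) u ≡ sum λ i → load q (μ i) u
    load-sum μ u = trans (sum-cong λ k → sum-* _ (λ i → μ i k)) (sum-swap _)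

    load-unit : ∀ k u → load q (unit k) u ≡ sum λ i → χ (does (u Fin.≟ q k i))
    load-unit k u = sum-δ k _

  sum-unit : ∀ {K} (k : Fin K) → sum (unit k) ≡ 1
  sum-unit k = trans (sum-cong λ k′ → sym (ℕ.*-identityʳ (unit k k′))) (sum-δ k (λ _ → 1))

module _ {n : ℕ} (G : Graph n) where
  open Swap G

  private
    irrefl : ∀ u → ¬ Adj G u u
    irrefl u a = subst T (adj-irrefl G u) a

  tuple-injective : ∀ {k} {c : Fin k → Fin n} → IsTuple G c → ∀ i j → c i ≡ c j → i ≡ j
  tuple-injective {c = c} cl i j eq with i Fin.≟ j
  ... | yes i≡j = i≡j
  ... | no  i≢j = contradiction (subst (Adj G (c i)) (sym eq) (cl i j i≢j)) (irrefl (c i))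

  replace : ∀ {k} → (Fin k → Fin n) → Fin k → Fin n → Fin k → Fin n
  replace c i u j = if does (j Fin.≟ i) then u else c j

  replace-tuple : ∀ {k} {c : Fin k → Fin n} → IsTuple G c → ∀ i u → T (swaps c i u) →
    IsTuple G (replace c i u)
  replace-tuple {c = c} cl i u s j j′ j≢j′ with j Fin.≟ i | j′ Fin.≟ i
  ... | yes refl | yes refl = contradiction refl j≢j′
  ... | yes refl | no j′≢i  = T-does⁻ (swaps? c i u) s j′ j′≢i
  ... | no j≢i   | yes refl = subst T (adj-sym G u (c j)) (T-does⁻ (swaps? c i u) s j j≢i)
  ... | no j≢i   | no j′≢i  = cl j j′ j≢j′

  isTuple-≗ : ∀ {k} {c d : Fin k → Fin n} → (∀ i → d i ≡ c i) → IsTuple G c → IsTuple G d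
  isTuple-≗ eq cl i j i≢j = subst₂ (Adj G) (sym (eq i)) (sym (eq j)) (cl i j i≢j)

module MaximalPacking {n : ℕ} (G : Graph n) (r : ℕ) (1≤r : 1 ℕ.≤ r)
  (free : ¬ Clique G (suc (suc r))) (L : ℕ) where

  open Data.Nat.Base using (_+_; _*_; _≤_; _<_)
  open Swap G

  p K : ℕ
  p = suc r
  K = n ℕ.^ p

  q : Fin K → Fin p → Fin n
  q = finToFun

  code : ∀ (c : Fin p → Fin n) i → q (funToFin c) i ≡ c i
  code = Fin.finToFun-funToFin

  record Valid (μ : Fin K → ℕ) : Set where
    field
      tuple    : ∀ k → 0 < μ k → IsTuple G (q k)
      capacity : ∀ u → load q μ u ≤ L
      large    : L ≤ sum μ

  open Valid

  module P (μ : Fin K → ℕ) (valid : Valid μ) = Packing G r free q μ (tuple valid)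

  spare : (Fin K → ℕ) → Fin n → ℕ
  spare μ u = L ∸ load q μ u

  augment : ∀ {μ} → Valid μ → ∀ ρ → (∀ k → 0 < ρ k → IsTuple G (q k)) → sum ρ ≡ suc (sum μ) →
    (w : Fin p → Fin n) → (∀ i j → w i ≡ w j → i ≡ j) → (∀ i → 0 < spare μ (w i)) →
    (∀ u → load q ρ u ≡ load q μ u + sum λ i → χ (does (u Fin.≟ w i))) → Valid ρ
  augment {μ} valid ρ ρ-tuple ρ-total w w-injective room ρ-load = record
    { tuple    = ρ-tuple
    ; capacity = λ u → subst (_≤ L) (sym (ρ-load u)) (fits u)
    ; large    = ℕ.≤-trans (large valid) (ℕ.≤-trans (ℕ.n≤1+n _) (ℕ.≤-reflexive (sym ρ-total)))
    }
    where
    fits : ∀ u → load q μ u + sum (λ i → χ (does (u Fin.≟ w i))) ≤ L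
    fits u with Fin.any? (λ i → u Fin.≟ w i)
    ... | no none = ℕ.≤-trans (ℕ.≤-reflexive (trans (cong (load q μ u +_)
            (sum-zero λ i → χ-false λ t → none (i , T-does⁻ (u Fin.≟ w i) t))) (ℕ.+-identityʳ _)))
            (capacity valid u)
    ... | yes (i , refl) = ℕ.≤-trans (ℕ.+-monoʳ-≤ (load q μ u)
            (sum-at-most-one _ (λ i → χ≤1 _) λ i j ui uj → w-injective i j (trans
              (sym (T-does⁻ (u Fin.≟ w i) (χ-true ui))) (T-does⁻ (u Fin.≟ w j) (χ-true uj)))))
            (ℕ.≤-trans (ℕ.≤-reflexive (ℕ.+-comm _ 1)) (ℕ.m∸n≢0⇒n<m (λ eq → contradiction (subst (0 <_) eq (room i)) λ ())))

  add-clique : ∀ {μ} → Valid μ → ((c , _) : Clique G p) → (∀ i → 0 < spare μ (c i)) →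
    ∃[ ρ ] (Valid ρ × sum ρ ≡ suc (sum μ))
  add-clique {μ} valid (c , cl) room = ρ , augment valid ρ ρ-tuple ρ-total c
      (tuple-injective G cl) room ρ-load , ρ-total
    where
    k₀ : Fin K
    k₀ = funToFin c
    ρ : Fin K → ℕ
    ρ k = unit k₀ k + μ k
    ρ-total : sum ρ ≡ suc (sum μ)
    ρ-total = trans (sum-+ _ _) (cong (_+ sum μ) (sum-unit k₀))
    ρ-tuple : ∀ k → 0 < ρ k → IsTuple G (q k)
    ρ-tuple k pos with k Fin.≟ k₀
    ... | yes refl = isTuple-≗ G (code c) cl
    ... | no _     = tuple valid k pos
    ρ-load : ∀ u → load q ρ u ≡ load q μ u + sum λ i → χ (does (u Fin.≟ c i))
    ρ-load u = trans (load-+ q (unit k₀) μ u) (trans (ℕ.+-comm _ (load q μ u))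
      (cong (load q μ u +_) (trans (load-unit q k₀ u)
        (sum-cong λ i → cong (λ z → χ (does (u Fin.≟ z))) (code c i)))))

  -- Trades r copies of a clique c for the r + 1 cliques c[i ↦ w i]: every
  -- vertex of c belongs to exactly r of these.

  exchange : ∀ {μ} → Valid μ → ∀ k → r ≤ μ k →
    (w : Fin p → Fin n) → (∀ i → T (swaps (q k) i (w i))) → (∀ i → 0 < spare μ (w i)) →
    ∃[ ρ ] (Valid ρ × sum ρ ≡ suc (sum μ))
  exchange {μ} valid k r≤μ w w-swaps room = ρ , augment valid ρ ρ-tuple ρ-total w
      w-injective room ρ-load , ρ-total
    where
    cl : IsTuple G (q k)
    cl = tuple valid k (ℕ.≤-trans 1≤r r≤μ)
    kᵢ : Fin p → Fin K
    kᵢ i = funToFin (replace G (q k) i (w i))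
    new : Fin K → ℕ
    new k′ = sum λ i → unit (kᵢ i) k′
    old : Fin K → ℕ
    old k′ = μ k′ ∸ r * unit k k′
    ρ : Fin K → ℕ
    ρ k′ = old k′ + new k′

    μ-split : ∀ k′ → μ k′ ≡ old k′ + r * unit k k′
    μ-split k′ = sym (ℕ.m∸n+n≡m below)
      where
      below : r * unit k k′ ≤ μ k′
      below with k′ Fin.≟ k
      ... | yes refl = ℕ.≤-trans (ℕ.≤-reflexive (ℕ.*-identityʳ r)) r≤μ
      ... | no _     = ℕ.≤-trans (ℕ.≤-reflexive (ℕ.*-zeroʳ r)) z≤n

    ρ-total : sum ρ ≡ suc (sum μ)
    ρ-total = begin
      sum ρ                              ≡⟨ sum-+ old new ⟩
      sum old + sum new                  ≡⟨ cong (sum old +_) new-total ⟩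
      sum old + p                        ≡⟨ ℕ.+-suc (sum old) r ⟩
      suc (sum old + r)                  ≡⟨ cong (λ x → suc (sum old + x)) unit-total ⟨
      suc (sum old + sum λ k′ → r * unit k k′) ≡⟨ cong suc (sum-+ old _) ⟨
      suc (sum λ k′ → old k′ + r * unit k k′)  ≡⟨ cong suc (sum-cong μ-split) ⟨
      suc (sum μ)                        ∎
      where
      open ≡-Reasoning
      new-total : sum new ≡ p
      new-total = trans (sum-swap _) (trans (sum-cong λ i → sum-unit (kᵢ i))
        (trans (sum-const p 1) (ℕ.*-identityʳ p)))
      unit-total : sum (λ k′ → r * unit k k′) ≡ r
      unit-total = trans (sym (*-sum r _)) (trans (cong (r *_) (sum-unit k)) (ℕ.*-identityʳ r))

    ρ-tuple : ∀ k′ → 0 < ρ k′ → IsTuple G (q k′)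
    ρ-tuple k′ pos with 0 ℕ.<? new k′
    ... | no ¬new = tuple valid k′ (ℕ.≤-trans (subst (0 <_) (trans (cong (old k′ +_)
            (ℕ.n≤0⇒n≡0 (ℕ.≮⇒≥ ¬new))) (ℕ.+-identityʳ _)) pos) (ℕ.m∸n≤m (μ k′) (r * unit k k′)))
    ... | yes new>0 with i , ui ← sum-pos new>0 =
      subst (IsTuple G ∘ q) (sym (unit-pos {k = kᵢ i} {k′} ui))
        (isTuple-≗ G (code (replace G (q k) i (w i))) (replace-tuple G cl i (w i) (w-swaps i)))

    w-injective : ∀ i j → w i ≡ w j → i ≡ j
    w-injective i j eq with i Fin.≟ j
    ... | yes i≡j = i≡j
    ... | no  i≢j = contradiction (ℕ.≤-trans
            (ℕ.+-mono-≤ (χ-pos (w-swaps i)) (χ-pos (subst (T ∘ swaps (q k) j) (sym eq) (w-swaps j))))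
            (ℕ.≤-trans (two-terms≤sum (λ i′ → χ (swaps (q k) i′ (w i))) i≢j)
              (P.swaps-disjoint μ valid (q k) cl (w i)))) λ { (s≤s ()) }

    ρ-load : ∀ u → load q ρ u ≡ load q μ u + sum λ i → χ (does (u Fin.≟ w i))
    ρ-load u = begin
      load q ρ u                      ≡⟨ load-+ q old new u ⟩
      load q old u + load q new u     ≡⟨ cong (load q old u +_) (trans new-load (ℕ.+-comm W (r * S))) ⟩
      load q old u + (r * S + W)      ≡⟨ ℕ.+-assoc (load q old u) _ W ⟨
      load q old u + r * S + W        ≡⟨ cong (_+ W) μ-load ⟨
      load q μ u + W                  ∎
      where
      open ≡-Reasoning
      S W : ℕ
      S = sum λ j → χ (does (u Fin.≟ q k j))
      W = sum λ i → χ (does (u Fin.≟ w i))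
      μ-load : load q μ u ≡ load q old u + r * S
      μ-load = trans (sum-cong λ k′ → cong (_* _) (μ-split k′)) (trans (load-+ q old _ u)
        (cong (load q old u +_) (trans (load-* q r (unit k) u) (cong (r *_) (load-unit q k u)))))
      hits : Fin p → Fin p → ℕ
      hits i j = χ (does (u Fin.≟ replace G (q k) i (w i) j))
      hits-sum : ∀ i → sum (hits i) + χ (does (u Fin.≟ q k i)) ≡ χ (does (u Fin.≟ w i)) + S
      hits-sum i = trans (cong (sum (hits i) +_) (sym (sum-δ i _))) (trans (sym (sum-+ (hits i) _))
        (trans (sum-cong at) (trans (sum-+ _ _) (cong (_+ S) (sum-δ i λ _ → χ (does (u Fin.≟ w i)))))))
        where
        at : ∀ j → hits i j + χ (does (j Fin.≟ i)) * χ (does (u Fin.≟ q k j))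
                 ≡ χ (does (j Fin.≟ i)) * χ (does (u Fin.≟ w i)) + χ (does (u Fin.≟ q k j))
        at j with j Fin.≟ i
        ... | yes refl = cong₂ _+_ (sym (ℕ.*-identityˡ (χ (does (u Fin.≟ w j)))))
            (ℕ.*-identityˡ (χ (does (u Fin.≟ q k j))))
        ... | no _     = ℕ.+-identityʳ _
      new-load : load q new u ≡ W + r * S
      new-load = trans (load-sum q (λ i → unit (kᵢ i)) u) (trans
        (sum-cong λ i → trans (load-unit q (kᵢ i) u)
          (sum-cong λ j → cong (λ z → χ (does (u Fin.≟ z))) (code (replace G (q k) i (w i)) j)))
        (ℕ.+-cancelʳ-≡ S _ _ (begin
          sum (λ i → sum (hits i)) + S ≡⟨ sum-+ _ _ ⟨
          sum (λ i → sum (hits i) + χ (does (u Fin.≟ q k i))) ≡⟨ sum-cong hits-sum ⟩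
          sum (λ i → χ (does (u Fin.≟ w i)) + S) ≡⟨ sum-+ _ _ ⟩
          W + sum {p} (λ _ → S) ≡⟨ cong (W +_) (trans (sum-const p S) (ℕ.+-comm S (r * S))) ⟩
          W + (r * S + S) ≡⟨ ℕ.+-assoc W _ S ⟨
          W + r * S + S ∎)))

  total-bound : ∀ {μ} → Valid μ → sum μ ≤ n * L
  total-bound {μ} valid = begin
    sum μ               ≤⟨ ℕ.m≤m+n (sum μ) (r * sum μ) ⟩
    p * sum μ           ≡⟨ P.mass-total μ valid ⟨
    sum (load q μ)      ≤⟨ sum-mono (capacity valid) ⟩
    sum {n} (λ _ → L)   ≡⟨ sum-const n L ⟩
    n * L               ∎
    where open ℕ.≤-Reasoning

  concentrated : ((c , _) : Clique G p) → ∃ Valid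
  concentrated (c , cl) = (λ k → L * unit k₀ k) , record
    { tuple = λ k pos → subst (IsTuple G ∘ q) (sym (unit-pos {k = k₀} (positive k pos)))
        (isTuple-≗ G (code c) cl)
    ; capacity = λ u → ℕ.≤-trans (ℕ.≤-reflexive (trans (load-* q L (unit k₀) u)
        (cong (L *_) (load-unit q k₀ u)))) (ℕ.≤-trans (ℕ.*-monoʳ-≤ L (sum-at-most-one _ (λ i → χ≤1 _)
          λ i j ui uj → tuple-injective G (isTuple-≗ G (code c) cl) i j (trans
            (sym (T-does⁻ (u Fin.≟ q k₀ i) (χ-true ui))) (T-does⁻ (u Fin.≟ q k₀ j) (χ-true uj)))))
        (ℕ.≤-reflexive (ℕ.*-identityʳ L)))
    ; large = ℕ.≤-reflexive (sym (trans (sym (*-sum L (unit k₀)))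
        (trans (cong (L *_) (sum-unit k₀)) (ℕ.*-identityʳ L))))
    }
    where
    k₀ : Fin K
    k₀ = funToFin c
    positive : ∀ k → 0 < L * unit k₀ k → 0 < unit k₀ k
    positive k pos with unit k₀ k
    ... | suc _ = s≤s z≤n
    ... | zero  = contradiction (subst (0 <_) (ℕ.*-zeroʳ L) pos) λ ()

  maximal : ∀ {Goal : Set} → Dec Goal → Clique G p →
    (∀ μ (valid : Valid μ) →
      (∀ ((c , _) : Clique G p) → ¬ (∀ i → 0 < spare μ (c i))) →
      (∀ k → r ≤ μ k → ∃[ i ] P.swapSum μ valid (spare μ) k i ≡ 0) → Goal) →
    Goal
  maximal {Goal} goal? clique use = decidable-stable goal? λ ¬goal →
    let μ , valid = concentrated clique in climb ¬goal (suc (n * L)) μ valid (ℕ.m≤n+m _ (sum μ))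
    where
    climb : ¬ Goal → ∀ fuel μ → Valid μ → suc (n * L) ≤ sum μ + fuel → ⊥
    climb ¬goal zero μ valid enough = ℕ.<⇒≱ (subst (n * L <_) (ℕ.+-identityʳ _) enough) (total-bound valid)
    climb ¬goal (suc fuel) μ valid enough = ¬goal (use μ valid
      (λ c room → improve (add-clique valid c room)) unfillable)
      where
      improve : ∃[ ρ ] (Valid ρ × sum ρ ≡ suc (sum μ)) → ⊥
      improve (ρ , ρ-valid , eq) = climb ¬goal fuel ρ ρ-valid
        (ℕ.≤-trans enough (ℕ.≤-reflexive (trans (ℕ.+-suc (sum μ) fuel) (cong (_+ fuel) (sym eq)))))
      unfillable : ∀ k → r ≤ μ k → ∃[ i ] P.swapSum μ valid (spare μ) k i ≡ 0
      unfillable k r≤μ with Fin.any? (λ i → P.swapSum μ valid (spare μ) k i ℕ.≟ 0)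
      ... | yes found = found
      ... | no none = ⊥-elim (improve (exchange valid k r≤μ (proj₁ ∘ filler)
              (λ i → χ-true (proj₂ (positive i (proj₂ (filler i)))))
              (λ i → proj₁ (positive i (proj₂ (filler i))))))
        where
        filler : ∀ i → ∃[ v ] 0 < spare μ v * χ (swaps (q k) i v)
        filler i = sum-pos (ℕ.n≢0⇒n>0 λ eq → none (i , eq))
        positive : ∀ i {v} → 0 < spare μ v * χ (swaps (q k) i v) → 0 < spare μ v × 0 < χ (swaps (q k) i v)
        positive i {v} pos with spare μ v | χ (swaps (q k) i v)
        ... | suc _ | suc _ = s≤s z≤n , s≤s z≤n
        ... | suc a | zero  = contradiction (subst (0 <_) (ℕ.*-zeroʳ (suc a)) pos) λ ()

-- Counting pairs of vertices

module _ where
  open Data.Nat.Base using (_+_; _*_; _≤_; _<_)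

  listSum : ∀ {A : Set} → (A → ℕ) → List A → ℕ
  listSum f = List.foldr (λ x s → f x + s) 0

  length-filter-filter : ∀ {A : Set} {P Q : A → Set} (P? : Decidable P) (Q? : Decidable Q) xs →
    length (filter P? (filter Q? xs)) ≡ listSum (λ x → χ (does (Q? x)) * χ (does (P? x))) xs
  length-filter-filter P? Q? [] = refl
  length-filter-filter P? Q? (x ∷ xs) with does (Q? x)
  ... | false = length-filter-filter P? Q? xs
  ... | true with does (P? x)
  ...   | true  = cong suc (length-filter-filter P? Q? xs)
  ...   | false = length-filter-filter P? Q? xs

  listSum-++ : ∀ {A : Set} (f : A → ℕ) xs ys → listSum f (xs List.++ ys) ≡ listSum f xs + listSum f ys
  listSum-++ f []       ys = refl
  listSum-++ f (x ∷ xs) ys = trans (cong (f x +_) (listSum-++ f xs ys)) (sym (ℕ.+-assoc (f x) _ _))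

  listSum-map : ∀ {A B : Set} (f : B → ℕ) (g : A → B) xs → listSum f (List.map g xs) ≡ listSum (f ∘ g) xs
  listSum-map f g []       = refl
  listSum-map f g (x ∷ xs) = cong (f (g x) +_) (listSum-map f g xs)

  listSum-tabulate : ∀ {A : Set} {n} (f : A → ℕ) (g : Fin n → A) → listSum f (List.tabulate g) ≡ sum (f ∘ g)
  listSum-tabulate {n = zero}  f g = sym (sum-empty _)
  listSum-tabulate {n = suc n} f g =
    trans (cong (f (g zero) +_) (listSum-tabulate f (g ∘ suc))) (sym (sum-suc (f ∘ g)))

  listSum-product : ∀ {A B : Set} (f : A × B → ℕ) xs ys →
    listSum f (cartesianProduct xs ys) ≡ listSum (λ x → listSum (λ y → f (x , y)) ys) xs
  listSum-product f []       ys = refl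
  listSum-product f (x ∷ xs) ys = trans (listSum-++ f (List.map (x ,_) ys) _)
    (cong₂ _+_ (listSum-map f (x ,_) ys) (listSum-product f xs ys))

  sum< : ∀ {n} → (Fin n → Fin n → ℕ) → ℕ
  sum< h = sum λ u → sum λ v → χ (does (u Fin.<? v)) * h u v

  count-pairs : ∀ {n} {P : Fin n × Fin n → Set} (P? : Decidable P) →
    length (filter P? (pairs n)) ≡ sum< λ u v → χ (does (P? (u , v)))
  count-pairs {n} P? = trans (length-filter-filter P? _ (cartesianProduct (allFin n) (allFin n)))
    (trans (listSum-product _ (allFin n) (allFin n)) (trans (listSum-tabulate _ id)
      (sum-cong λ u → listSum-tabulate _ id)))

  sum<-mono : ∀ {n} {h h′ : Fin n → Fin n → ℕ} → (∀ {u v} → u Fin.< v → h u v ≤ h′ u v) →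
    sum< h ≤ sum< h′
  sum<-mono {h = h} {h′} le = sum-mono λ u → sum-mono λ v → at u v
    where
    at : ∀ u v → χ (does (u Fin.<? v)) * h u v ≤ χ (does (u Fin.<? v)) * h′ u v
    at u v with toℕ u ℕ.<ᵇ toℕ v | ℕ.<ᵇ⇒< (toℕ u) (toℕ v)
    ... | true  | u<v = ℕ.+-monoˡ-≤ 0 (le (u<v tt))
    ... | false | _   = z≤n

  sum<-cong : ∀ {n} {h h′ : Fin n → Fin n → ℕ} → (∀ u v → h u v ≡ h′ u v) → sum< h ≡ sum< h′
  sum<-cong eq = sum-cong λ u → sum-cong λ v → cong (χ (does (u Fin.<? v)) *_) (eq u v)

  double-sum : ∀ {n} (h : Fin n → Fin n → ℕ) → (∀ u v → h u v ≡ h v u) →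
    sum (λ u → sum (h u)) ≡ 2 * sum< h + sum λ u → h u u
  double-sum h h-sym = begin
    sum (λ u → sum (h u))
      ≡⟨ sum-cong (λ u → sum-cong (split u)) ⟩
    sum (λ u → sum λ v → lt u v + lt v u + χ (does (v Fin.≟ u)) * h u v)
      ≡⟨ sum-cong (λ u → trans (sum-+ _ _) (cong₂ _+_ (sum-+ _ _) (sum-δ u (h u)))) ⟩
    sum (λ u → sum (lt u) + sum (λ v → lt v u) + h u u)
      ≡⟨ trans (sum-+ _ _) (cong (_+ sum (λ u → h u u)) (sum-+ _ _)) ⟩
    sum (λ u → sum (lt u)) + sum (λ u → sum λ v → lt v u) + sum (λ u → h u u)
      ≡⟨ cong (λ x → sum< h + x + sum (λ u → h u u)) (sum-swap _) ⟨
    sum< h + sum< h + sum (λ u → h u u)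
      ≡⟨ cong (_+ sum (λ u → h u u)) (cong (sum< h +_) (sym (ℕ.+-identityʳ (sum< h)))) ⟩
    2 * sum< h + sum (λ u → h u u) ∎
    where
    open ≡-Reasoning
    lt : _ → _ → ℕ
    lt u v = χ (does (u Fin.<? v)) * h u v
    split : ∀ u v → h u v ≡ lt u v + lt v u + χ (does (v Fin.≟ u)) * h u v
    split u v with toℕ u ℕ.<ᵇ toℕ v | ℕ.<ᵇ⇒< (toℕ u) (toℕ v) | ℕ.<⇒<ᵇ {toℕ u} {toℕ v}
                 | toℕ v ℕ.<ᵇ toℕ u | ℕ.<ᵇ⇒< (toℕ v) (toℕ u) | ℕ.<⇒<ᵇ {toℕ v} {toℕ u} | v Fin.≟ u
    ... | true | u<v | _ | true  | v<u | _ | _        = contradiction (v<u tt) (ℕ.<⇒≯ (u<v tt))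
    ... | true | u<v | _ | false | _   | _ | yes refl = contradiction (u<v tt) (ℕ.<-irrefl refl)
    ... | true | u<v | _ | false | _   | _ | no _     = eq (h u v)
      where
      eq : ∀ a → a ≡ a + 0 + 0 + 0
      eq = ℕ-Ring.solve-∀
    ... | false | _ | _ | true | v<u | _ | yes refl = contradiction (v<u tt) (ℕ.<-irrefl refl)
    ... | false | _ | _ | true | v<u | _ | no _     = trans (h-sym u v) (eq (h v u))
      where
      eq : ∀ a → a ≡ a + 0 + 0
      eq = ℕ-Ring.solve-∀
    ... | false | _ | _ | false | _ | _ | yes refl = sym (ℕ.+-identityʳ _)
    ... | false | _ | u≮v | false | _ | v≮u | no v≢u = contradiction
      (Fin.toℕ-injective (ℕ.≤-antisym (ℕ.≮⇒≥ v≮u) (ℕ.≮⇒≥ u≮v))) (v≢u ∘ sym)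

  ones : ∀ {n} → Fin n → ℕ
  ones _ = 1

  ⟨1,1⟩ : ∀ {n} (R : Fin n → Fin n → Bool) → (∀ u v → R u v ≡ R v u) →
    ⟨ ones , ones ⟩[ R ] ≡ 2 * sum< (λ u v → χ (R u v)) + sum λ u → χ (R u u)
  ⟨1,1⟩ R R-sym = trans (sum-cong λ u → trans (ℕ.*-identityˡ _) (sum-cong λ v → ℕ.*-identityˡ _))
    (double-sum (λ u v → χ (R u v)) λ u v → cong χ (R-sym u v))

  ⟨⟩-scale : ∀ {n} (R : Fin n → Fin n → Bool) L (f : Fin n → ℕ) → (∀ u → f u ≡ L) →
    ⟨ f , f ⟩[ R ] ≡ L * L * ⟨ ones , ones ⟩[ R ]
  ⟨⟩-scale R L f f≡L = trans (sum-cong λ u → trans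
    (cong₂ _*_ (f≡L u) (trans (sum-cong λ v → cong (_* χ (R u v)) (f≡L v)) (sym (*-sum L _))))
    (trans (sym (ℕ.*-assoc L L _)) (cong (L * L *_)
      (trans (sum-cong λ v → sym (ℕ.*-identityˡ _)) (sym (ℕ.*-identityˡ _))))))
    (sym (*-sum (L * L) _))

  edges-sum : ∀ {n} (G : Graph n) → edges G ≡ sum< λ u v → χ (adj G u v)
  edges-sum G = count-pairs _

  edges-⟨⟩ : ∀ {n} (G : Graph n) → ⟨ ones , ones ⟩[ adj G ] ≡ 2 * edges G
  edges-⟨⟩ G = trans (⟨1,1⟩ (adj G) (adj-sym G)) (trans
    (cong₂ _+_ (cong (2 *_) (sym (edges-sum G))) (sum-zero λ u → cong χ (adj-irrefl G u)))
    (ℕ.+-identityʳ _))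

  card-tabulate : ∀ {n} (b : Fin n → Bool) → ∣ Vec.tabulate b ∣ ≡ sum (χ ∘ b)
  card-tabulate {zero}  b = sym (sum-empty _)
  card-tabulate {suc n} b with b zero in eq
  ... | true  = trans (cong suc (card-tabulate (b ∘ suc)))
                  (trans (cong (λ x → χ x + sum (χ ∘ b ∘ suc)) (sym eq)) (sym (sum-suc _)))
  ... | false = trans (card-tabulate (b ∘ suc))
                  (trans (cong (λ x → χ x + sum (χ ∘ b ∘ suc)) (sym eq)) (sym (sum-suc _)))

  clique⇒HasClique : ∀ {n} (G : Graph n) {k} → Clique G k → HasClique k G
  clique⇒HasClique {n} G {k} (c , cl) = Vec.tabulate member , card , λ u u∈ v v∈ u≢v →
      let i , u≡cᵢ = member⇒ u u∈ ; j , v≡cⱼ = member⇒ v v∈ in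
      subst₂ (Adj G) (sym u≡cᵢ) (sym v≡cⱼ)
        (cl i j λ i≡j → u≢v (trans u≡cᵢ (trans (cong c i≡j) (sym v≡cⱼ))))
    where
    member? : ∀ u → Dec (∃[ i ] u ≡ c i)
    member? u = Fin.any? λ i → u Fin.≟ c i
    member : Fin n → Bool
    member u = does (member? u)
    member⇒ : ∀ u → u Subset.∈ Vec.tabulate member → ∃[ i ] u ≡ c i
    member⇒ u u∈ = T-does⁻ (member? u) (subst T
      (trans (sym (Vec.[]=⇒lookup u∈)) (Vec.lookup∘tabulate member u)) tt)
    count : ∀ u → χ (member u) ≡ sum λ i → χ (does (u Fin.≟ c i))
    count u with member? u
    ... | no none = sym (sum-zero λ i → χ-false λ t → none (i , T-does⁻ (u Fin.≟ c i) t))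
    ... | yes (i , u≡cᵢ) = ℕ.≤-antisym
      (ℕ.≤-trans (χ-pos (T-does⁺ (u Fin.≟ c i) u≡cᵢ)) (term≤sum _ i))
      (sum-at-most-one _ (λ i → χ≤1 _) λ i j ui uj → tuple-injective G cl i j (trans
        (sym (T-does⁻ (u Fin.≟ c i) (χ-true ui))) (T-does⁻ (u Fin.≟ c j) (χ-true uj))))
    card : ∣ Vec.tabulate member ∣ ≡ k
    card = trans (card-tabulate member) (trans (sum-cong count) (trans (sum-swap _)
      (trans (sum-cong λ i → trans (sum-cong λ u → sym (ℕ.*-identityʳ _)) (sum-δ (c i) (λ _ → 1)))
        (trans (sum-const k 1) (ℕ.*-identityʳ k)))))

  enumerate : ∀ {n} (S : Subset n) → Fin ∣ S ∣ → Fin n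
  enumerate (true  ∷ S) zero    = zero
  enumerate (true  ∷ S) (suc i) = suc (enumerate S i)
  enumerate (false ∷ S) i       = suc (enumerate S i)

  enumerate-∈ : ∀ {n} (S : Subset n) i → enumerate S i Subset.∈ S
  enumerate-∈ (true  ∷ S) zero    = Vec.lookup⇒[]= zero _ refl
  enumerate-∈ (true  ∷ S) (suc i) = Vec.there (enumerate-∈ S i)
  enumerate-∈ (false ∷ S) i       = Vec.there (enumerate-∈ S i)

  enumerate-injective : ∀ {n} (S : Subset n) {i j} → enumerate S i ≡ enumerate S j → i ≡ j
  enumerate-injective (true  ∷ S) {zero}  {zero}  eq = refl
  enumerate-injective (true  ∷ S) {suc i} {suc j} eq = cong suc (enumerate-injective S (Fin.suc-injective eq))
  enumerate-injective (false ∷ S) eq = enumerate-injective S (Fin.suc-injective eq)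

  HasClique⇒clique : ∀ {n} (G : Graph n) {k} → HasClique k G → Clique G k
  HasClique⇒clique G (S , refl , cl) = enumerate S , λ i j i≢j →
    cl _ (enumerate-∈ S i) _ (enumerate-∈ S j) (i≢j ∘ enumerate-injective S)

  turán-bound : ∀ r V e → 1 ≤ r → (∀ q → e + (2 * q + 1) * V ≤ V * V + r * (q * (q + 1))) →
    r * e + V * V ≤ r * (V * V)
  turán-bound r@(suc r′) V e _ bound = ℕ.+-cancelʳ-≤ (r * (r * (q * (q + 1)))) _ _ (begin
    r * e + V * V + r * (r * (q * (q + 1)))
      ≤⟨ ℕ.m≤m+n _ (s * d) ⟩
    r * e + V * V + r * (r * (q * (q + 1))) + s * d
      ≡⟨ ℕ.+-assoc (r * e + V * V) _ _ ⟩
    r * e + V * V + (r * (r * (q * (q + 1))) + s * d)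
      ≡⟨ ℕ.+-assoc (r * e) _ _ ⟩
    r * e + (V * V + (r * (r * (q * (q + 1))) + s * d))
      ≡⟨ cong (r * e +_) (subst₂ (λ r V → V * V + (r * (r * (q * (q + 1))) + s * d) ≡ r * ((2 * q + 1) * V))
           (ℕ.m+[n∸m]≡n (ℕ.<⇒≤ (ℕ.m%n<n V r))) (sym V≡) (identity s d q)) ⟩
    r * e + r * ((2 * q + 1) * V)
      ≡⟨ ℕ.*-distribˡ-+ r e _ ⟨
    r * (e + (2 * q + 1) * V)
      ≤⟨ ℕ.*-monoʳ-≤ r (bound q) ⟩
    r * (V * V + r * (q * (q + 1)))
      ≡⟨ ℕ.*-distribˡ-+ r (V * V) (r * (q * (q + 1))) ⟩
    r * (V * V) + r * (r * (q * (q + 1))) ∎)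
    where
    open ℕ.≤-Reasoning
    q s d : ℕ
    q = V ℕ./ r
    s = V ℕ.% r
    d = r ∸ s
    V≡ : V ≡ s + q * (s + d)
    V≡ = trans (ℕ.m≡m%n+[m/n]*n V r) (cong (λ x → s + q * x) (sym (ℕ.m+[n∸m]≡n (ℕ.<⇒≤ (ℕ.m%n<n V r)))))
    identity : ∀ s d q → (s + q * (s + d)) * (s + q * (s + d)) + ((s + d) * ((s + d) * (q * (q + 1))) + s * d)
                       ≡ (s + d) * ((2 * q + 1) * (s + q * (s + d)))
    identity = ℕ-Ring.solve-∀

module _ {n : ℕ} (G : Graph n) (r : ℕ) (no-clique : ¬ HasClique (suc (suc r)) G) where
  open Swap G
  open Data.Nat.Base using (_+_; _*_; _≤_; _<_)

  free : ¬ Clique G (suc (suc r))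
  free = no-clique ∘ clique⇒HasClique G

  Completing : Fin n → Fin n → Set
  Completing u v = ∃[ k ] (IsTuple G (tup k) × ∃[ i ] (T (swaps (tup k) i u) × T (swaps (tup k) i v)))
    where
    tup : Fin (n ℕ.^ suc r) → Fin (suc r) → Fin n
    tup = finToFun

  completing? : ∀ u v → Dec (Completing u v)
  completing? u v = Fin.any? λ k → isTuple? G _ ×-dec Fin.any? λ i → T? _ ×-dec T? _

  σ : Fin n → Fin n → Bool
  σ u v = does (completing? u v)

  σ-sym : ∀ u v → σ u v ≡ σ v u
  σ-sym u v with completing? u v | completing? v u
  ... | yes _ | yes _ = refl
  ... | no _  | no _  = refl
  ... | yes (k , cl , i , a , b) | no ¬c = contradiction (k , cl , i , b , a) ¬c
  ... | no ¬c | yes (k , cl , i , a , b) = contradiction (k , cl , i , b , a) ¬c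

  swaps-≗ : ∀ {k} {c d : Fin k → Fin n} → (∀ i → d i ≡ c i) → ∀ i u → T (swaps c i u) → T (swaps d i u)
  swaps-≗ {c = c} {d} eq i u s = T-does⁺ (swaps? d i u) λ j j≢i →
    subst (Adj G u) (sym (eq j)) (T-does⁻ (swaps? c i u) s j j≢i)

  σ-swaps : ∀ (c : Fin (suc r) → Fin n) → IsTuple G c → ∀ i u v →
    T (swaps c i u) → T (swaps c i v) → T (σ u v)
  σ-swaps c cl i u v su sv = T-does⁺ (completing? u v)
    (funToFin c , isTuple-≗ G code cl , i , swaps-≗ code i u su , swaps-≗ code i v sv)
    where
    code : ∀ i → finToFun (funToFin c) i ≡ c i
    code = Fin.finToFun-funToFin c

  completing⇒saturating : ∀ {u v} → u ≢ v → Completing u v → IsSaturating (suc (suc r)) G (u , v)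
  completing⇒saturating {u} {v} u≢v (k , cl , i , su , sv) =
      u≢v , non-adjacent , clique⇒HasClique G+uv (proj₁ (cons-clique G+uv v (c , c-tuple) c-adj))
    where
    c₀ : Fin (suc r) → Fin n
    c₀ = finToFun k
    G+uv : Graph n
    G+uv = addEdge G u v u≢v
    c : Fin (suc r) → Fin n
    c = replace G c₀ i u
    keep : ∀ {a b} → Adj G a b → Adj G+uv a b
    keep {a} {b} ab with adj G a b
    ... | true = tt
    c-tuple : IsTuple G+uv c
    c-tuple a b a≢b = keep (replace-tuple G cl i u su a b a≢b)
    new-edge : Adj G+uv v u
    new-edge with adj G v u | u Fin.≟ u | v Fin.≟ v
    ... | true  | _ | _ = tt
    ... | false | no u≢u | _ = contradiction refl u≢u
    ... | false | yes _ | no v≢v = contradiction refl v≢v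
    ... | false | yes _ | yes _ with does (v Fin.≟ u) ∧ does (u Fin.≟ v)
    ...   | true  = tt
    ...   | false = tt
    c-adj : ∀ j → Adj G+uv v (c j)
    c-adj j with j Fin.≟ i
    ... | yes _  = new-edge
    ... | no j≢i = keep (T-does⁻ (swaps? c₀ i v) sv j j≢i)
    non-adjacent : ¬ Adj G u v
    non-adjacent uv = free (proj₁ (cons-clique G v (c , replace-tuple G cl i u su) adj-c))
      where
      adj-c : ∀ j → Adj G v (c j)
      adj-c j with j Fin.≟ i
      ... | yes _  = subst T (adj-sym G u v) uv
      ... | no j≢i = T-does⁻ (swaps? c₀ i v) sv j j≢i

  σ-count : ⟨ ones , ones ⟩[ σ ] ≤ 2 * satCount (suc (suc r)) G + n
  σ-count = begin
    ⟨ ones , ones ⟩[ σ ]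
      ≡⟨ ⟨1,1⟩ σ σ-sym ⟩
    2 * sum< (λ u v → χ (σ u v)) + sum (λ u → χ (σ u u))
      ≤⟨ ℕ.+-mono-≤ (ℕ.*-monoʳ-≤ 2 (sum<-mono λ {u} {v} u<v → χ-mono λ s →
           T-does⁺ (isSaturating? _ G (u , v)) (completing⇒saturating
             (λ u≡v → ℕ.<-irrefl (cong toℕ u≡v) u<v) (T-does⁻ (completing? u v) s))))
           (ℕ.≤-trans (sum-mono λ u → χ≤1 (σ u u)) (ℕ.≤-reflexive
             (trans (sum-const n 1) (ℕ.*-identityʳ n)))) ⟩
    2 * sum< (λ u v → χ (does (isSaturating? (suc (suc r)) G (u , v)))) + n
      ≡⟨ cong (λ x → 2 * x + n) (count-pairs (isSaturating? (suc (suc r)) G)) ⟨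
    2 * satCount (suc (suc r)) G + n ∎
    where open ℕ.≤-Reasoning

  -- T is the size of a maximal K_p-packing with vertex capacities L and V the
  -- total spare capacity; MM and NN are the swap totals of load and spare
  -- capacity, e and s the edges and saturating pairs within the latter.

  packing-inequalities : ∀ {Goal : Set} → Dec Goal → 1 ≤ r → Clique G (suc r) → ∀ L →
    (∀ T V MM NN e s →
      suc r * T + V ≡ n * L → L ≤ T →
      L * L * (2 * edges G) + (suc r * (T * T) + 2 * (T * V))
        ≤ (r * (suc r * (T * T) + 2 * (T * V)) + (MM + 2 * NN)) + e →
      r * e + V * V ≤ r * (V * V) →
      MM ≤ suc r * (T * T) →
      MM + 2 * NN + s ≤ L * L * (2 * satCount (suc (suc r)) G + n) →
      (∀ a b → 2 * (a * (b * NN)) ≤ b * b * (T * s) + (r * T + r * n ℕ.^ suc r) * (a * a)) →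
      Goal) → Goal
  packing-inequalities goal? 1≤r clique L use = maximal goal? clique λ μ valid spare-free unfillable →
    let open P μ valid
        open Saturation (spare μ) σ σ-sym σ-swaps
        open Valid valid
        ν = spare μ
        full : ∀ u → mass u + ν u ≡ L
        full u = ℕ.m+[n∸m]≡n (capacity u)
    in use total (sum ν) (swapTotal mass) (swapTotal ν) ⟨ ν , ν ⟩[ adj G ] ⟨ ν , ν ⟩[ σ ]
      (trans (cong (_+ sum ν) (sym mass-total)) (trans (sym (sum-+ mass ν))
        (trans (sum-cong full) (sum-const n L))))
      large
      (ℕ.≤-trans (ℕ.≤-reflexive (cong (_+ (suc r * (total * total) + 2 * (total * sum ν)))
        (sym (trans (⟨⟩-scale (adj G) L _ full) (cong (L * L *_) (edges-⟨⟩ G)))))) (edge-bound ν))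
      (turán-bound r (sum ν) _ 1≤r λ q → weighted-turán G r q ν spare-free)
      swapTotal-mass
      (ℕ.≤-trans saturation-bound (ℕ.≤-trans (ℕ.≤-reflexive (⟨⟩-scale σ L _ full))
        (ℕ.*-monoʳ-≤ (L * L) σ-count)))
      (swap-sum-bound unfillable)
    where open MaximalPacking G r 1≤r free L

-- Turán numbers

module _ where
  open Data.Nat.Base using (_+_; _*_; _≤_; _<_)

  rangeSum : ℕ → (ℕ → ℕ) → ℕ
  rangeSum zero    f = 0
  rangeSum (suc n) f = rangeSum n f + f n

  rangeSum-cong : ∀ n {f g : ℕ → ℕ} → (∀ i → i < n → f i ≡ g i) → rangeSum n f ≡ rangeSum n g
  rangeSum-cong zero    eq = refl
  rangeSum-cong (suc n) eq =
    cong₂ _+_ (rangeSum-cong n λ i i<n → eq i (ℕ.m≤n⇒m≤1+n i<n)) (eq n ℕ.≤-refl)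

  rangeSum-mono : ∀ n {f g : ℕ → ℕ} → (∀ i → i < n → f i ≤ g i) → rangeSum n f ≤ rangeSum n g
  rangeSum-mono zero    le = z≤n
  rangeSum-mono (suc n) le =
    ℕ.+-mono-≤ (rangeSum-mono n λ i i<n → le i (ℕ.m≤n⇒m≤1+n i<n)) (le n ℕ.≤-refl)

  rangeSum-+ : ∀ n f g → rangeSum n (λ i → f i + g i) ≡ rangeSum n f + rangeSum n g
  rangeSum-+ zero    f g = refl
  rangeSum-+ (suc n) f g = trans (cong (_+ (f n + g n)) (rangeSum-+ n f g))
    (interchange (rangeSum n f) (rangeSum n g) (f n) (g n))
    where
    interchange : ∀ a b c d → a + b + (c + d) ≡ a + c + (b + d)
    interchange = ℕ-Ring.solve-∀

  rangeSum-* : ∀ n a f → a * rangeSum n f ≡ rangeSum n (λ i → a * f i)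
  rangeSum-* zero    a f = ℕ.*-zeroʳ a
  rangeSum-* (suc n) a f = trans (ℕ.*-distribˡ-+ a (rangeSum n f) (f n)) (cong (_+ a * f n) (rangeSum-* n a f))

  rangeSum-zero : ∀ n {f : ℕ → ℕ} → (∀ i → i < n → f i ≡ 0) → rangeSum n f ≡ 0
  rangeSum-zero zero    eq = refl
  rangeSum-zero (suc n) eq =
    cong₂ _+_ (rangeSum-zero n λ i i<n → eq i (ℕ.m≤n⇒m≤1+n i<n)) (eq n ℕ.≤-refl)

  rangeSum-ones : ∀ n → rangeSum n (λ _ → 1) ≡ n
  rangeSum-ones zero    = refl
  rangeSum-ones (suc n) = trans (cong (_+ 1) (rangeSum-ones n)) (ℕ.+-comm n 1)

  rangeSum-head : ∀ n f → rangeSum (suc n) f ≡ f 0 + rangeSum n (f ∘ suc)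
  rangeSum-head zero    f = sym (ℕ.+-identityʳ (f 0))
  rangeSum-head (suc n) f = trans (cong (_+ f (suc n)) (rangeSum-head n f)) (ℕ.+-assoc (f 0) _ _)

  rangeSum-append : ∀ m n f → rangeSum (m + n) f ≡ rangeSum m f + rangeSum n (λ j → f (m + j))
  rangeSum-append m zero    f = trans (cong (λ k → rangeSum k f) (ℕ.+-identityʳ m)) (sym (ℕ.+-identityʳ _))
  rangeSum-append m (suc n) f = trans (cong (λ k → rangeSum k f) (ℕ.+-suc m n))
    (trans (cong (_+ f (m + n)) (rangeSum-append m n f)) (ℕ.+-assoc (rangeSum m f) _ _))

  rangeSum-swap : ∀ m n (f : ℕ → ℕ → ℕ) →
    rangeSum m (λ i → rangeSum n (f i)) ≡ rangeSum n (λ j → rangeSum m λ i → f i j)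
  rangeSum-swap zero    n f = sym (rangeSum-zero n λ _ _ → refl)
  rangeSum-swap (suc m) n f = trans (cong (_+ rangeSum n (f m)) (rangeSum-swap m n f))
    (sym (rangeSum-+ n _ (f m)))

  rangeSum-reverse : ∀ n (f : ℕ → ℕ) → rangeSum n (λ i → f (n ∸ i)) ≡ rangeSum n (f ∘ suc)
  rangeSum-reverse zero    f = refl
  rangeSum-reverse (suc n) f = trans (rangeSum-head n (λ i → f (suc n ∸ i)))
    (trans (cong (f (suc n) +_) (rangeSum-reverse n f)) (ℕ.+-comm (f (suc n)) (rangeSum n (f ∘ suc))))

  sum-toℕ : ∀ n f → sum {n} (f ∘ toℕ) ≡ rangeSum n f
  sum-toℕ zero    f = sum-empty _
  sum-toℕ (suc n) f = trans (sum-suc _) (trans (cong (f 0 +_) (sum-toℕ n (f ∘ suc))) (sym (rangeSum-head n f)))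

  χ-< : ∀ {i j} → i < j → χ (i ℕ.<ᵇ j) ≡ 1
  χ-< {i} {j} i<j with i ℕ.<ᵇ j | ℕ.<⇒<ᵇ i<j
  ... | true | _ = refl

  χ-≮ : ∀ {i j} → j ≤ i → χ (i ℕ.<ᵇ j) ≡ 0
  χ-≮ {i} {j} j≤i = χ-false λ lt → ℕ.<⇒≱ (ℕ.<ᵇ⇒< i j lt) j≤i

  rangeSum-below : ∀ n b f → b ≤ n → rangeSum n (λ i → χ (i ℕ.<ᵇ b) * f i) ≡ rangeSum b f
  rangeSum-below n b f b≤n with d , refl ← ℕ.m≤n⇒∃[o]m+o≡n b≤n = begin
    rangeSum (b + d) (λ i → χ (i ℕ.<ᵇ b) * f i)
      ≡⟨ rangeSum-append b d _ ⟩
    rangeSum b (λ i → χ (i ℕ.<ᵇ b) * f i) + rangeSum d (λ j → χ (b + j ℕ.<ᵇ b) * f (b + j))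
      ≡⟨ cong₂ _+_ (rangeSum-cong b λ i i<b → trans (cong (_* f i) (χ-< i<b)) (ℕ.*-identityˡ (f i)))
           (rangeSum-zero d λ j _ → cong (_* f (b + j)) (χ-≮ {b + j} {b} (ℕ.m≤m+n b j))) ⟩
    rangeSum b f + 0
      ≡⟨ ℕ.+-identityʳ _ ⟩
    rangeSum b f ∎
    where open ≡-Reasoning

  sum<-toℕ : ∀ n (h : ℕ → ℕ → ℕ) →
    sum< {n} (λ u v → h (toℕ u) (toℕ v)) ≡ rangeSum n λ v → rangeSum v λ u → h u v
  sum<-toℕ n h = begin
    sum< {n} (λ u v → h (toℕ u) (toℕ v))
      ≡⟨ sum-swap _ ⟩
    sum {n} (λ v → sum {n} λ u → χ (toℕ u ℕ.<ᵇ toℕ v) * h (toℕ u) (toℕ v))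
      ≡⟨ sum-cong (λ v → trans (sum-toℕ n λ u → χ (u ℕ.<ᵇ toℕ v) * h u (toℕ v))
           (rangeSum-below n (toℕ v) (λ u → h u (toℕ v)) (ℕ.<⇒≤ (Fin.toℕ<n v)))) ⟩
    sum {n} (λ v → rangeSum (toℕ v) λ u → h u (toℕ v))
      ≡⟨ sum-toℕ n (λ v → rangeSum v λ u → h u v) ⟩
    rangeSum n (λ v → rangeSum v λ u → h u v) ∎
    where open ≡-Reasoning

  divides₁ : ℕ → ℕ → ℕ → Bool
  divides₁ r u v = does (r ∣? ℕ.∣ u - v ∣)

  multiples : ℕ → ℕ → ℕ
  multiples r v = rangeSum v λ u → χ (divides₁ r u v)

  multiples-range : ∀ r v → multiples r v ≡ rangeSum v λ d → χ (does (r ∣? suc d))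
  multiples-range r v = trans
    (rangeSum-cong v λ u u<v → cong (λ z → χ (does (r ∣? z))) (ℕ.m≤n⇒∣m-n∣≡n∸m (ℕ.<⇒≤ u<v)))
    (rangeSum-reverse v λ d → χ (does (r ∣? d)))

  t-range : ∀ r n → t r n ≡ rangeSum n λ v → rangeSum v λ u → χ (not (divides₁ r u v))
  t-range r n = trans (edges-sum (turán r n)) (sum<-toℕ n λ u v → χ (not (divides₁ r u v)))

  t-suc : ∀ r n → t r (suc n) + multiples r n ≡ t r n + n
  t-suc r n = begin
    t r (suc n) + multiples r n
      ≡⟨ cong (_+ multiples r n) (t-range r (suc n)) ⟩
    rangeSum n (λ v → rangeSum v λ u → χ (not (divides₁ r u v)))
      + rangeSum n (λ u → χ (not (divides₁ r u n))) + multiples r n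
      ≡⟨ ℕ.+-assoc (rangeSum n (λ v → rangeSum v λ u → χ (not (divides₁ r u v)))) _ _ ⟩
    rangeSum n (λ v → rangeSum v λ u → χ (not (divides₁ r u v)))
      + (rangeSum n (λ u → χ (not (divides₁ r u n))) + multiples r n)
      ≡⟨ cong₂ _+_ (t-range r n) (rangeSum-+ n (λ u → χ (not (divides₁ r u n))) _) ⟨
    t r n + rangeSum n (λ u → χ (not (divides₁ r u n)) + χ (divides₁ r u n))
      ≡⟨ cong (t r n +_) (trans (rangeSum-cong n λ u _ →
           trans (ℕ.+-comm _ (χ (divides₁ r u n))) (χ-not (divides₁ r u n))) (rangeSum-ones n)) ⟩
    t r n + n ∎
    where
    open ≡-Reasoning

  record TuránNumber (r n : ℕ) : Set where
    field
      q s       : ℕ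
      division  : n ≡ s + q * r
      remainder : s < r
      count     : multiples r n ≡ q
      value     : 2 * t r n + (2 * q + 1) * n ≡ n * n + r * (q * (q + 1))

  turán-number : ∀ r n → 1 ≤ r → TuránNumber r n
  turán-number r zero 1≤r = record
    { q = 0 ; s = 0 ; division = refl ; remainder = 1≤r ; count = refl
    ; value = sym (ℕ.*-zeroʳ r) }
  turán-number r (suc n) 1≤r with turán-number r n 1≤r
  ... | record { q = q ; s = s ; division = refl ; remainder = s<r ; count = count ; value = value }
    with suc s ℕ.<? r
  ...   | yes 1+s<r = record
    { q = q ; s = suc s ; division = refl ; remainder = 1+s<r
    ; count = trans (multiples-range r (suc n)) (trans
        (cong₂ _+_ (trans (sym (multiples-range r n)) count) (χ-false λ d → not-multiple (T-does⁻ (r ∣? suc n) d)))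
        (ℕ.+-identityʳ q))
    ; value = ℕ.+-cancelʳ-≡ (2 * q) _ _ (begin
        2 * t r (suc n) + (2 * q + 1) * suc n + 2 * q
          ≡⟨ regroup (t r (suc n)) q n ⟩
        2 * (t r (suc n) + q) + (2 * q + 1) * suc n
          ≡⟨ cong (λ x → 2 * x + (2 * q + 1) * suc n) (trans (cong (t r (suc n) +_) (sym count)) (t-suc r n)) ⟩
        2 * (t r n + n) + (2 * q + 1) * suc n
          ≡⟨ regroup′ (t r n) n q ⟩
        2 * t r n + (2 * q + 1) * n + (2 * n + 2 * q + 1)
          ≡⟨ cong (_+ (2 * n + 2 * q + 1)) value ⟩
        n * n + r * (q * (q + 1)) + (2 * n + 2 * q + 1)
          ≡⟨ regroup″ n (r * (q * (q + 1))) q ⟩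
        suc n * suc n + r * (q * (q + 1)) + 2 * q ∎)
    }
    where
    open ≡-Reasoning
    not-multiple : ¬ (r ∣ suc s + q * r)
    not-multiple d = ℕ.<⇒≱ 1+s<r (ℕ.∣⇒≤ (ℕ.∣m+n∣m⇒∣n (subst (r ∣_) (ℕ.+-comm (suc s) (q * r)) d) (ℕ.n∣m*n q)))
    regroup : ∀ t q n → 2 * t + (2 * q + 1) * (1 + n) + 2 * q ≡ 2 * (t + q) + (2 * q + 1) * (1 + n)
    regroup = ℕ-Ring.solve-∀
    regroup′ : ∀ t n q → 2 * (t + n) + (2 * q + 1) * (1 + n) ≡ 2 * t + (2 * q + 1) * n + (2 * n + 2 * q + 1)
    regroup′ = ℕ-Ring.solve-∀
    regroup″ : ∀ n c q → n * n + c + (2 * n + 2 * q + 1) ≡ (1 + n) * (1 + n) + c + 2 * q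
    regroup″ = ℕ-Ring.solve-∀
  ...   | no 1+s≮r with refl ← ℕ.≤-antisym s<r (ℕ.≮⇒≥ 1+s≮r) = record
    { q = suc q ; s = 0 ; division = refl ; remainder = 1≤r
    ; count = trans (multiples-range r (suc n)) (trans
        (cong₂ _+_ (trans (sym (multiples-range r n)) count) (χ-one (T-does⁺ (r ∣? suc n) (ℕ.n∣m*n (suc q)))))
        (ℕ.+-comm q 1))
    ; value = ℕ.+-cancelʳ-≡ (2 * q) _ _ (begin
        2 * t r (suc n) + (2 * suc q + 1) * suc n + 2 * q
          ≡⟨ regroup (t r (suc n)) q n ⟩
        2 * (t r (suc n) + q) + (2 * q + 3) * suc n
          ≡⟨ cong (λ x → 2 * x + (2 * q + 3) * suc n) (trans (cong (t r (suc n) +_) (sym count)) (t-suc r n)) ⟩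
        2 * (t r n + n) + (2 * q + 3) * suc n
          ≡⟨ regroup′ (t r n) n q ⟩
        2 * t r n + (2 * q + 1) * n + (2 * n + 2 * suc n + 2 * q + 1)
          ≡⟨ cong (_+ (2 * n + 2 * suc n + 2 * q + 1)) value ⟩
        n * n + r * (q * (q + 1)) + (2 * n + 2 * suc n + 2 * q + 1)
          ≡⟨ regroup″ s q ⟩
        suc n * suc n + r * (suc q * (suc q + 1)) + 2 * q ∎)
    }
    where
    open ≡-Reasoning
    regroup : ∀ t q n → 2 * t + (2 * (1 + q) + 1) * (1 + n) + 2 * q ≡ 2 * (t + q) + (2 * q + 3) * (1 + n)
    regroup = ℕ-Ring.solve-∀
    regroup′ : ∀ t n q → 2 * (t + n) + (2 * q + 3) * (1 + n)
                       ≡ 2 * t + (2 * q + 1) * n + (2 * n + 2 * (1 + n) + 2 * q + 1)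
    regroup′ = ℕ-Ring.solve-∀
    regroup″ : ∀ s q → let n = s + q * (1 + s) in
      n * n + (1 + s) * (q * (q + 1)) + (2 * n + 2 * (1 + n) + 2 * q + 1)
        ≡ (1 + n) * (1 + n) + (1 + s) * ((1 + q) * (1 + q + 1)) + 2 * q
    regroup″ = ℕ-Ring.solve-∀

  multiples-bound : ∀ r v → 1 ≤ r → r * multiples r v ≤ v
  multiples-bound r v 1≤r with turán-number r v 1≤r
  ... | record { q = q ; s = s ; division = refl ; count = count } = begin
    r * multiples r (s + q * r) ≡⟨ cong (r *_) count ⟩
    r * q                       ≡⟨ ℕ.*-comm r q ⟩
    q * r                       ≤⟨ ℕ.m≤n+m (q * r) s ⟩
    s + q * r                   ∎
    where open ℕ.≤-Reasoning

  t-mono : ∀ r {k n} → k ≤ n → 1 ≤ r → t r k ≤ t r n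
  t-mono r {k} {n} k≤n 1≤r with d , refl ← ℕ.m≤n⇒∃[o]m+o≡n k≤n = extend d
    where
    step : ∀ n → t r n ≤ t r (suc n)
    step n = ℕ.+-cancelʳ-≤ n _ _ (ℕ.≤-trans (ℕ.≤-reflexive (sym (t-suc r n)))
      (ℕ.+-monoʳ-≤ (t r (suc n)) (ℕ.≤-trans (ℕ.m≤n*m (multiples r n) r {{ℕ.>-nonZero 1≤r}})
        (multiples-bound r n 1≤r))))
    extend : ∀ d → t r k ≤ t r (k + d)
    extend zero    = ℕ.≤-reflexive (cong (t r) (sym (ℕ.+-identityʳ k)))
    extend (suc d) = ℕ.≤-trans (extend d) (ℕ.≤-trans (step (k + d))
      (ℕ.≤-reflexive (cong (t r) (sym (ℕ.+-suc k d)))))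

  quotient-unique : ∀ r {q q′ s s′} → s < r → s′ < r → s + q * r ≡ s′ + q′ * r → q ≡ q′
  quotient-unique r {q} {q′} {s} {s′} s<r s′<r eq =
    ℕ.≤-antisym (ℕ.≮⇒≥ (clash s′<r (sym eq))) (ℕ.≮⇒≥ (clash s<r eq))
    where
    clash : ∀ {q q′ s s′} → s < r → s + q * r ≡ s′ + q′ * r → ¬ (q < q′)
    clash {q} {q′} {s} {s′} s<r eq q<q′ = ℕ.<⇒≱ (ℕ.<-≤-trans (ℕ.+-monoˡ-< (q * r) s<r) (ℕ.*-monoˡ-≤ r q<q′))
      (ℕ.≤-trans (ℕ.m≤n+m (q′ * r) s′) (ℕ.≤-reflexive (sym eq)))

  -- Removing a part of T_{r+1}(n), of size q or q + 1, leaves T_r(b).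

  part-removal : ∀ r {n b} q s a → s < r → b ≡ s + q * r → a ≡ q ⊎ a ≡ suc q → n ≡ b + a →
    2 * t (suc r) n + (2 * q + 1) * n ≡ n * n + suc r * (q * (q + 1)) →
    t (suc r) n ≡ t r b + b * a
  part-removal r {n} {b} q s a s<r b≡ part refl value
    with turán-number r b (ℕ.≤-trans (s≤s z≤n) s<r)
  ... | record { q = q₀ ; s = s₀ ; division = division ; remainder = remainder ; value = value₀ }
    with refl ← quotient-unique r {q} {q₀} {s} {s₀} s<r remainder (trans (sym b≡) division) =
    ℕ.*-cancelˡ-≡ _ _ 2 (ℕ.+-cancelʳ-≡ ((2 * q + 1) * (b + a)) _ _ (begin
      2 * t (suc r) (b + a) + (2 * q + 1) * (b + a)
        ≡⟨ value ⟩
      (b + a) * (b + a) + suc r * (q * (q + 1))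
        ≡⟨ identity part ⟩
      b * b + r * (q * (q + 1)) + 2 * (b * a) + (2 * q + 1) * a
        ≡⟨ cong (λ z → z + 2 * (b * a) + (2 * q + 1) * a) value₀ ⟨
      2 * t r b + (2 * q + 1) * b + 2 * (b * a) + (2 * q + 1) * a
        ≡⟨ collect (t r b) q a b ⟩
      2 * (t r b + b * a) + (2 * q + 1) * (b + a) ∎))
    where
    open ≡-Reasoning
    collect : ∀ t q a b → 2 * t + (2 * q + 1) * b + 2 * (b * a) + (2 * q + 1) * a
                        ≡ 2 * (t + b * a) + (2 * q + 1) * (b + a)
    collect = ℕ-Ring.solve-∀
    identity : a ≡ q ⊎ a ≡ suc q → (b + a) * (b + a) + suc r * (q * (q + 1))
      ≡ b * b + r * (q * (q + 1)) + 2 * (b * a) + (2 * q + 1) * a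
    identity (inj₁ refl) = eq q b (r * (q * (q + 1)))
      where
      eq : ∀ q b z → (b + q) * (b + q) + (q * (q + 1) + z) ≡ b * b + z + 2 * (b * q) + (2 * q + 1) * q
      eq = ℕ-Ring.solve-∀
    identity (inj₂ refl) = eq q b (r * (q * (q + 1)))
      where
      eq : ∀ q b z → (b + (1 + q)) * (b + (1 + q)) + (q * (q + 1) + z)
                   ≡ b * b + z + 2 * (b * (1 + q)) + (2 * q + 1) * (1 + q)
      eq = ℕ-Ring.solve-∀

  turán-number-bounds : ∀ r n → 1 ≤ r →
    r * (2 * t r n) + n * n ≤ r * (n * n) × r * (n * n) ≤ r * (2 * t r n) + n * n + r * r
  turán-number-bounds r n 1≤r with turán-number r n 1≤r
  ... | record { q = q ; s = s ; division = refl ; remainder = s<r ; value = value }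
    with d , refl ← ℕ.m≤n⇒∃[o]m+o≡n (ℕ.<⇒≤ s<r) =
      ℕ.≤-trans (ℕ.m≤m+n _ (s * d)) (ℕ.≤-reflexive exact)
    , ℕ.≤-trans (ℕ.≤-reflexive (sym exact)) (ℕ.+-monoʳ-≤ _ (ℕ.*-mono-≤ (ℕ.m≤m+n s d) (ℕ.m≤n+m d s)))
    where
    open ≡-Reasoning
    R N : ℕ
    R = s + d
    N = s + q * R
    exact : R * (2 * t R N) + N * N + s * d ≡ R * (N * N)
    exact = ℕ.+-cancelʳ-≡ (R * (R * (q * (q + 1)))) _ _ (begin
      R * (2 * t R N) + N * N + s * d + R * (R * (q * (q + 1)))
        ≡⟨ collect (t R N) s d q ⟩
      R * (2 * t R N + (2 * q + 1) * N)
        ≡⟨ cong (R *_) value ⟩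
      R * (N * N + R * (q * (q + 1)))
        ≡⟨ ℕ.*-distribˡ-+ R (N * N) (R * (q * (q + 1))) ⟩
      R * (N * N) + R * (R * (q * (q + 1))) ∎)
      where
      collect : ∀ t s d q → let R = s + d ; N = s + q * R in
        R * (2 * t) + N * N + s * d + R * (R * (q * (q + 1))) ≡ R * (2 * t + (2 * q + 1) * N)
      collect = ℕ-Ring.solve-∀

  turán-theorem : ∀ {n} (G : Graph n) r → 1 ≤ r → t r n < edges G → Clique G (suc r)
  turán-theorem {n} G r 1≤r t<e with hasClique? (suc r) G
  ... | yes clique = HasClique⇒clique G clique
  ... | no none with turán-number r n 1≤r
  ...   | record { q = q ; value = value } = contradiction t<e (ℕ.≤⇒≯ (ℕ.*-cancelˡ-≤ 2
    (ℕ.+-cancelʳ-≤ ((2 * q + 1) * n) _ _ (begin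
      2 * edges G + (2 * q + 1) * n
        ≡⟨ cong₂ (λ x y → x + (2 * q + 1) * y) (edges-⟨⟩ G) n-ones ⟨
      ⟨ ones , ones ⟩[ adj G ] + (2 * q + 1) * sum {n} ones
        ≤⟨ weighted-turán G r q ones (λ c _ → none (clique⇒HasClique G c)) ⟩
      sum {n} ones * sum {n} ones + r * (q * (q + 1))
        ≡⟨ cong (λ x → x * x + r * (q * (q + 1))) n-ones ⟩
      n * n + r * (q * (q + 1))
        ≡⟨ value ⟨
      2 * t r n + (2 * q + 1) * n ∎))))
    where
    open ℕ.≤-Reasoning
    n-ones : sum {n} ones ≡ n
    n-ones = trans (sum-const n 1) (ℕ.*-identityʳ n)

-- The extremal construction

module Construction (r a b N : ℕ) where
  open Data.Nat.Base using (_+_; _*_; _≤_; _<_; _<ᵇ_)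

  -- The vertices below b form a Turán graph with r parts; the other a vertices
  -- are independent, and N of the a * b pairs between are joined, starting
  -- with those at the smallest vertices below b.

  n : ℕ
  n = b + a

  across : ℕ → ℕ → Bool
  across i j = i * a + (j ∸ b) <ᵇ N

  link : Bool → Bool → ℕ → ℕ → Bool
  link true  true  i j = not (divides₁ r i j)
  link true  false i j = across i j
  link false true  i j = across j i
  link false false i j = false

  linked : ℕ → ℕ → Bool
  linked i j = link (i <ᵇ b) (j <ᵇ b) i j

  linked-sym : ∀ i j → linked i j ≡ linked j i
  linked-sym i j with i <ᵇ b | j <ᵇ b
  ... | true  | true  = cong (λ d → not (does (r ∣? d))) (ℕ.∣-∣-comm i j)
  ... | true  | false = refl
  ... | false | true  = refl
  ... | false | false = refl

  linked-irrefl : ∀ i → linked i i ≡ false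
  linked-irrefl i with i <ᵇ b
  ... | false = refl
  ... | true rewrite ℕ.∣n-n∣≡0 i with r ∣? 0
  ...   | yes _  = refl
  ...   | no r∤0 = contradiction (r ℕ.∣0) r∤0

  G : Graph n
  G = record
    { adj        = λ u v → linked (toℕ u) (toℕ v)
    ; adj-sym    = λ u v → linked-sym (toℕ u) (toℕ v)
    ; adj-irrefl = λ v → linked-irrefl (toℕ v)
    }

  flatten : ∀ m f → rangeSum m (λ i → rangeSum a λ j → f (i * a + j)) ≡ rangeSum (m * a) f
  flatten zero    f = refl
  flatten (suc m) f = trans (cong (_+ rangeSum a (λ j → f (m * a + j))) (flatten m f))
    (trans (sym (rangeSum-append (m * a) a f)) (cong (λ k → rangeSum k f) (ℕ.+-comm (m * a) a)))

  <ᵇ-true : ∀ {i j} → i < j → (i <ᵇ j) ≡ true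
  <ᵇ-true {i} {j} i<j with i <ᵇ j | ℕ.<⇒<ᵇ i<j
  ... | true | _ = refl

  <ᵇ-false : ∀ {i j} → j ≤ i → (i <ᵇ j) ≡ false
  <ᵇ-false {i} {j} j≤i with i <ᵇ j | ℕ.<ᵇ⇒< i j
  ... | false | _ = refl
  ... | true  | i<j = contradiction (i<j tt) (ℕ.≤⇒≯ j≤i)

  edge-count : N ≤ b * a → edges G ≡ t r b + N
  edge-count N≤ab = begin
    edges G
      ≡⟨ trans (edges-sum G) (sum<-toℕ n λ u v → χ (linked u v)) ⟩
    rangeSum (b + a) (λ v → rangeSum v λ u → χ (linked u v))
      ≡⟨ rangeSum-append b a _ ⟩
    rangeSum b (λ v → rangeSum v λ u → χ (linked u v))
      + rangeSum a (λ j → rangeSum (b + j) λ u → χ (linked u (b + j)))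
      ≡⟨ cong₂ _+_ (trans (rangeSum-cong b λ v v<b → rangeSum-cong v λ u u<v →
           cong₂ (λ x y → χ (link x y u v)) (<ᵇ-true (ℕ.<-trans u<v v<b)) (<ᵇ-true v<b))
             (sym (t-range r b)))
           (rangeSum-cong a λ j _ → column j) ⟩
    t r b + rangeSum a (λ j → rangeSum b λ u → χ (u * a + j <ᵇ N))
      ≡⟨ cong (t r b +_) (trans (rangeSum-swap a b _) (flatten b λ i → χ (i <ᵇ N))) ⟩
    t r b + rangeSum (b * a) (λ i → χ (i <ᵇ N))
      ≡⟨ cong (t r b +_) (trans (rangeSum-cong (b * a) λ i _ → sym (ℕ.*-identityʳ _))
           (trans (rangeSum-below (b * a) N (λ _ → 1) N≤ab) (rangeSum-ones N))) ⟩
    t r b + N ∎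
    where
    open ≡-Reasoning
    column : ∀ j → rangeSum (b + j) (λ u → χ (linked u (b + j))) ≡ rangeSum b (λ u → χ (u * a + j <ᵇ N))
    column j = trans (rangeSum-append b j _) (trans (cong₂ _+_
      (rangeSum-cong b λ u u<b → trans
        (cong₂ (λ x y → χ (link x y u (b + j))) (<ᵇ-true u<b) (<ᵇ-false {b + j} {b} (ℕ.m≤m+n b j)))
        (cong (λ k → χ (u * a + k <ᵇ N)) (ℕ.m+n∸m≡n b j)))
      (rangeSum-zero j λ i _ → cong₂ (λ x y → χ (link x y (b + i) (b + j)))
        (<ᵇ-false {b + i} {b} (ℕ.m≤m+n b i)) (<ᵇ-false {b + j} {b} (ℕ.m≤m+n b j))))
      (ℕ.+-identityʳ _))

  module _ (1≤r : 1 ≤ r) where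

    private instance
      r≢0 : ℕ.NonZero r
      r≢0 = ℕ.>-nonZero 1≤r

    residue : ℕ → Fin r
    residue i = Fin.fromℕ< (ℕ.m%n<n i r)

    residue-∣ : ∀ i j → residue i ≡ residue j → r ∣ ℕ.∣ i - j ∣
    residue-∣ i j eq = ℕ.divides ℕ.∣ i ℕ./ r - j ℕ./ r ∣ (begin
      ℕ.∣ i - j ∣
        ≡⟨ cong₂ ℕ.∣_-_∣ (ℕ.m≡m%n+[m/n]*n i r) (ℕ.m≡m%n+[m/n]*n j r) ⟩
      ℕ.∣ i ℕ.% r + i ℕ./ r * r - j ℕ.% r + j ℕ./ r * r ∣
        ≡⟨ cong (λ x → ℕ.∣ x + i ℕ./ r * r - j ℕ.% r + j ℕ./ r * r ∣) same ⟩
      ℕ.∣ j ℕ.% r + i ℕ./ r * r - j ℕ.% r + j ℕ./ r * r ∣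
        ≡⟨ ℕ.∣m+n-m+o∣≡∣n-o∣ (j ℕ.% r) _ _ ⟩
      ℕ.∣ i ℕ./ r * r - j ℕ./ r * r ∣
        ≡⟨ ℕ.*-distribʳ-∣-∣ r (i ℕ./ r) (j ℕ./ r) ⟨
      ℕ.∣ i ℕ./ r - j ℕ./ r ∣ * r ∎)
      where
      open ≡-Reasoning
      same : i ℕ.% r ≡ j ℕ.% r
      same = trans (sym (Fin.toℕ-fromℕ< (ℕ.m%n<n i r))) (trans (cong toℕ eq) (Fin.toℕ-fromℕ< (ℕ.m%n<n j r)))

    color : ℕ → Fin (suc r)
    color i = if i <ᵇ b then suc (residue i) else zero

    data SameColor (i j : ℕ) : Set where
      outside : b ≤ i → b ≤ j → SameColor i j
      inside  : i < b → j < b → r ∣ ℕ.∣ i - j ∣ → SameColor i j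

    same-color : ∀ i j → color i ≡ color j → SameColor i j
    same-color i j eq with i <ᵇ b in i<b | j <ᵇ b in j<b
    ... | true  | true  = inside (ℕ.<ᵇ⇒< i b (subst T (sym i<b) tt)) (ℕ.<ᵇ⇒< j b (subst T (sym j<b) tt))
                            (residue-∣ i j (Fin.suc-injective eq))
    ... | false | false = outside (ℕ.≮⇒≥ λ lt → subst T i<b (ℕ.<⇒<ᵇ lt)) (ℕ.≮⇒≥ λ lt → subst T j<b (ℕ.<⇒<ᵇ lt))

    same-color-unlinked : ∀ {i j} → SameColor i j → ¬ T (linked i j)
    same-color-unlinked {i} {j} (outside b≤i b≤j)
      rewrite <ᵇ-false {i} {b} b≤i | <ᵇ-false {j} {b} b≤j = λ ()
    same-color-unlinked {i} {j} (inside i<b j<b d)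
      rewrite <ᵇ-true {i} {b} i<b | <ᵇ-true {j} {b} j<b with r ∣? ℕ.∣ i - j ∣
    ... | yes _  = λ ()
    ... | no r∤d = contradiction d r∤d

    clique-free : ¬ HasClique (suc (suc r)) G
    clique-free h with c , cl ← HasClique⇒clique G h
                  with i , j , i<j , eq ← Fin.pigeonhole ℕ.≤-refl (color ∘ toℕ ∘ c) =
      same-color-unlinked (same-color _ _ eq) (cl i j (Fin.<⇒≢ i<j))

    SatType : ℕ → ℕ → Set
    SatType i j = (b ≤ i × b ≤ j) ⊎ (j * a < N × r ∣ ℕ.∣ i - j ∣)

    module _ {x y : Fin n} (x≢y : x ≢ y) (clique : Clique (addEdge G x y x≢y) (suc (suc r))) where

      c : Fin (suc (suc r)) → Fin n
      c = proj₁ clique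

      cl : IsTuple (addEdge G x y x≢y) c
      cl = proj₂ clique

      new : ∀ {u v} → ¬ Adj G u v → Adj (addEdge G x y x≢y) u v → (u ≡ x × v ≡ y) ⊎ (u ≡ y × v ≡ x)
      new {u} {v} ¬uv uv with adj G u v | u Fin.≟ x | v Fin.≟ y | v Fin.≟ x | u Fin.≟ y
      ... | true | _ | _ | _ | _ = contradiction tt ¬uv
      ... | false | yes p | yes q | _ | _ = inj₁ (p , q)
      ... | false | _ | _ | yes p | yes q = inj₂ (q , p)
      ... | false | yes _ | no _ | no _ | _ = ⊥-elim uv
      ... | false | yes _ | no _ | yes _ | no _ = ⊥-elim uv
      ... | false | no _ | _ | no _ | _ = ⊥-elim uv
      ... | false | no _ | _ | yes _ | no _ = ⊥-elim uv

      old : ∀ {u v} → u ≢ x → u ≢ y → Adj (addEdge G x y x≢y) u v → Adj G u v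
      old u≢x u≢y uv = decidable-stable (T? _) λ ¬uv →
        [ u≢x ∘ proj₁ , u≢y ∘ proj₁ ]′ (new ¬uv uv)

      c-injective : ∀ i j → c i ≡ c j → i ≡ j
      c-injective = tuple-injective (addEdge G x y x≢y) cl

      monochromatic : ∀ i j → i ≢ j → color (toℕ (c i)) ≡ color (toℕ (c j)) →
        (c i ≡ x × c j ≡ y) ⊎ (c i ≡ y × c j ≡ x)
      monochromatic i j i≢j eq = new (same-color-unlinked (same-color _ _ eq)) (cl i j i≢j)

      positions : ∃[ i ] ∃[ j ] (c i ≡ x × c j ≡ y × color (toℕ x) ≡ color (toℕ y))
      positions with i , j , i<j , eq ← Fin.pigeonhole ℕ.≤-refl (color ∘ toℕ ∘ c)
                with monochromatic i j (Fin.<⇒≢ i<j) eq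
      ... | inj₁ (p , q) = i , j , p , q , subst₂ (λ u v → color (toℕ u) ≡ color (toℕ v)) p q eq
      ... | inj₂ (p , q) = j , i , q , p , sym (subst₂ (λ u v → color (toℕ u) ≡ color (toℕ v)) p q eq)

      -- Outside x every color class holds at most one vertex of the clique,
      -- so all r + 1 colors occur there.

      apex : ∃[ k ] b ≤ toℕ (c k)
      apex with Fin.any? (λ k → b ℕ.≤? toℕ (c k))
      ... | yes found = found
      ... | no none with i , j , cᵢ≡x , cⱼ≡y , _ ← positions
                    with k , l , k<l , eq ← Fin.pigeonhole ℕ.≤-refl
                           (residue ∘ toℕ ∘ c ∘ Fin.punchIn i) =
        ⊥-elim ([ (λ (p , _) → Fin.punchInᵢ≢i i k (c-injective _ _ (trans p (sym cᵢ≡x))))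
                , (λ (_ , q) → Fin.punchInᵢ≢i i l (c-injective _ _ (trans q (sym cᵢ≡x)))) ]′
          (monochromatic (Fin.punchIn i k) (Fin.punchIn i l)
            (λ eq′ → Fin.<⇒≢ k<l (Fin.punchIn-injective i k l eq′))
            (cong₂ (λ p q → if p then suc q else zero)
              (trans (below (Fin.punchIn i k)) (sym (below (Fin.punchIn i l)))) eq)))
        where
        below : ∀ k → (toℕ (c k) <ᵇ b) ≡ true
        below k = <ᵇ-true (ℕ.≰⇒> λ b≤ → none (k , b≤))

      sat-type : SatType (toℕ x) (toℕ y)
      sat-type with i , j , cᵢ≡x , cⱼ≡y , eq ← positions with same-color _ _ eq
      ... | outside b≤x b≤y = inj₁ (b≤x , b≤y)
      ... | inside x<b y<b d with k , b≤z ← apex = inj₂ (ℕ.≤-<-trans (ℕ.m≤m+n _ _) joined , d)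
        where
        z≢ : ∀ {w} → toℕ w < b → c k ≢ w
        z≢ w<b eq = ℕ.<⇒≱ w<b (subst (λ u → b ≤ toℕ u) eq b≤z)
        edge : Adj G (c k) y
        edge = old (z≢ x<b) (z≢ y<b) (subst (Adj (addEdge G x y x≢y) (c k)) cⱼ≡y
          (cl k j λ { refl → z≢ y<b cⱼ≡y }))
        joined : toℕ y * a + (toℕ (c k) ∸ b) < N
        joined = ℕ.<ᵇ⇒< _ _ (subst T (cong₂ (λ p q → link p q (toℕ (c k)) (toℕ y))
          (<ᵇ-false {toℕ (c k)} {b} b≤z) (<ᵇ-true y<b)) edge)

    triangle : ∀ m → 2 * rangeSum m id + m ≡ m * m
    triangle zero    = refl
    triangle (suc m) = trans (regroup (rangeSum m id) m) (trans (cong (_+ (2 * m + 1)) (triangle m)) (square m))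
      where
      regroup : ∀ s m → 2 * (s + m) + (1 + m) ≡ 2 * s + m + (2 * m + 1)
      regroup = ℕ-Ring.solve-∀
      square : ∀ m → m * m + (2 * m + 1) ≡ (1 + m) * (1 + m)
      square = ℕ-Ring.solve-∀

    satCount-bound : ∀ B → B ≤ n → (∀ v → v * a < N → v < B) →
      2 * r * satCount (suc (suc r)) G ≤ r * (a * a) + B * B
    satCount-bound B B≤n small = begin
      2 * r * satCount (suc (suc r)) G
        ≡⟨ cong (2 * r *_) (count-pairs (isSaturating? (suc (suc r)) G)) ⟩
      2 * r * sum< (λ u v → χ (does (isSaturating? (suc (suc r)) G (u , v))))
        ≤⟨ ℕ.*-monoʳ-≤ (2 * r) (sum<-mono {h′ = λ u v → h (toℕ u) (toℕ v)} λ {u} {v} _ → pair-bound u v) ⟩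
      2 * r * sum< {n} (λ u v → h (toℕ u) (toℕ v))
        ≡⟨ cong (2 * r *_) (sum<-toℕ n h) ⟩
      2 * r * rangeSum n (λ v → rangeSum v λ u → h u v)
        ≡⟨ cong (2 * r *_) (trans (rangeSum-cong n λ v _ → rangeSum-+ v _ _) (rangeSum-+ n _ _)) ⟩
      2 * r * (rangeSum n (λ v → rangeSum v λ u → χ (not (u <ᵇ b)))
        + rangeSum n (λ v → rangeSum v λ u → χ (v <ᵇ B) * χ (divides₁ r u v)))
        ≡⟨ regroup r _ _ ⟩
      r * (2 * rangeSum n (λ v → rangeSum v λ u → χ (not (u <ᵇ b))))
        + 2 * (r * rangeSum n (λ v → rangeSum v λ u → χ (v <ᵇ B) * χ (divides₁ r u v)))
        ≤⟨ ℕ.+-mono-≤ (ℕ.*-monoʳ-≤ r outer) inner ⟩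
      r * (a * a) + B * B ∎
      where
      open ℕ.≤-Reasoning
      regroup : ∀ r x y → 2 * r * (x + y) ≡ r * (2 * x) + 2 * (r * y)
      regroup = ℕ-Ring.solve-∀
      h : ℕ → ℕ → ℕ
      h u v = χ (not (u <ᵇ b)) + χ (v <ᵇ B) * χ (divides₁ r u v)
      pair-bound : ∀ u v → χ (does (isSaturating? (suc (suc r)) G (u , v))) ≤ h (toℕ u) (toℕ v)
      pair-bound u v with isSaturating? (suc (suc r)) G (u , v)
      ... | no _ = z≤n
      ... | yes (u≢v , _ , clique) with sat-type u≢v (HasClique⇒clique (addEdge G u v u≢v) clique)
      ...   | inj₁ (b≤u , _) = ℕ.≤-trans (ℕ.≤-reflexive (sym (cong (χ ∘ not) (<ᵇ-false {toℕ u} {b} b≤u)))) (ℕ.m≤m+n _ _)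
      ...   | inj₂ (va<N , d) = ℕ.≤-trans
              (ℕ.≤-reflexive (sym (cong₂ _*_ (χ-< (small (toℕ v) va<N)) (χ-one (T-does⁺ (r ∣? _) d)))))
              (ℕ.m≤n+m _ _)
      outer : 2 * rangeSum n (λ v → rangeSum v λ u → χ (not (u <ᵇ b))) ≤ a * a
      outer = begin
        2 * rangeSum n (λ v → rangeSum v λ u → χ (not (u <ᵇ b)))
          ≡⟨ cong (2 *_) (trans (rangeSum-append b a _) (cong₂ _+_
               (rangeSum-zero b λ v v<b → rangeSum-zero v λ u u<v →
                 cong (χ ∘ not) (<ᵇ-true (ℕ.<-trans u<v v<b)))
               (rangeSum-cong a λ j _ → trans (rangeSum-append b j _) (cong₂ _+_
                 (rangeSum-zero b λ u u<b → cong (χ ∘ not) (<ᵇ-true u<b))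
                 (trans (rangeSum-cong j λ i _ → cong (χ ∘ not) (<ᵇ-false {b + i} {b} (ℕ.m≤m+n b i))) (rangeSum-ones j)))))) ⟩
        2 * rangeSum a id
          ≤⟨ ℕ.m≤m+n _ a ⟩
        2 * rangeSum a id + a
          ≡⟨ triangle a ⟩
        a * a ∎
      inner : 2 * (r * rangeSum n (λ v → rangeSum v λ u → χ (v <ᵇ B) * χ (divides₁ r u v))) ≤ B * B
      inner = begin
        2 * (r * rangeSum n (λ v → rangeSum v λ u → χ (v <ᵇ B) * χ (divides₁ r u v)))
          ≡⟨ cong (λ x → 2 * (r * x)) (trans
               (rangeSum-cong n λ v _ → sym (rangeSum-* v (χ (v <ᵇ B)) _))
               (rangeSum-below n B (multiples r) B≤n)) ⟩
        2 * (r * rangeSum B (multiples r))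
          ≡⟨ cong (2 *_) (rangeSum-* B r _) ⟩
        2 * rangeSum B (λ v → r * multiples r v)
          ≤⟨ ℕ.*-monoʳ-≤ 2 (rangeSum-mono B λ v _ → multiples-bound r v 1≤r) ⟩
        2 * rangeSum B id
          ≤⟨ ℕ.m≤m+n _ B ⟩
        2 * rangeSum B id + B
          ≡⟨ triangle B ⟩
        B * B ∎

-- Existence of the minimum

module _ where
  open Data.Nat.Base using (_+_; _*_; _≤_; _<_)

  does-cong : ∀ {A B : Set} (A? : Dec A) (B? : Dec B) → (A → B) → (B → A) → does A? ≡ does B?
  does-cong (yes _) (yes _) f g = refl
  does-cong (no _)  (no _)  f g = refl
  does-cong (yes a) (no ¬b) f g = contradiction (f a) ¬b
  does-cong (no ¬a) (yes b) f g = contradiction (g b) ¬a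

  module _ {n : ℕ} where

    _≈_ : Graph n → Graph n → Set
    G ≈ H = ∀ u v → adj G u v ≡ adj H u v

    HasClique-≈ : ∀ {G H k} → G ≈ H → HasClique k G → HasClique k H
    HasClique-≈ eq (S , card , cl) = S , card , λ u u∈ v v∈ u≢v → subst T (eq u v) (cl u u∈ v v∈ u≢v)

    edges-≈ : ∀ {G H} → G ≈ H → edges G ≡ edges H
    edges-≈ {G} {H} eq = trans (edges-sum G)
      (trans (sum<-cong λ u v → cong χ (eq u v)) (sym (edges-sum H)))

    saturating-≈ : ∀ {G H k} → G ≈ H → ∀ {e} → IsSaturating k G e → IsSaturating k H e
    saturating-≈ {G} {H} eq {x , y} (x≢y , ¬xy , clique) =
      x≢y , ¬xy ∘ subst T (sym (eq x y)) ,
      HasClique-≈ {addEdge G x y x≢y} {addEdge H x y x≢y} (λ u v → cong (_∨ _) (eq u v)) clique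

    satCount-≈ : ∀ {G H k} → G ≈ H → satCount k G ≡ satCount k H
    satCount-≈ {G} {H} {k} eq = trans (count-pairs (isSaturating? k G)) (trans
      (sum<-cong λ u v → cong χ (does-cong (isSaturating? k G (u , v)) (isSaturating? k H (u , v))
        (saturating-≈ {G} {H} eq) (saturating-≈ {H} {G} λ u v → sym (eq u v))))
      (sym (count-pairs (isSaturating? k H))))

    decode : Subset (n * n) → Graph n
    decode S = record
      { adj = edge
      ; adj-sym = λ u v → cong₂ _∧_
          (∨-comm (Vec.lookup S (Fin.combine u v)) (Vec.lookup S (Fin.combine v u)))
          (cong not (does-cong (u Fin.≟ v) (v Fin.≟ u) sym sym))
      ; adj-irrefl = irrefl
      }
      where
      edge : Fin n → Fin n → Bool
      edge u v = (Vec.lookup S (Fin.combine u v) ∨ Vec.lookup S (Fin.combine v u)) ∧ not (does (u Fin.≟ v))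
      irrefl : ∀ v → edge v v ≡ false
      irrefl v with v Fin.≟ v
      ... | yes _  = ∧-zeroʳ _
      ... | no v≢v = contradiction refl v≢v

    encode : Graph n → Subset (n * n)
    encode G = Vec.tabulate λ k → adj G (proj₁ (Fin.remQuot {n} n k)) (proj₂ (Fin.remQuot {n} n k))

    decode-encode : ∀ G → G ≈ decode (encode G)
    decode-encode G u v with u Fin.≟ v
    ... | yes refl = trans (adj-irrefl G u) (sym (∧-zeroʳ _))
    ... | no _     = begin
      adj G u v
        ≡⟨ ∨-idem _ ⟨
      adj G u v ∨ adj G u v
        ≡⟨ cong (adj G u v ∨_) (adj-sym G u v) ⟩
      adj G u v ∨ adj G v u
        ≡⟨ cong₂ _∨_ (bit u v) (bit v u) ⟨
      Vec.lookup (encode G) (Fin.combine u v) ∨ Vec.lookup (encode G) (Fin.combine v u)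
        ≡⟨ ∧-identityʳ _ ⟨
      (Vec.lookup (encode G) (Fin.combine u v) ∨ Vec.lookup (encode G) (Fin.combine v u)) ∧ true ∎
      where
      open ≡-Reasoning
      bit : ∀ u v → Vec.lookup (encode G) (Fin.combine u v) ≡ adj G u v
      bit u v = trans (Vec.lookup∘tabulate _ (Fin.combine u v))
        (cong (λ (i , j) → adj G i j) (Fin.remQuot-combine u v))

  satValue? : ∀ k n m → Decidable (SatValue k n m)
  satValue? k n m j = map′
    (λ (S , props) → decode {n} S , props)
    (λ (G , ¬clique , e , s) → let eq = decode-encode G in
      encode G
      , ¬clique ∘ HasClique-≈ {G = decode (encode G)} {G} (λ u v → sym (eq u v))
      , trans (sym (edges-≈ {G = G} {decode (encode G)} eq)) e
      , trans (sym (satCount-≈ {G = G} {decode (encode G)} eq)) s)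
    (anySubset? {n ℕ.* n} λ S → ¬? (hasClique? k (decode {n} S)) ×-dec (edges (decode {n} S) ℕ.≟ m)
      ×-dec (satCount k (decode {n} S) ℕ.≟ j))

  minimum : ∀ {P : ℕ → Set} → Decidable P → ∀ {j} → P j → ∃[ k ] IsMinimum P k
  minimum {P} P? {j} pj = search j 0 (ℕ.≤-reflexive (sym (ℕ.+-identityʳ j))) λ i ()
    where
    search : ∀ fuel k → j ≤ fuel + k → (∀ i → i < k → ¬ P i) → ∃[ k ] IsMinimum P k
    search fuel k enough below with P? k
    ... | yes pk = k , pk , λ i pi → ℕ.≮⇒≥ λ i<k → below i i<k pi
    ... | no ¬pk with fuel
    ...   | zero = ⊥-elim ([ (λ j<k → below j j<k pj) , (λ { refl → ¬pk pj }) ]′ (ℕ.m≤n⇒m<n∨m≡n enough))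
    ...   | suc fuel′ = search fuel′ (suc k)
              (ℕ.≤-trans enough (ℕ.≤-reflexive (sym (ℕ.+-suc fuel′ k))))
              λ i i<1+k pi → [ (λ i<k → below i i<k pi) , (λ { refl → ¬pk pi }) ]′
                (ℕ.m≤n⇒m<n∨m≡n (ℕ.s≤s⁻¹ i<1+k))

-- Rational arithmetic

module _ where
  open Data.Rational.Base using (_+_; _*_; _-_; -_; _≤_; _<_)

  ℚ-ring : AlmostCommutativeRing 0ℓ 0ℓ
  ℚ-ring = fromCommutativeRing ℚ.+-*-commutativeRing (λ x → dec⇒maybe (0ℚ ℚ.≟ x))

  0≤+ : ∀ {a b} → 0ℚ ≤ a → 0ℚ ≤ b → 0ℚ ≤ a + b
  0≤+ {a} {b} 0≤a 0≤b = ℚ.nonNegative⁻¹ (a + b)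
    {{ℚ.nonNeg+nonNeg⇒nonNeg a {{ℚ.nonNegative 0≤a}} b {{ℚ.nonNegative 0≤b}}}}

  0≤* : ∀ {a b} → 0ℚ ≤ a → 0ℚ ≤ b → 0ℚ ≤ a * b
  0≤* {a} {b} 0≤a 0≤b = ℚ.nonNegative⁻¹ (a * b)
    {{ℚ.nonNeg*nonNeg⇒nonNeg a {{ℚ.nonNegative 0≤a}} b {{ℚ.nonNegative 0≤b}}}}

  0<* : ∀ {a b} → 0ℚ < a → 0ℚ < b → 0ℚ < a * b
  0<* {a} {b} 0<a 0<b = ℚ.positive⁻¹ (a * b) {{ℚ.pos*pos⇒pos a {{ℚ.positive 0<a}} b {{ℚ.positive 0<b}}}}

  0≤square : ∀ a → 0ℚ ≤ a * a
  0≤square a with ℚ.≤-total 0ℚ a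
  ... | inj₁ 0≤a = 0≤* 0≤a 0≤a
  ... | inj₂ a≤0 = subst (0ℚ ≤_) (neg-square a) (0≤* 0≤-a 0≤-a)
    where
    0≤-a : 0ℚ ≤ - a
    0≤-a = ℚ.neg-antimono-≤ a≤0
    neg-square : ∀ a → (- a) * (- a) ≡ a * a
    neg-square = solve-∀ ℚ-ring

  0≤1 : 0ℚ ≤ 1ℚ
  0≤1 = ℚ.nonNegative⁻¹ 1ℚ

  2ℚ : ℚ
  2ℚ = 1ℚ + 1ℚ

  0≤2 : 0ℚ ≤ 2ℚ
  0≤2 = ℚ.nonNegative⁻¹ 2ℚ

  0<2 : 0ℚ < 2ℚ
  0<2 = ℚ.positive⁻¹ 2ℚ

  +-cancel : ∀ a b → a + b - a ≡ b
  +-cancel = solve-∀ ℚ-ring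

  neg-difference : ∀ a b → - (a - b) ≡ b - a
  neg-difference = solve-∀ ℚ-ring

  slack : ∀ {a b} → a ≤ b → 0ℚ ≤ b - a
  slack {a} {b} a≤b = subst (_≤ b - a) (ℚ.+-inverseʳ a) (ℚ.+-monoˡ-≤ (- a) a≤b)

  unslack : ∀ {a b} → 0ℚ ≤ b - a → a ≤ b
  unslack {a} {b} h = subst₂ _≤_ (ℚ.+-identityˡ a) (cancel b a) (ℚ.+-monoˡ-≤ a h)
    where
    cancel : ∀ b a → b - a + a ≡ b
    cancel = solve-∀ ℚ-ring

  ≤-by : ∀ {a b} c → b - a ≡ c → 0ℚ ≤ c → a ≤ b
  ≤-by c eq 0≤c = unslack (subst (0ℚ ≤_) (sym eq) 0≤c)

  ≤-by-eq : ∀ {a b c u v} k → u ≡ v → b - a ≡ c + k * (u - v) → 0ℚ ≤ c → a ≤ b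
  ≤-by-eq {c = c} {u} k refl eq = ≤-by c (trans eq (trans
    (cong (c +_) (trans (cong (k *_) (ℚ.+-inverseʳ u)) (ℚ.*-zeroʳ k))) (ℚ.+-identityʳ c)))

  ≤-+ : ∀ {a b} → 0ℚ ≤ b → a ≤ a + b
  ≤-+ {a} {b} = ≤-by b (+-cancel a b)

  0≤square-1 : ∀ {a} → 1ℚ ≤ a → 0ℚ ≤ a * a - 1ℚ
  0≤square-1 {a} 1≤a = subst (0ℚ ≤_) (factor a) (0≤* (slack 1≤a) (0≤+ (ℚ.≤-trans 0≤1 1≤a) 0≤1))
    where
    factor : ∀ a → (a - 1ℚ) * (a + 1ℚ) ≡ a * a - 1ℚ
    factor = solve-∀ ℚ-ring

  *-cancel-≤ : ∀ {a b c} → 0ℚ < c → c * a ≤ c * b → a ≤ b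
  *-cancel-≤ {c = c} 0<c = ℚ.*-cancelˡ-≤-pos c {{ℚ.positive 0<c}}

  -- Opaque, to keep the normal forms of fractions out of unification.

  opaque
    cast : ℕ → ℚ
    cast = ℕ→ℚ

    cast-ℕ→ℚ : ∀ k → ℕ→ℚ k ≡ cast k
    cast-ℕ→ℚ k = refl

    cast-0 : cast 0 ≡ 0ℚ
    cast-0 = refl

    cast-1 : cast 1 ≡ 1ℚ
    cast-1 = refl

    cast-+ : ∀ a b → cast (a ℕ.+ b) ≡ cast a + cast b
    cast-+ a b = ℚ.toℚᵘ-injective (begin
      toℚᵘ (cast (a ℕ.+ b))               ≈⟨ raw (a ℕ.+ b) ⟩
      mkℚᵘ (ℤ.+ (a ℕ.+ b)) 0              ≈⟨ ℚᵘ.*≡* (cong (ℤ._* ℤ.+ 1) (sym (cong₂ ℤ._+_ (ℤ.*-identityʳ (ℤ.+ a)) (ℤ.*-identityʳ (ℤ.+ b))))) ⟩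
      mkℚᵘ (ℤ.+ a) 0 ℚᵘ.+ mkℚᵘ (ℤ.+ b) 0  ≈⟨ ℚᵘ.+-cong (raw a) (raw b) ⟨
      toℚᵘ (cast a) ℚᵘ.+ toℚᵘ (cast b)     ≈⟨ ℚ.toℚᵘ-homo-+ (cast a) (cast b) ⟨
      toℚᵘ (cast a + cast b)               ∎)
      where
      open ℚᵘ.≃-Reasoning
      raw : ∀ a → toℚᵘ (cast a) ℚᵘ.≃ mkℚᵘ (ℤ.+ a) 0
      raw a = ℚ.toℚᵘ-fromℚᵘ (mkℚᵘ (ℤ.+ a) 0)

  cast-suc : ∀ a → cast (suc a) ≡ cast a + 1ℚ
  cast-suc a = trans (cong cast (ℕ.+-comm 1 a)) (trans (cast-+ a 1) (cong (cast a +_) cast-1))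

  cast-* : ∀ a b → cast (a ℕ.* b) ≡ cast a * cast b
  cast-* zero    b = trans cast-0 (trans (sym (ℚ.*-zeroˡ (cast b))) (cong (_* cast b) (sym cast-0)))
  cast-* (suc a) b = begin
    cast (b ℕ.+ a ℕ.* b)         ≡⟨ cast-+ b (a ℕ.* b) ⟩
    cast b + cast (a ℕ.* b)       ≡⟨ cong (cast b +_) (cast-* a b) ⟩
    cast b + cast a * cast b       ≡⟨ factor (cast a) (cast b) ⟩
    (cast a + 1ℚ) * cast b        ≡⟨ cong (_* cast b) (cast-suc a) ⟨
    cast (suc a) * cast b         ∎
    where
    open ≡-Reasoning
    factor : ∀ a b → b + a * b ≡ (a + 1ℚ) * b
    factor = solve-∀ ℚ-ring

  cast-0≤ : ∀ a → 0ℚ ≤ cast a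
  cast-0≤ zero    = ℚ.≤-reflexive (sym cast-0)
  cast-0≤ (suc a) = subst (0ℚ ≤_) (sym (cast-suc a)) (0≤+ (cast-0≤ a) 0≤1)

  cast-≤ : ∀ {a b} → a ℕ.≤ b → cast a ≤ cast b
  cast-≤ {a} a≤b with d , refl ← ℕ.m≤n⇒∃[o]m+o≡n a≤b =
    ≤-by (cast d) (trans (cong (_- cast a) (cast-+ a d)) (+-cancel (cast a) (cast d))) (cast-0≤ d)

  cast-< : ∀ {a b} → a ℕ.< b → cast a < cast b
  cast-< {a} {b} a<b = ℚ.<-≤-trans
    (subst₂ _<_ (ℚ.+-identityʳ (cast a)) (sym (cast-suc a)) (ℚ.+-monoʳ-< (cast a) (ℚ.positive⁻¹ 1ℚ)))
    (cast-≤ a<b)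

  cast-cancel-≤ : ∀ {a b} → cast a ≤ cast b → a ℕ.≤ b
  cast-cancel-≤ a≤b = ℕ.≮⇒≥ λ b<a → ℚ.<-irrefl refl (ℚ.<-≤-trans (cast-< b<a) a≤b)

  cast-1≤ : ∀ {a} → 1 ℕ.≤ a → 1ℚ ≤ cast a
  cast-1≤ {a} 1≤a = subst (_≤ cast a) cast-1 (cast-≤ 1≤a)

  cast-2 : cast 2 ≡ 2ℚ
  cast-2 = trans (cast-suc 1) (cong (_+ 1ℚ) cast-1)

  infixl 6 _⊞_
  infixl 7 _⊠_

  _⊞_ : ∀ {a b x y} → cast a ≡ x → cast b ≡ y → cast (a ℕ.+ b) ≡ x + y
  _⊞_ {a} {b} refl refl = cast-+ a b

  _⊠_ : ∀ {a b x y} → cast a ≡ x → cast b ≡ y → cast (a ℕ.* b) ≡ x * y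
  _⊠_ {a} {b} refl refl = cast-* a b

  ⟨_,_⟩≤ : ∀ {a b x y} → cast a ≡ x → cast b ≡ y → a ℕ.≤ b → x ≤ y
  ⟨ refl , refl ⟩≤ = cast-≤

  nonneg-fraction : ∀ z → 0ℚ ≤ z → ∃[ a ] ∃[ b ] (0 ℕ.< b × z * cast b ≡ cast a)
  nonneg-fraction z@(mkℚ (ℤ.+ a) d _) 0≤z = a , suc d , s≤s z≤n , fraction
    where
    opaque
      unfolding cast
      fraction : z * cast (suc d) ≡ cast a
      fraction = ℚ.toℚᵘ-injective (ℚᵘ.≃-trans (ℚ.toℚᵘ-homo-* z (ℕ→ℚ (suc d))) (ℚᵘ.≃-trans
        (ℚᵘ.*-congˡ {toℚᵘ z} (ℚ.toℚᵘ-fromℚᵘ (mkℚᵘ (ℤ.+ suc d) 0)))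
        (ℚᵘ.≃-trans (ℚᵘ.*≡* (ℤ.*-assoc (ℤ.+ a) (ℤ.+ suc d) (ℤ.+ 1)))
          (ℚᵘ.≃-sym (ℚ.toℚᵘ-fromℚᵘ (mkℚᵘ (ℤ.+ a) 0))))))
  nonneg-fraction (mkℚ ℤ.-[1+ a ] d _) 0≤z = contradiction 0≤z λ { (ℚ.*≤* ()) }

-- The optimisation problem

-- In the extremal graph x n independent vertices are joined to y n vertices,
-- spread evenly over r parts; it has (r x² + y²) n² / 2r saturating pairs. The
-- equation xy makes its density l, and slope, which is the quartic divided by
-- 2 p r x, is nonnegative when x is not below the minimiser of r x² + y².

module Optimum (r x y l : ℚ) where
  open Data.Rational.Base using (_+_; _*_; _-_; -_; _≤_; _<_)

  slope : ℚ
  slope = 2ℚ * (r + 1ℚ) * r * r * (x * x * x) - y * (l + (r * r - 1ℚ) * (x * x))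

  excess : ℚ → ℚ → ℚ
  excess T H = (r + 1ℚ) * r * r * T * (T * T - x * x * (H * H))
             - 2ℚ * (r + 1ℚ) * r * T * (y * y * (H * H))
             + y * H * (l * (H * H) + (r * r - 1ℚ) * (2ℚ * T * H - T * T))

  module _ (0≤r : 0ℚ ≤ r) (0<x : 0ℚ < x) (0≤y : 0ℚ ≤ y) (0≤l : 0ℚ ≤ l) (0≤slope : 0ℚ ≤ slope)
    (xy : 2ℚ * (r + 1ℚ) * r * x * y ≡ l + (r * r - 1ℚ) * (2ℚ * x - x * x)) where

    private
      0≤x : 0ℚ ≤ x
      0≤x = ℚ.<⇒≤ 0<x
      0≤p : 0ℚ ≤ r + 1ℚ
      0≤p = 0≤+ 0≤r 0≤1

    excess-bound : ∀ T H → 0ℚ ≤ T → 0ℚ ≤ H → 0ℚ ≤ x * excess T H + T * slope * (H * H)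
    excess-bound T H 0≤T 0≤H = *-cancel-≤ 0<x (≤-by-eq (- (T * y * x * (H * H))) xy (identity r x y l T H)
      (0≤+ (0≤+ (0≤* (0≤* (0≤* (0≤* (0≤* (0≤* 0≤x 0≤x) 0≤p) 0≤r) 0≤r) 0≤T) (0≤square (T - x * H)))
                (0≤* (0≤* (0≤* 0≤T 0≤T) 0≤slope) 0≤H))
           (0≤* (0≤* (0≤* 0≤y 0≤l) (0≤square (T - x * H))) 0≤H)))
      where
      identity : ∀ r x y l T H →
        let G = 2ℚ * (r + 1ℚ) * r * r * (x * x * x) - y * (l + (r * r - 1ℚ) * (x * x))
            D = (r + 1ℚ) * r * r * T * (T * T - x * x * (H * H))
              - 2ℚ * (r + 1ℚ) * r * T * (y * y * (H * H))
              + y * H * (l * (H * H) + (r * r - 1ℚ) * (2ℚ * T * H - T * T)) in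
        x * (x * D + T * G * (H * H)) - x * 0ℚ
          ≡ (x * x * (r + 1ℚ) * r * r * T * ((T - x * H) * (T - x * H)) + T * T * G * H
             + y * l * ((T - x * H) * (T - x * H)) * H)
            + - (T * y * x * (H * H)) * (2ℚ * (r + 1ℚ) * r * x * y
               - (l + (r * r - 1ℚ) * (2ℚ * x - x * x)))
      identity = solve-∀ ℚ-ring

    module Lower (n m S K L T V MM NN e s c : ℚ)
      (0≤n : 0ℚ ≤ n) (0≤K : 0ℚ ≤ K) (0<L : 0ℚ < L) (0≤c : 0ℚ ≤ c)
      (capacity : (r + 1ℚ) * T + V ≡ n * L) (0≤V : 0ℚ ≤ V) (L≤T : L ≤ T) (K≤L : K * n ≤ L)
      (0≤s : 0ℚ ≤ s)
      (edge-bound : L * L * (2ℚ * m) + ((r + 1ℚ) * (T * T) + 2ℚ * (T * V))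
        ≤ r * ((r + 1ℚ) * (T * T) + 2ℚ * (T * V)) + (MM + 2ℚ * NN) + e)
      (turán-part : r * e + V * V ≤ r * (V * V))
      (MM-bound : MM ≤ (r + 1ℚ) * (T * T))
      (sat-bound : MM + 2ℚ * NN + s ≤ L * L * (2ℚ * S + n))
      (m-bound : (r * r - 1ℚ + l) * (n * n) - c ≤ 2ℚ * (r + 1ℚ) * r * m)
      (swap-tangent : ∀ Z → 0ℚ ≤ Z → 2ℚ * (Z * NN) ≤ r * (T * s) + (T + K) * (Z * Z))
      (slope-small : n * slope ≤ x) where

      private
        H B X₂ : ℚ
        H = n * L
        B = l * (H * H) + (r * r - 1ℚ) * (2ℚ * T * H - (r + 1ℚ) * (T * T)) - c * (L * L)
        X₂ = L * L * (2ℚ * S + n)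
        0≤L : 0ℚ ≤ L
        0≤L = ℚ.<⇒≤ 0<L
        0<T : 0ℚ < T
        0<T = ℚ.<-≤-trans 0<L L≤T
        0≤T : 0ℚ ≤ T
        0≤T = ℚ.<⇒≤ 0<T
        0≤H : 0ℚ ≤ H
        0≤H = 0≤* 0≤n 0≤L

      swap-bound : B ≤ (r + 1ℚ) * r * (2ℚ * NN + MM)
      swap-bound = ≤-by-eq (- ((r * r - 1ℚ) * ((r + 1ℚ) * T + V + n * L - 2ℚ * T))) capacity (identity r T n L l m MM NN e c V)
        (0≤+ (0≤+ (0≤* (0≤* 0≤p 0≤r) (slack edge-bound)) (0≤* 0≤p (slack turán-part)))
             (0≤* (0≤* 0≤L 0≤L) (slack m-bound)))
        where
        identity : ∀ r T n L l m MM NN e c V →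
          (r + 1ℚ) * r * (2ℚ * NN + MM)
            - (l * (n * L * (n * L)) + (r * r - 1ℚ) * (2ℚ * T * (n * L) - (r + 1ℚ) * (T * T)) - c * (L * L))
          ≡ ((r + 1ℚ) * r * (r * ((r + 1ℚ) * (T * T) + 2ℚ * (T * V)) + (MM + 2ℚ * NN) + e
                - (L * L * (2ℚ * m) + ((r + 1ℚ) * (T * T) + 2ℚ * (T * V))))
             + (r + 1ℚ) * (r * (V * V) - (r * e + V * V))
             + L * L * (2ℚ * (r + 1ℚ) * r * m - ((r * r - 1ℚ + l) * (n * n) - c)))
            + - ((r * r - 1ℚ) * ((r + 1ℚ) * T + V + n * L - 2ℚ * T)) * ((r + 1ℚ) * T + V - n * L)
        identity = solve-∀ ℚ-ring

      module Sparse (sparse : r * T ≤ y * H) where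

        private
          Z W : ℚ
          Z = y * H - r * T
          W = y * H * B - (r + 1ℚ) * (r + 1ℚ) * r * Z * (T * T) - (r + 1ℚ) * r * (T + K) * (Z * Z)
          0≤Z : 0ℚ ≤ Z
          0≤Z = slack sparse

        collected : W ≤ (r + 1ℚ) * r * r * T * X₂
        collected = ≤-by _ (identity r T H y MM NN s K B X₂)
          (0≤+ (0≤+ (0≤+ (0≤* (0≤* (0≤* (0≤* 0≤p 0≤r) 0≤r) 0≤T) (slack sat-bound))
                         (0≤* (0≤* 0≤p 0≤r) (slack (swap-tangent Z 0≤Z))))
                    (0≤* (0≤* 0≤y 0≤H) (slack swap-bound)))
               (0≤* (0≤* (0≤* 0≤p 0≤r) 0≤Z) (slack MM-bound)))
          where
          identity : ∀ r T H y MM NN s K B X → let Z = y * H - r * T in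
            (r + 1ℚ) * r * r * T * X
              - (y * H * B - (r + 1ℚ) * (r + 1ℚ) * r * Z * (T * T) - (r + 1ℚ) * r * (T + K) * (Z * Z))
            ≡ (r + 1ℚ) * r * r * T * (X - (MM + 2ℚ * NN + s))
              + (r + 1ℚ) * r * (r * (T * s) + (T + K) * (Z * Z) - 2ℚ * (Z * NN))
              + y * H * ((r + 1ℚ) * r * (2ℚ * NN + MM) - B)
              + (r + 1ℚ) * r * Z * ((r + 1ℚ) * (T * T) - MM)
          identity = solve-∀ ℚ-ring

        result : (r + 1ℚ) * r * (r * (x * x) + y * y) * (n * n)
               ≤ (r + 1ℚ) * r * r * (2ℚ * S + n) + (n + y * c * n + (r + 1ℚ) * r * n * (y * y))
        result = *-cancel-≤ (0<* (0<* 0<x 0<T) (0<* 0<L 0<L))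
          (≤-by _ (identity r x y l n L T K S c)
            (0≤+ (0≤+ (0≤+ (0≤+ (0≤* 0≤x (slack collected)) (excess-bound T H 0≤T 0≤H))
                           (0≤* (0≤* (0≤* 0≤T (0≤* 0≤L 0≤L)) 0≤n) (slack slope-small)))
                      (0≤* (0≤* (0≤* (0≤* (0≤* 0≤x 0≤y) 0≤c) 0≤n) (0≤* 0≤L 0≤L)) (slack L≤T)))
                 (0≤* (0≤* (0≤* 0≤x 0≤p) 0≤r)
                   (0≤+ (0≤+ (0≤* (0≤* (0≤* 0≤n (0≤* 0≤y 0≤y)) (0≤* 0≤L 0≤L)) (slack L≤T))
                             (0≤* (0≤* (0≤* (0≤* 0≤y 0≤y) 0≤n) (0≤* 0≤L 0≤L)) (slack K≤L)))
                        (0≤* (0≤* (0≤* 0≤K 0≤r) 0≤T) (0≤+ (0≤* 0≤y 0≤H) 0≤Z))))))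
          where
          identity : ∀ r x y l n L T K S c →
            let H = n * L
                Z = y * H - r * T
                B = l * (H * H) + (r * r - 1ℚ) * (2ℚ * T * H - (r + 1ℚ) * (T * T)) - c * (L * L)
                G = 2ℚ * (r + 1ℚ) * r * r * (x * x * x) - y * (l + (r * r - 1ℚ) * (x * x))
                D = (r + 1ℚ) * r * r * T * (T * T - x * x * (H * H))
                  - 2ℚ * (r + 1ℚ) * r * T * (y * y * (H * H))
                  + y * H * (l * (H * H) + (r * r - 1ℚ) * (2ℚ * T * H - T * T))
                W = y * H * B - (r + 1ℚ) * (r + 1ℚ) * r * Z * (T * T) - (r + 1ℚ) * r * (T + K) * (Z * Z) in
            x * T * (L * L) * ((r + 1ℚ) * r * r * (2ℚ * S + n) + (n + y * c * n + (r + 1ℚ) * r * n * (y * y)))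
              - x * T * (L * L) * ((r + 1ℚ) * r * (r * (x * x) + y * y) * (n * n))
            ≡ x * ((r + 1ℚ) * r * r * T * (L * L * (2ℚ * S + n)) - W)
              + (x * D + T * G * (H * H))
              + T * (L * L) * n * (x - n * G)
              + x * y * c * n * (L * L) * (T - L)
              + x * (r + 1ℚ) * r *
                (n * (y * y) * (L * L) * (T - L) + y * y * n * (L * L) * (L - K * n) + K * r * T * (y * H + Z))
          identity = solve-∀ ℚ-ring

      module Dense (dense : y * H ≤ r * T) (0<y : 0ℚ < y) (1≤r : 1ℚ ≤ r) where

        private
          0<r : 0ℚ < r
          0<r = ℚ.<-≤-trans (ℚ.positive⁻¹ 1ℚ) 1≤r
          0≤r²-1 : 0ℚ ≤ r * r - 1ℚ
          0≤r²-1 = 0≤square-1 1≤r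

        result : (r + 1ℚ) * r * (r * (x * x) + y * y) * (n * n)
               ≤ (r + 1ℚ) * r * r * (2ℚ * S + n) + (n + r * c)
        result = *-cancel-≤ (0<* (0<* 0<x (0<* 0<r 0<r)) (0<* 0<y (0<* 0<L 0<L)))
          (≤-by-eq (- (x * y * r * (r * r - 1ℚ) * (2ℚ * r * (r * T - y * (n * L))))) capacity
            (identity r x y l n L T V MM NN s S c)
            (0≤+ (0≤+ (0≤+
              (0≤* (0≤* (0≤* 0≤x 0≤y) (0≤* 0≤r (0≤* 0≤r 0≤r)))
                (0≤+ (0≤+ (0≤* (0≤* 0≤p 0≤r) (slack sat-bound)) (0≤* (0≤* 0≤p 0≤r) 0≤s)) (slack swap-bound)))
              (0≤* (0≤* (0≤* (0≤* (0≤* 0≤x 0≤y) 0≤r) 0≤r²-1) (slack dense))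
                (0≤+ (0≤* (0≤* 0≤2 0≤r) 0≤V) (0≤* 0≤p (slack dense)))))
              (0≤* (0≤* 0≤H 0≤H) (excess-bound y r 0≤y 0≤r)))
              (0≤* (0≤* (0≤* (0≤* (0≤* 0≤r 0≤r) 0≤y) (0≤* 0≤L 0≤L)) 0≤n) (slack slope-small))))
          where
          identity : ∀ r x y l n L T V MM NN s S c →
            let H = n * L
                X = L * L * (2ℚ * S + n)
                B = l * (H * H) + (r * r - 1ℚ) * (2ℚ * T * H - (r + 1ℚ) * (T * T)) - c * (L * L)
                G = 2ℚ * (r + 1ℚ) * r * r * (x * x * x) - y * (l + (r * r - 1ℚ) * (x * x))
                D = (r + 1ℚ) * r * r * y * (y * y - x * x * (r * r))
                  - 2ℚ * (r + 1ℚ) * r * y * (y * y * (r * r))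
                  + y * r * (l * (r * r) + (r * r - 1ℚ) * (2ℚ * y * r - y * y)) in
            x * (r * r) * (y * (L * L)) * ((r + 1ℚ) * r * r * (2ℚ * S + n) + (n + r * c))
              - x * (r * r) * (y * (L * L)) * ((r + 1ℚ) * r * (r * (x * x) + y * y) * (n * n))
            ≡ (x * y * (r * (r * r)) * ((r + 1ℚ) * r * (X - (MM + 2ℚ * NN + s)) + (r + 1ℚ) * r * s
                  + ((r + 1ℚ) * r * (2ℚ * NN + MM) - B))
              + x * y * r * (r * r - 1ℚ) * (r * T - y * H) * (2ℚ * r * V + (r + 1ℚ) * (r * T - y * H))
              + H * H * (x * D + y * G * (r * r))
              + r * r * y * (L * L) * n * (x - n * G))
              + - (x * y * r * (r * r - 1ℚ) * (2ℚ * r * (r * T - y * H))) * ((r + 1ℚ) * T + V - H)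
          identity = solve-∀ ℚ-ring

      conclusion : y ≤ 1ℚ → 0ℚ < y → 1ℚ ≤ r → 1ℚ ≤ n →
        (r + 1ℚ) * r * (r * (x * x) + y * y) * (n * n)
          ≤ (r + 1ℚ) * r * r * (2ℚ * S + n) + (1ℚ + r * c + (r + 1ℚ) * r) * n
      conclusion y≤1 0<y 1≤r 1≤n with ℚ.≤-total (r * T) (y * H)
      ... | inj₁ sparse = ℚ.≤-trans (Sparse.result sparse) (≤-by _ (identity r y n c S)
        (0≤+ (0≤* (0≤* 0≤c 0≤n) (0≤+ (slack y≤1) (slack 1≤r)))
             (0≤* (0≤* (0≤* 0≤p 0≤r) 0≤n) (0≤* (0≤+ 0≤1 0≤y) (slack y≤1)))))
        where
        identity : ∀ r y n c S →
          (r + 1ℚ) * r * r * (2ℚ * S + n) + (1ℚ + r * c + (r + 1ℚ) * r) * n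
            - ((r + 1ℚ) * r * r * (2ℚ * S + n) + (n + y * c * n + (r + 1ℚ) * r * n * (y * y)))
          ≡ c * n * (1ℚ - y + (r - 1ℚ)) + (r + 1ℚ) * r * n * ((1ℚ + y) * (1ℚ - y))
        identity = solve-∀ ℚ-ring
      ... | inj₂ dense = ℚ.≤-trans (Dense.result dense 0<y 1≤r) (≤-by _ (identity r n c S)
        (0≤+ (0≤* (0≤* 0≤r 0≤c) (slack 1≤n)) (0≤* (0≤* 0≤p 0≤r) 0≤n)))
        where
        identity : ∀ r n c S →
          (r + 1ℚ) * r * r * (2ℚ * S + n) + (1ℚ + r * c + (r + 1ℚ) * r) * n
            - ((r + 1ℚ) * r * r * (2ℚ * S + n) + (n + r * c))
          ≡ r * c * (n - 1ℚ) + (r + 1ℚ) * r * n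
        identity = solve-∀ ℚ-ring

-- Bounds for the minimum

module Density (r n m : ℕ) (1≤r : 1 ℕ.≤ r) (t<m : t r n ℕ.< m) (m≤t : m ℕ.≤ t (suc r) n) where
  open Data.Rational.Base using (_+_; _*_; _-_; -_; _≤_; _<_)

  R N M l tᵣ tₚ : ℚ
  R  = cast r
  N  = cast n
  M  = cast m
  tᵣ = cast (t r n)
  tₚ = cast (t (suc r) n)
  l  = (M - tᵣ) ÷ (tₚ - tᵣ)

  density≡l : density (suc r) n m ≡ l
  density≡l = cong₂ _÷_ (cong₂ _-_ (cast-ℕ→ℚ m) (cast-ℕ→ℚ (t r n)))
    (cong₂ _-_ (cast-ℕ→ℚ (t (suc r) n)) (cast-ℕ→ℚ (t r n)))

  positive-difference : ∀ {a b} → a < b → 0ℚ < b - a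
  positive-difference {a} {b} a<b = subst (_< b - a) (ℚ.+-inverseʳ a) (ℚ.+-monoˡ-< (- a) a<b)

  0<gap : 0ℚ < tₚ - tᵣ
  0<gap = positive-difference (cast-< (ℕ.<-≤-trans t<m m≤t))

  l-gap : l * (tₚ - tᵣ) ≡ M - tᵣ
  l-gap = trans (ℚ.*-assoc (M - tᵣ) _ _) (trans (cong ((M - tᵣ) *_)
    (trans (ℚ.*-comm _ (tₚ - tᵣ)) (recip-inverse 0<gap))) (ℚ.*-identityʳ _))

  0<l : 0ℚ < l
  0<l = 0<* (positive-difference (cast-< t<m)) (recip-pos 0<gap)

  0≤l : 0ℚ ≤ l
  0≤l = ℚ.<⇒≤ 0<l

  l≤1 : l ≤ 1ℚ
  l≤1 = *-cancel-≤ 0<gap (subst₂ _≤_ (trans (sym l-gap) (ℚ.*-comm l _)) (sym (ℚ.*-identityʳ _))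
    (ℚ.+-monoˡ-≤ (- tᵣ) (cast-≤ m≤t)))

  0≤R : 0ℚ ≤ R
  0≤R = cast-0≤ r

  1≤R : 1ℚ ≤ R
  1≤R = cast-1≤ 1≤r

  0<R : 0ℚ < R
  0<R = ℚ.<-≤-trans (ℚ.positive⁻¹ 1ℚ) 1≤R

  0≤N : 0ℚ ≤ N
  0≤N = cast-0≤ n

  0≤P : 0ℚ ≤ R + 1ℚ
  0≤P = 0≤+ 0≤R 0≤1

  0<P : 0ℚ < R + 1ℚ
  0<P = ℚ.<-≤-trans 0<R (≤-+ 0≤1)

  0≤R²-1 : 0ℚ ≤ R * R - 1ℚ
  0≤R²-1 = 0≤square-1 1≤R

  turán-upper : ∀ k b → 1 ℕ.≤ k →
    cast k * (2ℚ * cast (t k b)) + cast b * cast b ≤ cast k * (cast b * cast b)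
  turán-upper k b 1≤k = ⟨ refl {x = cast k} ⊠ (cast-2 ⊠ refl {x = cast (t k b)}) ⊞ refl {x = cast b} ⊠ refl {x = cast b}
                        , refl {x = cast k} ⊠ (refl {x = cast b} ⊠ refl {x = cast b}) ⟩≤
                          (proj₁ (turán-number-bounds k b 1≤k))

  turán-lower : ∀ k b → 1 ℕ.≤ k →
    cast k * (cast b * cast b) ≤ cast k * (2ℚ * cast (t k b)) + cast b * cast b + cast k * cast k
  turán-lower k b 1≤k = ⟨ refl {x = cast k} ⊠ (refl {x = cast b} ⊠ refl {x = cast b})
                        , refl {x = cast k} ⊠ (cast-2 ⊠ refl {x = cast (t k b)})
                            ⊞ refl {x = cast b} ⊠ refl {x = cast b} ⊞ refl {x = cast k} ⊠ refl {x = cast k} ⟩≤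
                          (proj₂ (turán-number-bounds k b 1≤k))

  turánₚ-upper : (R + 1ℚ) * (2ℚ * tₚ) + N * N ≤ (R + 1ℚ) * (N * N)
  turánₚ-upper = subst (λ p → p * (2ℚ * tₚ) + N * N ≤ p * (N * N)) (cast-suc r)
    (turán-upper (suc r) n (s≤s z≤n))

  turánₚ-lower : (R + 1ℚ) * (N * N) ≤ (R + 1ℚ) * (2ℚ * tₚ) + N * N + (R + 1ℚ) * (R + 1ℚ)
  turánₚ-lower = subst (λ p → p * (N * N) ≤ p * (2ℚ * tₚ) + N * N + p * p) (cast-suc r)
    (turán-lower (suc r) n (s≤s z≤n))

  m-lower : (R * R - 1ℚ + l) * (N * N) - R * ((R + 1ℚ) * (R + 1ℚ)) ≤ 2ℚ * (R + 1ℚ) * R * M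
  m-lower = ≤-by-eq (- (2ℚ * (R + 1ℚ) * R)) l-gap (identity R N M l tᵣ tₚ)
    (0≤+ (0≤+ (0≤* (0≤* (slack l≤1) 0≤P) (slack (turán-lower r n 1≤r)))
              (0≤* (0≤* 0≤l 0≤R) (slack turánₚ-lower)))
         (0≤* (0≤* (slack l≤1) 0≤R) 0≤P))
    where
    identity : ∀ r n m l tᵣ tₚ →
      2ℚ * (r + 1ℚ) * r * m - ((r * r - 1ℚ + l) * (n * n) - r * ((r + 1ℚ) * (r + 1ℚ)))
      ≡ ((1ℚ - l) * (r + 1ℚ) * (r * (2ℚ * tᵣ) + n * n + r * r - r * (n * n))
        + l * r * ((r + 1ℚ) * (2ℚ * tₚ) + n * n + (r + 1ℚ) * (r + 1ℚ) - (r + 1ℚ) * (n * n))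
        + (1ℚ - l) * r * (r + 1ℚ))
        + - (2ℚ * (r + 1ℚ) * r) * (l * (tₚ - tᵣ) - (m - tᵣ))
    identity = solve-∀ ℚ-ring

  m-upper : 2ℚ * (R + 1ℚ) * R * M ≤ (R * R - 1ℚ + l) * (N * N)
  m-upper = ≤-by-eq (2ℚ * (R + 1ℚ) * R) l-gap (identity R N M l tᵣ tₚ)
    (0≤+ (0≤* (0≤* (slack l≤1) 0≤P) (slack (turán-upper r n 1≤r)))
         (0≤* (0≤* 0≤l 0≤R) (slack turánₚ-upper)))
    where
    identity : ∀ r n m l tᵣ tₚ →
      (r * r - 1ℚ + l) * (n * n) - 2ℚ * (r + 1ℚ) * r * m
      ≡ ((1ℚ - l) * (r + 1ℚ) * (r * (n * n) - (r * (2ℚ * tᵣ) + n * n))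
        + l * r * ((r + 1ℚ) * (n * n) - ((r + 1ℚ) * (2ℚ * tₚ) + n * n)))
        + 2ℚ * (r + 1ℚ) * r * (l * (tₚ - tᵣ) - (m - tᵣ))
    identity = solve-∀ ℚ-ring

  module Bounds (1≤n : 1 ℕ.≤ n) (x y : ℚ) (0<x : 0ℚ < x) (px≤1 : (R + 1ℚ) * x ≤ 1ℚ)
    (xy : 2ℚ * (R + 1ℚ) * R * x * y ≡ l + (R * R - 1ℚ) * (2ℚ * x - x * x))
    (0≤slope : 0ℚ ≤ Optimum.slope R x y l) where

    open Optimum R x y l

    0≤x : 0ℚ ≤ x
    0≤x = ℚ.<⇒≤ 0<x

    1≤N : 1ℚ ≤ N
    1≤N = cast-1≤ 1≤n

    x≤1 : x ≤ 1ℚ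
    x≤1 = ℚ.≤-trans (≤-by (R * x) (identity R x) (0≤* 0≤R 0≤x)) px≤1
      where
      identity : ∀ r x → (r + 1ℚ) * x - x ≡ r * x
      identity = solve-∀ ℚ-ring

    0<2prx : 0ℚ < 2ℚ * (R + 1ℚ) * R * x
    0<2prx = 0<* (0<* (0<* 0<2 0<P) 0<R) 0<x

    -- x is at least the smaller solution of (1 - p x)² = 1 - l, which means
    -- that a part of size x n leaves room for the parts of total size y n.

    room : l ≤ 1ℚ - (1ℚ - (R + 1ℚ) * x) * (1ℚ - (R + 1ℚ) * x)
    room = ℚ.≮⇒≥ λ l₀<l → let 0<e = positive-difference l₀<l ; 0≤e = ℚ.<⇒≤ 0<e in
      ℚ.<-irrefl refl (ℚ.<-≤-trans (0<* 0<e 0<e)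
        (≤-by-eq (l + (R * R - 1ℚ) * (x * x)) xy (identity R x y l)
          (0≤+ (0≤+ (0≤* (ℚ.<⇒≤ 0<2prx) 0≤slope)
                    (0≤* (0≤* (0≤* (0≤* (0≤* (0≤* 0≤2 0≤2) (0≤* 0≤P 0≤P)) 0≤R) (0≤* 0≤x 0≤x)) (slack px≤1))
                         (0≤+ 0≤1 (0≤* (slack 1≤R) 0≤x))))
               (0≤* (0≤* (0≤* (0≤* 0≤2 (0≤* 0≤P 0≤P)) 0≤x) (slack x≤1)) 0≤e))))
      where
      identity : ∀ r x y l →
        let u = 1ℚ - (r + 1ℚ) * x
            e = l - (1ℚ - u * u)
            G = 2ℚ * (r + 1ℚ) * r * r * (x * x * x) - y * (l + (r * r - 1ℚ) * (x * x)) in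
        0ℚ - e * e
        ≡ (2ℚ * (r + 1ℚ) * r * x * G
          + 2ℚ * 2ℚ * ((r + 1ℚ) * (r + 1ℚ)) * r * (x * x) * u * (1ℚ + (r - 1ℚ) * x)
          + 2ℚ * ((r + 1ℚ) * (r + 1ℚ)) * x * (1ℚ - x) * e)
          + (l + (r * r - 1ℚ) * (x * x)) * (2ℚ * (r + 1ℚ) * r * x * y - (l + (r * r - 1ℚ) * (2ℚ * x - x * x)))
      identity = solve-∀ ℚ-ring

    y≤1 : y ≤ 1ℚ
    y≤1 = *-cancel-≤ 0<2prx (≤-by-eq (- 1ℚ) xy (identity R x y l)
      (0≤+ (slack room) (0≤* (ℚ.<⇒≤ 0<2prx) 0≤x)))
      where
      identity : ∀ r x y l →
        2ℚ * (r + 1ℚ) * r * x * 1ℚ - 2ℚ * (r + 1ℚ) * r * x * y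
        ≡ ((1ℚ - (1ℚ - (r + 1ℚ) * x) * (1ℚ - (r + 1ℚ) * x) - l) + 2ℚ * (r + 1ℚ) * r * x * x)
          + - 1ℚ * (2ℚ * (r + 1ℚ) * r * x * y - (l + (r * r - 1ℚ) * (2ℚ * x - x * x)))
      identity = solve-∀ ℚ-ring

    0<y : 0ℚ < y
    0<y = ℚ.≰⇒> λ y≤0 → ℚ.<-irrefl refl (ℚ.<-≤-trans 0<l (≤-by-eq 1ℚ xy (identity R x y l)
      (0≤+ (0≤* (ℚ.<⇒≤ 0<2prx) (slack y≤0)) (0≤* 0≤R²-1 (0≤* 0≤x (0≤+ 0≤1 (slack x≤1)))))))
      where
      identity : ∀ r x y l →
        0ℚ - l ≡ (2ℚ * (r + 1ℚ) * r * x * (0ℚ - y) + (r * r - 1ℚ) * (x * (1ℚ + (1ℚ - x))))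
          + 1ℚ * (2ℚ * (r + 1ℚ) * r * x * y - (l + (r * r - 1ℚ) * (2ℚ * x - x * x)))
      identity = solve-∀ ℚ-ring

    0≤y : 0ℚ ≤ y
    0≤y = ℚ.<⇒≤ 0<y

    value : ℚ
    value = R * (x * x) + y * y

    error : ℚ
    error = 1ℚ + R * (R * ((R + 1ℚ) * (R + 1ℚ))) + (R + 1ℚ) * R

    module _ (G : Graph n) (no-clique : ¬ HasClique (suc (suc r)) G) (edges≡m : edges G ≡ m)
      (slope-small : N * slope ≤ x) where

      private
        S K L : ℕ
        S = satCount (suc (suc r)) G
        K = n ℕ.^ suc r
        L = K ℕ.* n

        1≤L : 1 ℕ.≤ L
        1≤L = ℕ.*-mono-≤ (ℕ.m^n>0 n {{ℕ.>-nonZero 1≤n}} (suc r)) 1≤n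

      scaled-lower : (R + 1ℚ) * R * value * (N * N)
        ≤ (R + 1ℚ) * R * R * (2ℚ * cast S + N) + error * N
      scaled-lower = packing-inequalities G r no-clique (_ ℚ.≤? _) 1≤r
        (turán-theorem G r 1≤r (subst (t r n ℕ.<_) (sym edges≡m) t<m)) L
        λ T V MM NN e s capacity L≤T edge-bound turán-part MM-bound sat-bound swap-bound →
        let T² = cast-* T T
            TV = cast-* T V
            P  = cast-suc r
            S₁ = P ⊠ T² ⊞ cast-2 ⊠ TV
            S₂ = refl {x = cast MM} ⊞ cast-2 ⊠ refl {x = cast NN}
            LL = cast-* L L in
        Lower.conclusion 0≤R 0<x 0≤y 0≤l 0≤slope xy
          N M (cast S) (cast K) (cast L) (cast T) (cast V) (cast MM) (cast NN) (cast e) (cast s)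
          (R * ((R + 1ℚ) * (R + 1ℚ)))
          0≤N (cast-0≤ K) (ℚ.<-≤-trans (ℚ.positive⁻¹ 1ℚ) (cast-1≤ 1≤L))
          (0≤* 0≤R (0≤* 0≤P 0≤P))
          (trans (sym (P ⊠ refl {x = cast T} ⊞ refl {x = cast V})) (trans (cong cast capacity) (cast-* n L)))
          (cast-0≤ V) (cast-≤ L≤T) (ℚ.≤-reflexive (sym (cast-* K n)))
          (cast-0≤ s)
          (⟨ LL ⊠ (cast-2 ⊠ cong cast edges≡m) ⊞ S₁
           , refl {x = R} ⊠ S₁ ⊞ S₂ ⊞ refl {x = cast e} ⟩≤ edge-bound)
          (⟨ refl {x = R} ⊠ refl {x = cast e} ⊞ cast-* V V , refl {x = R} ⊠ cast-* V V ⟩≤ turán-part)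
          (⟨ refl {x = cast MM} , P ⊠ T² ⟩≤ MM-bound)
          (⟨ S₂ ⊞ refl {x = cast s} , LL ⊠ (cast-2 ⊠ refl {x = cast S} ⊞ refl {x = N}) ⟩≤ sat-bound)
          m-lower
          (tangent T NN s swap-bound)
          slope-small y≤1 0<y 1≤R 1≤N
        where
        tangent : ∀ T NN s →
          (∀ a b → 2 ℕ.* (a ℕ.* (b ℕ.* NN)) ℕ.≤ b ℕ.* b ℕ.* (T ℕ.* s) ℕ.+ (r ℕ.* T ℕ.+ r ℕ.* K) ℕ.* (a ℕ.* a)) →
          ∀ Z → 0ℚ ≤ Z →
          2ℚ * (Z * cast NN) ≤ R * (cast T * cast s) + (cast T + cast K) * (Z * Z)
        tangent T NN s swap-bound Z 0≤Z with a , b , 0<b , Zb≡a ← nonneg-fraction Z 0≤Z =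
          *-cancel-≤ (0<* 0<R (0<* 0<B 0<B)) (≤-by _ (identity R (cast T) (cast NN) (cast s) (cast K) Z (cast b)) (slack
            (subst (λ A → 2ℚ * (A * (R * cast b * cast NN))
                ≤ R * cast b * (R * cast b) * (cast T * cast s) + (R * cast T + R * cast K) * (A * A)) (sym Zb≡a)
              (⟨ cast-2 ⊠ (refl {x = cast a} ⊠ (cast-* r b ⊠ refl {x = cast NN}))
               , cast-* r b ⊠ cast-* r b ⊠ cast-* T s ⊞ (cast-* r T ⊞ cast-* r K) ⊠ cast-* a a ⟩≤
               (swap-bound a (r ℕ.* b))))))
          where
          0<B : 0ℚ < cast b
          0<B = ℚ.<-≤-trans (ℚ.positive⁻¹ 1ℚ) (cast-1≤ 0<b)
          identity : ∀ r T NN s K Z b →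
            r * (b * b) * (r * (T * s) + (T + K) * (Z * Z)) - r * (b * b) * (2ℚ * (Z * NN))
            ≡ r * b * (r * b) * (T * s) + (r * T + r * K) * (Z * b * (Z * b)) - 2ℚ * (Z * b * (r * b * NN))
          identity = solve-∀ ℚ-ring

      lower : value * (N * N) ≤ 2ℚ * R * cast S + (R + error) * N
      lower = *-cancel-≤ (0<* 0<P 0<R) (≤-by _ (identity R value N (cast S) error)
        (0≤+ (slack scaled-lower) (0≤* (0≤* 0≤error 0≤N) 0≤pr-1)))
        where
        0≤error : 0ℚ ≤ error
        0≤error = 0≤+ (0≤+ 0≤1 (0≤* 0≤R (0≤* 0≤R (0≤* 0≤P 0≤P)))) (0≤* 0≤P 0≤R)
        0≤pr-1 : 0ℚ ≤ (R - 1ℚ) + R * R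
        0≤pr-1 = 0≤+ (slack 1≤R) (0≤* 0≤R 0≤R)
        identity : ∀ r v n s e →
          (r + 1ℚ) * r * (2ℚ * r * s + (r + e) * n) - (r + 1ℚ) * r * (v * (n * n))
          ≡ ((r + 1ℚ) * r * r * (2ℚ * s + n) + e * n - (r + 1ℚ) * r * v * (n * n)) + e * n * ((r - 1ℚ) + r * r)
        identity = solve-∀ ℚ-ring

    record Sizes : Set where
      field
        a b       : ℕ
        size      : n ≡ b ℕ.+ a
        feasible  : m ℕ.≤ t r b ℕ.+ b ℕ.* a
        a-lower   : x * N ≤ cast a
        a-upper   : cast a ≤ x * N + (R + 1ℚ)

    feasible-below : ∀ a b → n ≡ b ℕ.+ a → x * N + R ≤ cast a → suc r ℕ.* a ℕ.≤ n →
      m ℕ.≤ t r b ℕ.+ b ℕ.* a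
    feasible-below a b size large pa≤n = cast-cancel-≤ (subst (M ≤_) (sym (cast-+ (t r b) (b ℕ.* a) ))
      (subst (λ ba → M ≤ cast (t r b) + ba) (sym (cast-* b a))
        (*-cancel-≤ (0<* (0<* 0<2 0<P) 0<R)
          (≤-by-eq k N≡b+a (identity R x N l M (cast (t r b)) (cast a) (cast b))
            (0≤+ (0≤+ (0≤+ (0≤* 0≤P (slack (turán-lower r b 1≤r))) (slack m-upper))
                      (0≤* (0≤* 0≤N 0≤N) (slack room)))
                 (0≤+ (0≤+ (0≤* (0≤* (0≤* 0≤2 0≤P) (slack pa≤N)) 0≤δ)
                           (0≤* (0≤* 0≤P 0≤P) (0≤* (slack′ large) (0≤+ 0≤δ 0≤R))))
                      (0≤* (0≤* 0≤P (0≤* 0≤R 0≤R)) 0≤R)))))))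
      where
      k : ℚ
      k = - ((R * R - 1ℚ) * (N + cast b + cast a) + 2ℚ * (R + 1ℚ) * cast a)
      N≡b+a : N ≡ cast b + cast a
      N≡b+a = trans (cong cast size) (cast-+ b a)
      pa≤N : (R + 1ℚ) * cast a ≤ N
      pa≤N = ⟨ cast-suc r ⊠ refl {x = cast a} , refl ⟩≤ pa≤n
      slack′ : ∀ {u v w} → u + v ≤ w → 0ℚ ≤ w - u - v
      slack′ {u} {v} {w} le = subst (0ℚ ≤_) (regroup u v w) (slack le)
        where
        regroup : ∀ u v w → w - (u + v) ≡ w - u - v
        regroup = solve-∀ ℚ-ring
      0≤δ : 0ℚ ≤ cast a - x * N
      0≤δ = slack (ℚ.≤-trans (≤-+ 0≤R) large)
      identity : ∀ r x n l m t a b →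
        2ℚ * (r + 1ℚ) * r * (t + b * a) - 2ℚ * (r + 1ℚ) * r * m
        ≡ ((r + 1ℚ) * (r * (2ℚ * t) + b * b + r * r - r * (b * b))
          + ((r * r - 1ℚ + l) * (n * n) - 2ℚ * (r + 1ℚ) * r * m)
          + n * n * (1ℚ - (1ℚ - (r + 1ℚ) * x) * (1ℚ - (r + 1ℚ) * x) - l)
          + (2ℚ * (r + 1ℚ) * (n - (r + 1ℚ) * a) * (a - x * n)
            + (r + 1ℚ) * (r + 1ℚ) * ((a - x * n - r) * (a - x * n + r))
            + (r + 1ℚ) * (r * r) * r))
          + - ((r * r - 1ℚ) * (n + b + a) + 2ℚ * (r + 1ℚ) * a) * (n - (b + a))
      identity = solve-∀ ℚ-ring

    xN≤N : x * N ≤ N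
    xN≤N = ≤-by (N * (1ℚ - x)) (identity x N) (0≤* 0≤N (slack x≤1))
      where
      identity : ∀ x n → n - x * n ≡ n * (1ℚ - x)
      identity = solve-∀ ℚ-ring

    module Choice (k₀ : ℕ) (xN≤k₀ : x * N ≤ cast k₀) (least : ∀ k → x * N ≤ cast k → k₀ ℕ.≤ k) where

      a₀ : ℕ
      a₀ = k₀ ℕ.+ r
      below-least : ∀ k → (∀ k′ → x * N ≤ cast k′ → k ℕ.≤ k′) → cast k ≤ x * N + 1ℚ
      below-least zero    _     = subst (_≤ x * N + 1ℚ) (sym cast-0) (0≤+ (0≤* 0≤x 0≤N) 0≤1)
      below-least (suc k) least = subst (_≤ x * N + 1ℚ) (sym (cast-suc k)) (ℚ.+-monoˡ-≤ 1ℚ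
        (ℚ.<⇒≤ (ℚ.≰⇒> λ xN≤k → ℕ.<-irrefl refl (least k xN≤k))))
      a₀-lower : x * N + R ≤ cast a₀
      a₀-lower = subst (x * N + R ≤_) (sym (cast-+ k₀ r)) (ℚ.+-monoˡ-≤ R xN≤k₀)
      a₀-upper : cast a₀ ≤ x * N + (R + 1ℚ)
      a₀-upper = subst₂ _≤_ (sym (cast-+ k₀ r)) (regroup (x * N) R) (ℚ.+-monoˡ-≤ R (below-least k₀ least))
        where
        regroup : ∀ u r → u + 1ℚ + r ≡ u + (r + 1ℚ)
        regroup = solve-∀ ℚ-ring
      xN≤a₀ : x * N ≤ cast a₀
      xN≤a₀ = ℚ.≤-trans (≤-+ 0≤R) a₀-lower

      largest-part : n ℕ.< suc r ℕ.* a₀ → ∀ a b → n ≡ b ℕ.+ a → t (suc r) n ≡ t r b ℕ.+ b ℕ.* a →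
        n ℕ.≤ suc r ℕ.* a → suc r ℕ.* a ℕ.≤ n ℕ.+ r → Sizes
      largest-part n<pa₀ a b size exact n≤pa pa≤n+r = record
        { a = a ; b = b ; size = size
        ; feasible = ℕ.≤-trans m≤t (ℕ.≤-reflexive exact)
        ; a-lower = *-cancel-≤ 0<P (≤-by _ (lower-identity R x N (cast a))
            (0≤+ (slack (⟨ refl , cast-suc r ⊠ refl {x = cast a} ⟩≤ n≤pa)) (0≤* 0≤N (slack px≤1))))
        ; a-upper = ℚ.≤-trans (cast-≤ (ℕ.s≤s⁻¹ (ℕ.*-cancelˡ-< (suc r) a (suc a₀) (begin-strict
            suc r ℕ.* a              ≤⟨ pa≤n+r ⟩
            n ℕ.+ r                  <⟨ ℕ.+-monoˡ-< r n<pa₀ ⟩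
            suc r ℕ.* a₀ ℕ.+ r       ≤⟨ ℕ.+-monoʳ-≤ _ (ℕ.n≤1+n r) ⟩
            suc r ℕ.* a₀ ℕ.+ suc r   ≡⟨ trans (ℕ.+-comm _ (suc r)) (sym (ℕ.*-suc (suc r) a₀)) ⟩
            suc r ℕ.* suc a₀         ∎)))) a₀-upper
        }
        where
        open ℕ.≤-Reasoning
        lower-identity : ∀ r x n a → (r + 1ℚ) * a - (r + 1ℚ) * (x * n)
          ≡ ((r + 1ℚ) * a - n) + n * (1ℚ - (r + 1ℚ) * x)
        lower-identity = solve-∀ ℚ-ring

      fallback : n ℕ.< suc r ℕ.* a₀ → Sizes
      fallback n<pa₀ with turán-number (suc r) n (s≤s z≤n)
      ... | record { q = q ; s = zero ; division = division ; value = value } =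
        largest-part n<pa₀ q (q ℕ.* r) size (part-removal r q zero q 1≤r refl (inj₁ refl) size value)
          (ℕ.≤-reflexive (trans division (ℕ.*-comm q (suc r))))
          (ℕ.≤-trans (ℕ.≤-reflexive (sym (trans division (ℕ.*-comm q (suc r))))) (ℕ.m≤m+n n r))
        where
        size : n ≡ q ℕ.* r ℕ.+ q
        size = trans division (trans (ℕ.*-suc q r) (ℕ.+-comm q _))
      ... | record { q = q ; s = suc s ; division = division ; remainder = s<r ; value = value } =
        largest-part n<pa₀ (suc q) (s ℕ.+ q ℕ.* r) size
          (part-removal r q s (suc q) (ℕ.s≤s⁻¹ s<r) refl (inj₂ refl) size value)
          (ℕ.≤-trans (ℕ.≤-reflexive division) (ℕ.≤-trans (ℕ.+-monoˡ-≤ _ (ℕ.<⇒≤ s<r))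
            (ℕ.≤-reflexive (ℕ.*-comm (suc q) (suc r)))))
          (ℕ.≤-trans (ℕ.≤-reflexive (trans (ℕ.*-comm (suc r) (suc q)) (regroup r (q ℕ.* suc r))))
            (ℕ.+-monoˡ-≤ r (ℕ.≤-trans (s≤s (ℕ.m≤n+m _ s)) (ℕ.≤-reflexive (sym division)))))
        where
        size : n ≡ s ℕ.+ q ℕ.* r ℕ.+ suc q
        size = trans division (eq s q r)
          where
          eq : ∀ s q r → 1 ℕ.+ s ℕ.+ q ℕ.* (1 ℕ.+ r) ≡ s ℕ.+ q ℕ.* r ℕ.+ (1 ℕ.+ q)
          eq = ℕ-Ring.solve-∀
        regroup : ∀ r z → 1 ℕ.+ r ℕ.+ z ≡ 1 ℕ.+ z ℕ.+ r
        regroup = ℕ-Ring.solve-∀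

      choose : Sizes
      choose with a₀ ℕ.≤? n
      ... | no a₀≰n = fallback (ℕ.<-≤-trans (ℕ.≰⇒> a₀≰n) (ℕ.m≤m+n a₀ (r ℕ.* a₀)))
      ... | yes a₀≤n with m ℕ.≤? t r (n ∸ a₀) ℕ.+ (n ∸ a₀) ℕ.* a₀
      ...   | yes feasible = record
        { a = a₀ ; b = n ∸ a₀ ; size = sym (ℕ.m∸n+n≡m a₀≤n) ; feasible = feasible
        ; a-lower = xN≤a₀ ; a-upper = a₀-upper }
      ...   | no infeasible = fallback (ℕ.≰⇒> λ pa₀≤n → infeasible
        (feasible-below a₀ (n ∸ a₀) (sym (ℕ.m∸n+n≡m a₀≤n)) a₀-lower pa₀≤n))

    sizes : Sizes
    sizes = let k₀ , xN≤k₀ , least = minimum {λ k → x * N ≤ cast k} (λ k → x * N ℚ.≤? cast k) xN≤N in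
      Choice.choose k₀ xN≤k₀ least

    upper-error : ℚ
    upper-error = (R + 1ℚ) * (2ℚ * (R + 1ℚ) + (R + 1ℚ) * (R + 1ℚ))

    module Attained (chosen : Sizes) where

      open Sizes chosen

      A X Y : ℚ
      A = cast a
      X = cast (m ∸ t r b)
      Y = y * N + R
      0<A : 0ℚ < A
      0<A = ℚ.<-≤-trans (0<* 0<x (ℚ.<-≤-trans (ℚ.positive⁻¹ 1ℚ) 1≤N)) a-lower
      1≤a : 1 ℕ.≤ a
      1≤a = ℕ.≰⇒> λ a≤0 → ℚ.<-irrefl refl (ℚ.<-≤-trans 0<A
        (subst (A ≤_) cast-0 (cast-≤ a≤0)))
      instance
        a≢0 : ℕ.NonZero a
        a≢0 = ℕ.>-nonZero 1≤a
      b≤n : b ℕ.≤ n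
      b≤n = subst (b ℕ.≤_) (sym size) (ℕ.m≤m+n b a)
      tb≤m : t r b ℕ.≤ m
      tb≤m = ℕ.≤-trans (t-mono r b≤n 1≤r) (ℕ.<⇒≤ t<m)
      joined : t r b ℕ.+ (m ∸ t r b) ≡ m
      joined = ℕ.m+[n∸m]≡n tb≤m
      X≤ba : m ∸ t r b ℕ.≤ b ℕ.* a
      X≤ba = ℕ.m≤n+o⇒m∸n≤o m (t r b) feasible
      B : ℕ
      B = suc ((m ∸ t r b) ℕ./ a)
      module C = Construction r a b (m ∸ t r b)

      X≡ : X ≡ M - cast (t r b)
      X≡ = trans (sym (+-cancel (cast (t r b)) X)) (cong (_- cast (t r b))
        (trans (sym (cast-+ (t r b) _)) (cong cast joined)))
      b≡ : cast b ≡ N - A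
      b≡ = trans (sym (cancel (cast b) A)) (cong (_- A) (trans (sym (cast-+ b a)) (cong cast (sym size))))
        where
        cancel : ∀ u v → u + v - v ≡ u
        cancel = solve-∀ ℚ-ring

      X-bound : X ≤ A * Y
      X-bound = subst (_≤ A * Y) (sym X≡) (*-cancel-≤ 0<2prx (≤-by-eq (A * N) xy
        (identity R x y l N M (cast (t r b)) A)
        (0≤+ (0≤+ (0≤+ (0≤+ (0≤* 0≤x (slack m-upper)) (0≤* (0≤* 0≤x 0≤P) (slack turán-b)))
                       (0≤* (0≤* 0≤l 0≤N) (slack a-lower)))
                  (0≤* (0≤* (0≤* 0≤R²-1 (ℚ.<⇒≤ 0<A)) 0≤x) (slack a-lower)))
             (0≤* (0≤* (0≤* 0≤P (0≤* 0≤R 0≤R)) 0≤x) (0≤+ (ℚ.<⇒≤ 0<A) (slack (cast-1≤ 1≤a)))))))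
        where
        turán-b : R * ((N - A) * (N - A)) ≤ R * (2ℚ * cast (t r b)) + (N - A) * (N - A) + R * R
        turán-b = subst (λ β → R * (β * β) ≤ R * (2ℚ * cast (t r b)) + β * β + R * R) b≡
          (turán-lower r b 1≤r)
        identity : ∀ r x y l n m t a →
          2ℚ * (r + 1ℚ) * r * x * (a * (y * n + r)) - 2ℚ * (r + 1ℚ) * r * x * (m - t)
          ≡ (x * ((r * r - 1ℚ + l) * (n * n) - 2ℚ * (r + 1ℚ) * r * m)
            + x * (r + 1ℚ) * (r * (2ℚ * t) + (n - a) * (n - a) + r * r - r * ((n - a) * (n - a)))
            + l * n * (a - x * n)
            + (r * r - 1ℚ) * a * x * (a - x * n)
            + (r + 1ℚ) * (r * r) * x * (a + (a - 1ℚ)))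
            + a * n * (2ℚ * (r + 1ℚ) * r * x * y - (l + (r * r - 1ℚ) * (2ℚ * x - x * x)))
        identity = solve-∀ ℚ-ring

      B-upper : cast B ≤ Y + 1ℚ
      B-upper = subst (_≤ Y + 1ℚ) (sym (cast-suc _)) (ℚ.+-monoˡ-≤ 1ℚ (*-cancel-≤ 0<A (ℚ.≤-trans
        (⟨ cast-* a _ , refl ⟩≤ (ℕ.≤-trans (ℕ.≤-reflexive (ℕ.*-comm a _)) (ℕ.m/n*n≤m (m ∸ t r b) a))) X-bound)))

      B≤n : B ℕ.≤ b ℕ.+ a
      B≤n = ℕ.≤-trans (ℕ.≤-reflexive (ℕ.+-comm 1 _)) (ℕ.+-mono-≤
        (ℕ.≤-trans (ℕ./-monoˡ-≤ a X≤ba) (ℕ.≤-reflexive (ℕ.m*n/n≡m b a))) 1≤a)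

      sat-bound : 2ℚ * R * cast (satCount (suc (suc r)) C.G) ≤ R * (A * A) + cast B * cast B
      sat-bound = ⟨ cast-2 ⊠ refl {x = R} ⊠ refl , refl {x = R} ⊠ cast-* a a ⊞ cast-* B B ⟩≤
        (C.satCount-bound 1≤r B B≤n λ v va<X → s≤s (ℕ.≤-trans
          (ℕ.≤-reflexive (sym (ℕ.m*n/n≡m v a))) (ℕ./-monoˡ-≤ a (ℕ.<⇒≤ va<X))))

      value-bound : 2ℚ * R * cast (satCount (suc (suc r)) C.G) ≤ value * (N * N) + upper-error * N
      value-bound = ℚ.≤-trans sat-bound (≤-by _ (identity R x y N A (cast B))
        (0≤+ (0≤+ (0≤* (0≤* 0≤R (slack a-upper)) (0≤+ 0≤x′ (ℚ.<⇒≤ 0<A)))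
                  (0≤* (slack B-upper) (0≤+ 0≤Y (cast-0≤ B))))
             (0≤+ (0≤* (0≤* (0≤* 0≤2 0≤P) 0≤N) (0≤+ (0≤* 0≤R (slack x≤1)) (slack y≤1)))
                  (0≤* (0≤* 0≤P (0≤* 0≤P 0≤P)) (slack 1≤N)))))
        where
        0≤x′ : 0ℚ ≤ x * N + (R + 1ℚ)
        0≤x′ = 0≤+ (0≤* 0≤x 0≤N) 0≤P
        0≤Y : 0ℚ ≤ Y + 1ℚ
        0≤Y = 0≤+ (0≤+ (0≤* 0≤y 0≤N) 0≤R) 0≤1
        identity : ∀ r x y n a b →
          (r * (x * x) + y * y) * (n * n) + (r + 1ℚ) * (2ℚ * (r + 1ℚ) + (r + 1ℚ) * (r + 1ℚ)) * n
            - (r * (a * a) + b * b)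
          ≡ r * (x * n + (r + 1ℚ) - a) * (x * n + (r + 1ℚ) + a)
            + (y * n + r + 1ℚ - b) * (y * n + r + 1ℚ + b)
            + (2ℚ * (r + 1ℚ) * n * (r * (1ℚ - x) + (1ℚ - y))
              + (r + 1ℚ) * ((r + 1ℚ) * (r + 1ℚ)) * (n - 1ℚ))
        identity = solve-∀ ℚ-ring

      transport : ∀ {k} → k ≡ b ℕ.+ a → Σ[ G ∈ Graph k ] (¬ HasClique (suc (suc r)) G × edges G ≡ m ×
        2ℚ * R * cast (satCount (suc (suc r)) G) ≤ value * (N * N) + upper-error * N)
      transport refl = C.G , C.clique-free 1≤r , trans (C.edge-count X≤ba) joined , value-bound

    upper : Σ[ G ∈ Graph n ] (¬ HasClique (suc (suc r)) G × edges G ≡ m ×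
      2ℚ * R * cast (satCount (suc (suc r)) G) ≤ value * (N * N) + upper-error * N)
    upper = Attained.transport sizes (Sizes.size sizes)

-- The quartic

module Quartic (R l : ℚ) (1≤R : 1ℚ ℚ.≤ R) (0<l : 0ℚ ℚ.< l) (l≤1 : l ℚ.≤ 1ℚ) where
  open Data.Rational.Base using (_+_; _*_; _-_; -_; _≤_; _<_)

  α β η : ℚ
  α = (R + 1ℚ) * (R + 1ℚ) * (2ℚ * 2ℚ * (R * (R * R)) + (R - 1ℚ) * (R - 1ℚ))
  β = 2ℚ * ((R + 1ℚ) * (R + 1ℚ)) * ((R - 1ℚ) * (R - 1ℚ))
  η = 2ℚ * (R + 1ℚ) * (R - 1ℚ)

  Q : ℚ → ℚ
  Q x = α * (x * x * (x * x)) - β * (x * (x * x)) - η * l * x - l * l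

  0<R : 0ℚ < R
  0<R = ℚ.<-≤-trans (ℚ.positive⁻¹ 1ℚ) 1≤R

  0≤R : 0ℚ ≤ R
  0≤R = ℚ.<⇒≤ 0<R

  0<P : 0ℚ < R + 1ℚ
  0<P = ℚ.+-mono-<-≤ 0<R 0≤1

  0≤P : 0ℚ ≤ R + 1ℚ
  0≤P = ℚ.<⇒≤ 0<P

  0≤l : 0ℚ ≤ l
  0≤l = ℚ.<⇒≤ 0<l

  0<α : 0ℚ < α
  0<α = 0<* (0<* 0<P 0<P) (ℚ.+-mono-<-≤
    (0<* (0<* 0<2 0<2) (0<* 0<R (0<* 0<R 0<R)))
    (0≤square (R - 1ℚ)))

  0≤α : 0ℚ ≤ α
  0≤α = ℚ.<⇒≤ 0<α

  0≤β : 0ℚ ≤ β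
  0≤β = 0≤* (0≤* 0≤2 (0≤* 0≤P 0≤P)) (0≤square (R - 1ℚ))

  0≤η : 0ℚ ≤ η
  0≤η = 0≤* (0≤* 0≤2 0≤P) (slack 1≤R)

  Q-at-1/p : ∀ x → (R + 1ℚ) * x ≡ 1ℚ → 0ℚ ≤ Q x
  Q-at-1/p x px≡1 = ≤-by-eq k px≡1 (identity R l x)
    (0≤* (slack l≤1) (0≤+ (0≤+ (0≤* 0≤2 (slack 1≤R)) 0≤1) 0≤l))
    where
    k : ℚ
    k = (2ℚ * 2ℚ * (R * (R * R)) + (R - 1ℚ) * (R - 1ℚ)) * (x * x) * ((R + 1ℚ) * x + 1ℚ)
      - 2ℚ * ((R - 1ℚ) * (R - 1ℚ)) * x * ((R + 1ℚ) * x + 1ℚ) - 2ℚ * (R - 1ℚ) * l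
      + (2ℚ * 2ℚ * (R * R) - (1ℚ + 1ℚ + 1ℚ) * R + 1ℚ) * x + (2ℚ * R - 1ℚ)
    identity : ∀ r l x →
      (r + 1ℚ) * (r + 1ℚ) * (2ℚ * 2ℚ * (r * (r * r)) + (r - 1ℚ) * (r - 1ℚ)) * (x * x * (x * x))
        - 2ℚ * ((r + 1ℚ) * (r + 1ℚ)) * ((r - 1ℚ) * (r - 1ℚ)) * (x * (x * x))
        - 2ℚ * (r + 1ℚ) * (r - 1ℚ) * l * x - l * l - 0ℚ
      ≡ (1ℚ - l) * (2ℚ * (r - 1ℚ) + 1ℚ + l)
        + ((2ℚ * 2ℚ * (r * (r * r)) + (r - 1ℚ) * (r - 1ℚ)) * (x * x) * ((r + 1ℚ) * x + 1ℚ)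
            - 2ℚ * ((r - 1ℚ) * (r - 1ℚ)) * x * ((r + 1ℚ) * x + 1ℚ) - 2ℚ * (r - 1ℚ) * l
            + (2ℚ * 2ℚ * (r * r) - (1ℚ + 1ℚ + 1ℚ) * r + 1ℚ) * x + (2ℚ * r - 1ℚ))
          * ((r + 1ℚ) * x - 1ℚ)
    identity = solve-∀ ℚ-ring

  -- Q x / x³ increases with slope at least α.

  Q-increase : ∀ u v → 0ℚ ≤ u → u ≤ v →
    Q u * (v * (v * v)) + α * (u * (u * u)) * (v * (v * v)) * (v - u) ≤ Q v * (u * (u * u))
  Q-increase u v 0≤u u≤v = ≤-by _ (identity α β η l u v)
    (0≤+ (0≤* (0≤* (0≤* 0≤η 0≤l) (0≤* 0≤u 0≤v)) (0≤* (slack u≤v) (0≤+ 0≤u 0≤v)))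
         (0≤* (0≤* 0≤l 0≤l) (0≤* (slack u≤v) (0≤+ (0≤+ (0≤* 0≤u 0≤u) (0≤* 0≤u 0≤v)) (0≤* 0≤v 0≤v)))))
    where
    0≤v : 0ℚ ≤ v
    0≤v = ℚ.≤-trans 0≤u u≤v
    identity : ∀ a b e l u v →
      (a * (v * v * (v * v)) - b * (v * (v * v)) - e * l * v - l * l) * (u * (u * u))
        - ((a * (u * u * (u * u)) - b * (u * (u * u)) - e * l * u - l * l) * (v * (v * v))
          + a * (u * (u * u)) * (v * (v * v)) * (v - u))
      ≡ e * l * (u * v) * ((v - u) * (u + v)) + l * l * ((v - u) * (u * u + u * v + v * v))
    identity = solve-∀ ℚ-ring

  Q-nonneg-above : ∀ {u v} → 0ℚ < u → u ≤ v → 0ℚ ≤ Q u → 0ℚ ≤ Q v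
  Q-nonneg-above {u} {v} 0<u u≤v 0≤Qu = *-cancel-≤ (0<* 0<u (0<* 0<u 0<u)) (ℚ.≤-trans
    (ℚ.≤-trans (ℚ.≤-reflexive (ℚ.*-zeroʳ (u * (u * u)))) (0≤+ (0≤* 0≤Qu (cube 0≤v))
      (0≤* (0≤* (0≤* 0≤α (cube 0≤u)) (cube 0≤v)) (slack u≤v))))
    (ℚ.≤-trans (Q-increase u v 0≤u u≤v) (ℚ.≤-reflexive (ℚ.*-comm (Q v) _))))
    where
    0≤u : 0ℚ ≤ u
    0≤u = ℚ.<⇒≤ 0<u
    0≤v : 0ℚ ≤ v
    0≤v = ℚ.≤-trans 0≤u u≤v
    cube : ∀ {w} → 0ℚ ≤ w → 0ℚ ≤ w * (w * w)
    cube 0≤w = 0≤* 0≤w (0≤* 0≤w 0≤w)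

  close-roots : ∀ u v δ τ → 0ℚ < δ → δ ≤ u → u ≤ v → - τ ≤ Q u → Q v ≤ τ → 0ℚ ≤ τ →
    α * (δ * (δ * δ)) * (v - u) ≤ τ + τ
  close-roots u v δ τ 0<δ δ≤u u≤v Qu Qv 0≤τ = *-cancel-≤ (0<* 0<v (0<* 0<v 0<v)) (≤-by _
    (identity α u v δ τ (Q u) (Q v))
    (0≤+ (0≤+ (0≤+ (slack (Q-increase u v 0≤u u≤v)) (0≤* (slack Qv) (cube 0≤u)))
              (0≤* (slack Qu) (cube 0≤v)))
         (0≤+ (0≤* 0≤τ (difference 0≤u u≤v))
              (0≤* (0≤* (0≤* 0≤α (cube 0≤v)) (slack u≤v)) (difference (ℚ.<⇒≤ 0<δ) δ≤u)))))
    where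
    0≤u : 0ℚ ≤ u
    0≤u = ℚ.<⇒≤ (ℚ.<-≤-trans 0<δ δ≤u)
    0<v : 0ℚ < v
    0<v = ℚ.<-≤-trans (ℚ.<-≤-trans 0<δ δ≤u) u≤v
    0≤v : 0ℚ ≤ v
    0≤v = ℚ.<⇒≤ 0<v
    cube : ∀ {w} → 0ℚ ≤ w → 0ℚ ≤ w * (w * w)
    cube 0≤w = 0≤* 0≤w (0≤* 0≤w 0≤w)
    difference : ∀ {a b} → 0ℚ ≤ a → a ≤ b → 0ℚ ≤ (b - a) * (a * a + a * b + b * b)
    difference 0≤a a≤b = let 0≤b = ℚ.≤-trans 0≤a a≤b in
      0≤* (slack a≤b) (0≤+ (0≤+ (0≤* 0≤a 0≤a) (0≤* 0≤a 0≤b)) (0≤* 0≤b 0≤b))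
    identity : ∀ a u v d t U V →
      v * (v * v) * (t + t) - v * (v * v) * (a * (d * (d * d)) * (v - u))
      ≡ (V * (u * (u * u)) - (U * (v * (v * v)) + a * (u * (u * u)) * (v * (v * v)) * (v - u)))
        + (t - V) * (u * (u * u)) + (U - - t) * (v * (v * v))
        + (t * ((v - u) * (u * u + u * v + v * v))
          + a * (v * (v * v)) * (v - u) * ((u - d) * (d * d + d * u + u * u)))
    identity = solve-∀ ℚ-ring

  Q-step : ∀ w x → 0ℚ ≤ w → w ≤ x → x ≤ 1ℚ → Q x ≤ Q w + 2ℚ * 2ℚ * α * (x - w)
  Q-step w x 0≤w w≤x x≤1 = ≤-by _ (identity α β η l w x)
    (0≤+ (0≤+ (0≤* (0≤* 0≤α (slack w≤x))
                (0≤+ (0≤* 0≤2 (0≤+ (slack x≤1) (slack w≤1)))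
                     (0≤* (0≤+ 0≤x 0≤w) (0≤+ (0≤* (slack x≤1) (0≤+ 0≤1 0≤x)) (0≤* (slack w≤1) (0≤+ 0≤1 0≤w))))))
              (0≤* (0≤* 0≤β (slack w≤x)) (0≤+ (0≤+ (0≤* 0≤w 0≤w) (0≤* 0≤w 0≤x)) (0≤* 0≤x 0≤x))))
         (0≤* (0≤* 0≤η 0≤l) (slack w≤x)))
    where
    0≤x : 0ℚ ≤ x
    0≤x = ℚ.≤-trans 0≤w w≤x
    w≤1 : w ≤ 1ℚ
    w≤1 = ℚ.≤-trans w≤x x≤1
    identity : ∀ a b e l w x →
      (a * (w * w * (w * w)) - b * (w * (w * w)) - e * l * w - l * l) + 2ℚ * 2ℚ * a * (x - w)
        - (a * (x * x * (x * x)) - b * (x * (x * x)) - e * l * x - l * l)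
      ≡ a * (x - w) * (2ℚ * ((1ℚ - x) + (1ℚ - w)) + (x + w) * ((1ℚ - x) * (1ℚ + x) + (1ℚ - w) * (1ℚ + w)))
        + b * (x - w) * (w * w + w * x + x * x) + e * l * (x - w)
    identity = solve-∀ ℚ-ring

  δ : ℚ
  δ = l * l * recip α

  0<δ : 0ℚ < δ
  0<δ = 0<* (0<* 0<l 0<l) (recip-pos 0<α)

  away-from-zero : ∀ x → 0ℚ ≤ x → x ≤ 1ℚ → 0ℚ ≤ Q x → δ ≤ x
  away-from-zero x 0≤x x≤1 0≤Qx = *-cancel-≤ 0<α (ℚ.≤-trans (ℚ.≤-reflexive αδ) (≤-by _
    (identity α β η l x)
    (0≤+ (0≤+ (0≤+ 0≤Qx (0≤* 0≤β (0≤* 0≤x (0≤* 0≤x 0≤x)))) (0≤* (0≤* 0≤η 0≤l) 0≤x))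
         (0≤* (0≤* 0≤α 0≤x) (0≤* (slack x≤1) (0≤+ (0≤+ 0≤1 0≤x) (0≤* 0≤x 0≤x)))))))
    where
    αδ : α * δ ≡ l * l
    αδ = trans (swap α (l * l) (recip α)) (trans (cong (l * l *_) (recip-inverse 0<α)) (ℚ.*-identityʳ (l * l)))
      where
      swap : ∀ a b c → a * (b * c) ≡ b * (a * c)
      swap = solve-∀ ℚ-ring
    identity : ∀ a b e l x →
      a * x - l * l
      ≡ (a * (x * x * (x * x)) - b * (x * (x * x)) - e * l * x - l * l) + b * (x * (x * x)) + e * l * x
        + a * x * ((1ℚ - x) * (1ℚ + x + x * x))
    identity = solve-∀ ℚ-ring

module GridRoot (r : ℕ) (1≤r : 1 ℕ.≤ r) (l : ℚ) (0<l : 0ℚ ℚ.< l) (l≤1 : l ℚ.≤ 1ℚ) where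
  open Data.Rational.Base using (_+_; _*_; _-_; -_; _≤_; _<_)

  R : ℚ
  R = cast r

  open Quartic R l (cast-1≤ 1≤r) 0<l l≤1 public

  mesh : ℕ → ℕ
  mesh i = suc r ℕ.* suc i

  step : ℕ → ℚ
  step i = recip (cast (mesh i))

  0<mesh : ∀ i → 0ℚ < cast (mesh i)
  0<mesh i = subst (_< cast (mesh i)) cast-0 (cast-< {0} (s≤s z≤n))

  0<step : ∀ i → 0ℚ < step i
  0<step i = recip-pos (0<mesh i)

  mesh-step : ∀ i → cast (mesh i) * step i ≡ 1ℚ
  mesh-step i = recip-inverse (0<mesh i)

  steps-vanish : ∀ ε → 0ℚ < ε → ∃[ k ] (∀ i → k ℕ.≤ i → step i ≤ ε)
  steps-vanish ε 0<ε with a , b , 0<b , εb≡a ← nonneg-fraction ε (ℚ.<⇒≤ 0<ε) = b , λ i b≤i →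
    *-cancel-≤ (0<mesh i) (ℚ.≤-trans (ℚ.≤-reflexive (mesh-step i)) (ℚ.≤-trans 1≤bε
      (subst₂ _≤_ (ℚ.*-comm ε (cast b)) (ℚ.*-comm ε _) (ℚ.*-monoˡ-≤-nonNeg ε {{ℚ.nonNegative (ℚ.<⇒≤ 0<ε)}}
        (cast-≤ (ℕ.≤-trans b≤i (ℕ.≤-trans (ℕ.n≤1+n i) (ℕ.m≤m+n (suc i) (r ℕ.* suc i)))))))))
    where
    1≤a : 1 ℕ.≤ a
    1≤a = ℕ.≰⇒> λ a≤0 → ℚ.<-irrefl refl (ℚ.<-≤-trans
      (0<* 0<ε (ℚ.<-≤-trans (ℚ.positive⁻¹ 1ℚ) (cast-1≤ 0<b)))
      (ℚ.≤-trans (ℚ.≤-reflexive εb≡a) (subst (cast a ≤_) cast-0 (cast-≤ a≤0))))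
    1≤bε : 1ℚ ≤ cast b * ε
    1≤bε = subst (1ℚ ≤_) (trans (sym εb≡a) (ℚ.*-comm ε _)) (cast-1≤ 1≤a)

  point : ℕ → ℕ → ℚ
  point i j = cast j * step i

  last-point : ∀ i → (R + 1ℚ) * point i (suc i) ≡ 1ℚ
  last-point i = trans (sym (ℚ.*-assoc (R + 1ℚ) _ _)) (trans (cong (_* step i)
    (sym (cast-suc r ⊠ refl {x = cast (suc i)}))) (mesh-step i))

  record Approximation (i : ℕ) : Set where
    field
      j       : ℕ
      nonneg  : 0ℚ ≤ Q (point i j)
      below   : ∀ k → k ℕ.< j → Q (point i k) < 0ℚ
      bounded : j ℕ.≤ suc i

  approximation : ∀ i → Approximation i
  approximation i = let j , nonneg , least = minimum {λ j → 0ℚ ≤ Q (point i j)} (λ j → 0ℚ ℚ.≤? Q (point i j))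
                          (Q-at-1/p _ (last-point i)) in record
    { j = j ; nonneg = nonneg
    ; below = λ k k<j → ℚ.≰⇒> λ 0≤Qk → ℕ.<⇒≱ k<j (least k 0≤Qk)
    ; bounded = least (suc i) (Q-at-1/p _ (last-point i)) }

  x : ℕ → ℚ
  x i = point i (Approximation.j (approximation i))

  Q-x-nonneg : ∀ i → 0ℚ ≤ Q (x i)
  Q-x-nonneg i = Approximation.nonneg (approximation i)

  px≤1 : ∀ i → (R + 1ℚ) * x i ≤ 1ℚ
  px≤1 i = ℚ.≤-trans (ℚ.*-monoˡ-≤-nonNeg (R + 1ℚ) {{ℚ.nonNegative 0≤P}}
    (ℚ.*-monoʳ-≤-nonNeg (step i) {{ℚ.nonNegative (ℚ.<⇒≤ (0<step i))}}
      (cast-≤ (Approximation.bounded (approximation i))))) (ℚ.≤-reflexive (last-point i))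

  0≤x : ∀ i → 0ℚ ≤ x i
  0≤x i = 0≤* (cast-0≤ (Approximation.j (approximation i))) (ℚ.<⇒≤ (0<step i))

  x≤1 : ∀ i → x i ≤ 1ℚ
  x≤1 i = ℚ.≤-trans (≤-by (R * x i) (identity R (x i)) (0≤* 0≤R (0≤x i))) (px≤1 i)
    where
    identity : ∀ r x → (r + 1ℚ) * x - x ≡ r * x
    identity = solve-∀ ℚ-ring

  δ≤x : ∀ i → δ ≤ x i
  δ≤x i = away-from-zero (x i) (0≤x i) (x≤1 i) (Q-x-nonneg i)

  0<x : ∀ i → 0ℚ < x i
  0<x i = ℚ.<-≤-trans 0<δ (δ≤x i)

  predecessor : ∀ i → 0ℚ ≤ x i - step i × Q (x i - step i) < 0ℚ
  predecessor i = lemma (Approximation.j (approximation i)) (Approximation.below (approximation i)) (0<x i)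
    where
    lemma : ∀ j → (∀ k → k ℕ.< j → Q (point i k) < 0ℚ) → 0ℚ < point i j →
      0ℚ ≤ point i j - step i × Q (point i j - step i) < 0ℚ
    lemma zero    below 0<p = contradiction 0<p (ℚ.<-irrefl (sym (trans (cong (_* step i) cast-0) (ℚ.*-zeroˡ (step i)))))
    lemma (suc j) below 0<p =
        subst (0ℚ ≤_) (sym shift) (0≤* (cast-0≤ j) (ℚ.<⇒≤ (0<step i)))
      , subst (λ z → Q z < 0ℚ) (sym shift) (below j ℕ.≤-refl)
      where
      shift : point i (suc j) - step i ≡ point i j
      shift = trans (cong (λ z → z * step i - step i) (cast-suc j)) (identity (cast j) (step i))
        where
        identity : ∀ a h → (a + 1ℚ) * h - h ≡ a * h
        identity = solve-∀ ℚ-ring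

  Q-x-small : ∀ i → Q (x i) ≤ 2ℚ * 2ℚ * α * step i
  Q-x-small i = ℚ.≤-trans (Q-step (x i - step i) (x i) (proj₁ (predecessor i))
    (≤-by (step i) (cancel (x i) (step i)) (ℚ.<⇒≤ (0<step i))) (x≤1 i))
    (≤-by _ (identity (Q (x i - step i)) α (x i) (step i)) (ℚ.neg-antimono-≤ (ℚ.<⇒≤ (proj₂ (predecessor i)))))
    where
    cancel : ∀ x h → x - (x - h) ≡ h
    cancel = solve-∀ ℚ-ring
    identity : ∀ q a x h → 2ℚ * 2ℚ * a * h - (q + 2ℚ * 2ℚ * a * (x - (x - h))) ≡ - q
    identity = solve-∀ ℚ-ring

  x-close : ∀ i k → x k - x i ≤ step k
  x-close i k = ≤-by _ (identity (x k) (x i) (step k)) (slack (ℚ.≮⇒≥ λ xᵢ<w →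
    ℚ.<-irrefl refl (ℚ.<-≤-trans (proj₂ (predecessor k))
      (Q-nonneg-above (0<x i) (ℚ.<⇒≤ xᵢ<w) (Q-x-nonneg i)))))
    where
    identity : ∀ a b h → h - (a - b) ≡ b - (a - h)
    identity = solve-∀ ℚ-ring

module _ where
  open Data.Rational.Base using (_+_; _*_; _-_; -_; _≤_; _<_)

  ∣∣-≤ : ∀ {a e} → a ≤ e → - a ≤ e → ℚ.∣ a ∣ ≤ e
  ∣∣-≤ {a} a≤e -a≤e with ℚ.∣p∣≡p∨∣p∣≡-p a
  ... | inj₁ eq = ℚ.≤-trans (ℚ.≤-reflexive eq) a≤e
  ... | inj₂ eq = ℚ.≤-trans (ℚ.≤-reflexive eq) -a≤e

  ≤-∣∣ : ∀ {a e} → ℚ.∣ a ∣ ≤ e → a ≤ e × - e ≤ a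
  ≤-∣∣ {a} {e} le = ℚ.≤-trans (p≤∣p∣ a) le , ≤-by _ (identity a e) (slack
      (ℚ.≤-trans (p≤∣p∣ (- a)) (ℚ.≤-trans (ℚ.≤-reflexive (ℚ.∣-p∣≡∣p∣ a)) le)))
    where
    identity : ∀ a e → a - - e ≡ e - - a
    identity = solve-∀ ℚ-ring
    p≤∣p∣ : ∀ p → p ≤ ℚ.∣ p ∣
    p≤∣p∣ p with ℚ.≤-total 0ℚ p
    ... | inj₁ 0≤p = ℚ.≤-reflexive (sym (ℚ.0≤p⇒∣p∣≡p 0≤p))
    ... | inj₂ p≤0 = ℚ.≤-trans p≤0 (ℚ.0≤∣p∣ p)

  difference≤0 : ∀ {a b} → a ≤ b → a - b ≤ 0ℚ
  difference≤0 {a} {b} a≤b = ≤-by _ (identity a b) (slack a≤b)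
    where
    identity : ∀ a b → 0ℚ - (a - b) ≡ b - a
    identity = solve-∀ ℚ-ring

  *-recip-cancel : ∀ {a} b → 0ℚ < a → a * (b * recip a) ≡ b
  *-recip-cancel {a} b 0<a = trans (swap a b (recip a)) (trans (cong (b *_) (recip-inverse 0<a)) (ℚ.*-identityʳ b))
    where
    swap : ∀ a b c → a * (b * c) ≡ b * (a * c)
    swap = solve-∀ ℚ-ring

  0<÷ : ∀ {a b} → 0ℚ < a → 0ℚ < b → 0ℚ < b * recip a
  0<÷ 0<a 0<b = 0<* 0<b (recip-pos 0<a)

  quartic-form : (P c₁ c₂ c₄ c₈ c₁₁ l x : ℚ) → ℚ
  quartic-form P c₁ c₂ c₄ c₈ c₁₁ l x =
      P * (P * (P * c₁)) * (c₄ * (P * (P * c₁)) - c₁₁ * P + c₈) * (x * (x * (x * (x * c₁))))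
    - c₂ * (P * (P * c₁)) * ((P - c₂) * ((P - c₂) * c₁)) * (x * (x * (x * c₁)))
    - c₂ * P * (P - c₂) * l * x
    - l * (l * c₁)

  y-form : (P c₁ c₂ l x : ℚ) → ℚ
  y-form P c₁ c₂ l x = (l ÷ (c₂ * P * (P - 1ℚ))) * recip x + ((P - c₂) ÷ (P - 1ℚ)) * (c₁ - ½ * x)

  y-equation : ∀ R l x → 0ℚ < R → 0ℚ < x →
    2ℚ * (R + 1ℚ) * R * x * y-form (R + 1ℚ) 1ℚ 2ℚ l x
      ≡ l + (R * R - 1ℚ) * (2ℚ * x - x * x)
  y-equation R l x 0<R 0<x = begin
    2ℚ * (R + 1ℚ) * R * x * y-form (R + 1ℚ) 1ℚ 2ℚ l x
      ≡⟨ cong (λ z → 2ℚ * (R + 1ℚ) * R * x * ((l * recip (2ℚ * (R + 1ℚ) * z)) * recip x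
           + ((R + 1ℚ - 2ℚ) * recip z) * (1ℚ - ½ * x))) (cancel R) ⟩
    2ℚ * (R + 1ℚ) * R * x * ((l * u) * v + ((R + 1ℚ - 2ℚ) * w) * (1ℚ - ½ * x))
      ≡⟨ split R l x u v w ½ ⟩
    l * (2ℚ * (R + 1ℚ) * R * u) * (x * v) + (R * R - 1ℚ) * (R * w) * (2ℚ * x - (½ + ½) * (x * x))
      ≡⟨ cong₂ _+_ (cong₂ (λ a b → l * a * b) (recip-inverse (0<* (0<* 0<2 0<P) 0<R)) (recip-inverse 0<x))
           (cong (λ a → (R * R - 1ℚ) * a * (2ℚ * x - 1ℚ * (x * x))) (recip-inverse 0<R)) ⟩
    l * 1ℚ * 1ℚ + (R * R - 1ℚ) * 1ℚ * (2ℚ * x - 1ℚ * (x * x))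
      ≡⟨ units R l x ⟩
    l + (R * R - 1ℚ) * (2ℚ * x - x * x) ∎
    where
    open ≡-Reasoning
    0<P : 0ℚ < R + 1ℚ
    0<P = ℚ.+-mono-<-≤ 0<R 0≤1
    u v w : ℚ
    u = recip (2ℚ * (R + 1ℚ) * R)
    v = recip x
    w = recip R
    cancel : ∀ r → r + 1ℚ - 1ℚ ≡ r
    cancel = solve-∀ ℚ-ring
    split : ∀ r l x u v w h →
      2ℚ * (r + 1ℚ) * r * x * ((l * u) * v + ((r + 1ℚ - 2ℚ) * w) * (1ℚ - h * x))
      ≡ l * (2ℚ * (r + 1ℚ) * r * u) * (x * v) + (r * r - 1ℚ) * (r * w) * (2ℚ * x - (h + h) * (x * x))
    split = solve-∀ ℚ-ring
    units : ∀ r l x → l * 1ℚ * 1ℚ + (r * r - 1ℚ) * 1ℚ * (2ℚ * x - 1ℚ * (x * x))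
      ≡ l + (r * r - 1ℚ) * (2ℚ * x - x * x)
    units = solve-∀ ℚ-ring

  Φ-form : (P c₁ x y : ℚ) → ℚ
  Φ-form P c₁ x y = ½ * (x * (x * c₁) + (1ℚ ÷ (P - 1ℚ)) * (y * (y * c₁)))

  Φ-value : ∀ R x y → 0ℚ < R → 2ℚ * R * Φ-form (R + 1ℚ) 1ℚ x y ≡ R * (x * x) + y * y
  Φ-value R x y 0<R = begin
    2ℚ * R * Φ-form (R + 1ℚ) 1ℚ x y
      ≡⟨ cong (λ z → 2ℚ * R * (½ * (x * (x * 1ℚ) + (1ℚ * recip z) * (y * (y * 1ℚ))))) (cancel R) ⟩
    2ℚ * R * (½ * (x * (x * 1ℚ) + (1ℚ * recip R) * (y * (y * 1ℚ))))
      ≡⟨ split R x y (recip R) ½ ⟩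
    (½ + ½) * (R * (x * x) + (R * recip R) * (y * y))
      ≡⟨ cong (λ a → 1ℚ * (R * (x * x) + a * (y * y))) (recip-inverse 0<R) ⟩
    1ℚ * (R * (x * x) + 1ℚ * (y * y))
      ≡⟨ trans (ℚ.*-identityˡ _) (cong (R * (x * x) +_) (ℚ.*-identityˡ (y * y))) ⟩
    R * (x * x) + y * y ∎
    where
    open ≡-Reasoning
    cancel : ∀ r → r + 1ℚ - 1ℚ ≡ r
    cancel = solve-∀ ℚ-ring
    split : ∀ r x y w h → 2ℚ * r * (h * (x * (x * 1ℚ) + (1ℚ * w) * (y * (y * 1ℚ))))
      ≡ (h + h) * (r * (x * x) + (r * w) * (y * y))
    split = solve-∀ ℚ-ring

module Root (r : ℕ) (1≤r : 1 ℕ.≤ r) (l : ℚ) (0<l : 0ℚ ℚ.< l) (l≤1 : l ℚ.≤ 1ℚ) where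
  open Data.Rational.Base using (_+_; _*_; _-_; -_; _≤_; _<_)
  open GridRoot r 1≤r l 0<l l≤1 public
  open Defs using (ℝ; mkℝ; seq; quartic; IsUniquePositiveRoot; IsCauchy; 0ℝ; _≃_)

  P≡ : ℕ→ℚ (suc r) ≡ R + 1ℚ
  P≡ = trans (cast-ℕ→ℚ (suc r)) (cast-suc r)

  quartic-seq : ∀ x i → seq (quartic (suc r) l x) i ≡ Q (seq x i)
  quartic-seq x i = trans (cong (λ P → quartic-form P 1ℚ 2ℚ four eight eleven l (seq x i)) P≡)
    (identity R l (seq x i))
    where
    four eight eleven : ℚ
    four   = 2ℚ * 2ℚ
    eight  = four * 2ℚ
    eleven = eight + 2ℚ + 1ℚ
    identity : ∀ r l x →
      let P = r + 1ℚ
          c₂ = 2ℚ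
          c₄ = 2ℚ * 2ℚ
          c₈ = 2ℚ * 2ℚ * 2ℚ
          c₁₁ = 2ℚ * 2ℚ * 2ℚ + 2ℚ + 1ℚ in
      P * (P * (P * 1ℚ)) * (c₄ * (P * (P * 1ℚ)) - c₁₁ * P + c₈) * (x * (x * (x * (x * 1ℚ))))
        - c₂ * (P * (P * 1ℚ)) * ((P - c₂) * ((P - c₂) * 1ℚ)) * (x * (x * (x * 1ℚ)))
        - c₂ * P * (P - c₂) * l * x
        - l * (l * 1ℚ)
      ≡ (r + 1ℚ) * (r + 1ℚ) * (2ℚ * 2ℚ * (r * (r * r)) + (r - 1ℚ) * (r - 1ℚ)) * (x * x * (x * x))
        - 2ℚ * ((r + 1ℚ) * (r + 1ℚ)) * ((r - 1ℚ) * (r - 1ℚ)) * (x * (x * x))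
        - 2ℚ * (r + 1ℚ) * (r - 1ℚ) * l * x - l * l
    identity = solve-∀ ℚ-ring

  x-cauchy : IsCauchy x
  x-cauchy ε 0<ε = let k , small = steps-vanish ε 0<ε in k , λ i j k≤i k≤j → ∣∣-≤
    (ℚ.≤-trans (x-close j i) (small i k≤i))
    (ℚ.≤-trans (ℚ.≤-reflexive (neg-difference (x i) (x j))) (ℚ.≤-trans (x-close i j) (small j k≤j)))

  X : ℝ
  X = mkℝ x x-cauchy

  four : ℚ
  four = 2ℚ * 2ℚ

  0<four : 0ℚ < four
  0<four = ℚ.positive⁻¹ four

  Q-vanishes : ∀ ε → 0ℚ < ε → ∃[ k ] (∀ i → k ℕ.≤ i → Q (x i) ≤ ε)
  Q-vanishes ε 0<ε = let k , small = steps-vanish (ε * recip (four * α)) (0<÷ (0<* 0<four 0<α) 0<ε) in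
    k , λ i k≤i → ℚ.≤-trans (Q-x-small i) (ℚ.≤-trans
      (ℚ.*-monoˡ-≤-nonNeg (four * α) {{ℚ.nonNegative (ℚ.<⇒≤ (0<* 0<four 0<α))}} (small i k≤i))
      (ℚ.≤-reflexive (*-recip-cancel ε (0<* 0<four 0<α))))

  minus-zero : ∀ a → a - ℕ→ℚ 0 ≡ a
  minus-zero = ℚ.+-identityʳ

  isRoot : IsUniquePositiveRoot (suc r) l X
  isRoot = record
    { positive = δ , 0<δ , 0 , λ i _ → ℚ.≤-trans (ℚ.≤-reflexive (ℚ.+-identityˡ δ)) (δ≤x i)
    ; root     = λ ε 0<ε → let k , small = Q-vanishes ε 0<ε in k , λ i k≤i →
        subst (λ z → ℚ.∣ z ∣ ≤ ε) (sym (trans (minus-zero _) (quartic-seq X i)))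
          (ℚ.≤-trans (ℚ.≤-reflexive (ℚ.0≤p⇒∣p∣≡p (Q-x-nonneg i))) (small i k≤i))
    ; unique   = unique
    }
    where
    unique : ∀ x′ → Defs._<_ 0ℝ x′ → quartic (suc r) l x′ ≃ 0ℝ → x′ ≃ X
    unique x′ (δ′ , 0<δ′ , k₁ , δ′≤x′) x′-root ε 0<ε =
      k₁ ℕ.⊔ (k₂ ℕ.⊔ k₃) , λ i k≤i →
        let k₁≤i = ℕ.m⊔n≤o⇒m≤o k₁ (k₂ ℕ.⊔ k₃) k≤i
            k₂₃≤i = ℕ.m⊔n≤o⇒n≤o k₁ (k₂ ℕ.⊔ k₃) k≤i in
        close (seq x′ i) (x i)
          (ℚ.≤-trans (ℚ.p⊓q≤q δ δ′) (ℚ.≤-trans (ℚ.≤-reflexive (sym (ℚ.+-identityˡ δ′))) (δ′≤x′ i k₁≤i)))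
          (ℚ.≤-trans (ℚ.p⊓q≤p δ δ′) (δ≤x i))
          (≤-∣∣ (subst (λ z → ℚ.∣ z ∣ ≤ τ) (trans (minus-zero _) (quartic-seq x′ i))
            (x′-small i (ℕ.m⊔n≤o⇒m≤o k₂ k₃ k₂₃≤i))))
          ( x-small i (ℕ.m⊔n≤o⇒n≤o k₂ k₃ k₂₃≤i)
          , ℚ.≤-trans (ℚ.neg-antimono-≤ (ℚ.<⇒≤ 0<τ)) (Q-x-nonneg i))
      where
      d c τ : ℚ
      d = δ ℚ.⊓ δ′
      c = α * (d * (d * d))
      τ = ε * c * ½
      0<d : 0ℚ < d
      0<d with ℚ.⊓-sel δ δ′
      ... | inj₁ eq = subst (0ℚ <_) (sym eq) 0<δ
      ... | inj₂ eq = subst (0ℚ <_) (sym eq) 0<δ′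
      0<c : 0ℚ < c
      0<c = 0<* 0<α (0<* 0<d (0<* 0<d 0<d))
      0<τ : 0ℚ < τ
      0<τ = 0<* (0<* 0<ε 0<c) (ℚ.positive⁻¹ ½)
      k₂ k₃ : ℕ
      k₂ = proj₁ (x′-root τ 0<τ)
      k₃ = proj₁ (Q-vanishes τ 0<τ)
      x′-small : ∀ i → k₂ ℕ.≤ i → ℚ.∣ seq (quartic (suc r) l x′) i - ℕ→ℚ 0 ∣ ≤ τ
      x′-small = proj₂ (x′-root τ 0<τ)
      x-small : ∀ i → k₃ ℕ.≤ i → Q (x i) ≤ τ
      x-small = proj₂ (Q-vanishes τ 0<τ)
      ordered : ∀ u v → d ≤ u → u ≤ v → - τ ≤ Q u → Q v ≤ τ → v - u ≤ ε
      ordered u v d≤u u≤v Qu Qv = *-cancel-≤ 0<c (ℚ.≤-trans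
        (close-roots u v d τ 0<d d≤u u≤v Qu Qv (ℚ.<⇒≤ 0<τ)) (ℚ.≤-reflexive
          (trans (sym (ℚ.*-distribˡ-+ (ε * c) ½ ½)) (trans (ℚ.*-identityʳ (ε * c)) (ℚ.*-comm ε c)))))
      close : ∀ u v → d ≤ u → d ≤ v → Q u ≤ τ × - τ ≤ Q u → Q v ≤ τ × - τ ≤ Q v → ℚ.∣ u - v ∣ ≤ ε
      close u v d≤u d≤v (Qu≤ , ≤Qu) (Qv≤ , ≤Qv) with ℚ.≤-total u v
      ... | inj₁ u≤v = ∣∣-≤ (ℚ.≤-trans (difference≤0 u≤v) (ℚ.<⇒≤ 0<ε))
          (ℚ.≤-trans (ℚ.≤-reflexive (neg-difference u v)) (ordered u v d≤u u≤v ≤Qu Qv≤))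
      ... | inj₂ v≤u = ∣∣-≤ (ordered v u d≤v v≤u ≤Qv Qu≤)
          (ℚ.≤-trans (ℚ.≤-reflexive (neg-difference u v)) (ℚ.≤-trans (difference≤0 v≤u) (ℚ.<⇒≤ 0<ε)))

-- The asymptotic formula

module Asymptotics (r n m : ℕ) (1≤r : 1 ℕ.≤ r) (1≤n : 1 ℕ.≤ n)
  (t<m : t r n ℕ.< m) (m≤t : m ℕ.≤ t (suc r) n) where
  open Data.Rational.Base using (_+_; _*_; _-_; -_; _≤_; _<_)
  open Density r n m 1≤r t<m m≤t
  module S = Root r 1≤r l 0<l l≤1
  open S using (x; Q; α; step; δ; four)

  module At (i : ℕ) (fine : four * α * N * step i ≤ δ * δ) where

    y : ℚ
    y = y-form (R + 1ℚ) 1ℚ 2ℚ l (x i)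

    xy : 2ℚ * (R + 1ℚ) * R * x i * y ≡ l + (R * R - 1ℚ) * (2ℚ * x i - x i * x i)
    xy = y-equation R l (x i) 0<R (S.0<x i)

    0<scale : 0ℚ < 2ℚ * (R + 1ℚ) * R * x i
    0<scale = 0<* (0<* (0<* 0<2 0<P) 0<R) (S.0<x i)

    0≤slope : 0ℚ ≤ Optimum.slope R (x i) y l
    0≤slope = *-cancel-≤ 0<scale (≤-by-eq (- (l + (R * R - 1ℚ) * (x i * x i))) xy (identity R l (x i) y)
      (S.Q-x-nonneg i))
      where
      identity : ∀ r l x y →
        2ℚ * (r + 1ℚ) * r * x * (2ℚ * (r + 1ℚ) * r * r * (x * x * x) - y * (l + (r * r - 1ℚ) * (x * x)))
          - 2ℚ * (r + 1ℚ) * r * x * 0ℚ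
        ≡ ((r + 1ℚ) * (r + 1ℚ) * (2ℚ * 2ℚ * (r * (r * r)) + (r - 1ℚ) * (r - 1ℚ)) * (x * x * (x * x))
            - 2ℚ * ((r + 1ℚ) * (r + 1ℚ)) * ((r - 1ℚ) * (r - 1ℚ)) * (x * (x * x))
            - 2ℚ * (r + 1ℚ) * (r - 1ℚ) * l * x - l * l)
          + - (l + (r * r - 1ℚ) * (x * x))
            * (2ℚ * (r + 1ℚ) * r * x * y - (l + (r * r - 1ℚ) * (2ℚ * x - x * x)))
      identity = solve-∀ ℚ-ring

    slope-small : N * Optimum.slope R (x i) y l ≤ x i
    slope-small = *-cancel-≤ 0<scale (≤-by-eq (N * (l + (R * R - 1ℚ) * (x i * x i))) xy
      (identity R l (x i) y N δ (four * α) (step i))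
      (0≤+ (0≤+ (0≤+ (0≤* (0≤* 0≤x 0≤x) (0≤+ (0≤+ (slack 1≤R) 0≤R) (0≤* 0≤2 (0≤* 0≤R 0≤R))))
                     (0≤* (slack (S.δ≤x i)) (0≤+ 0≤x (ℚ.<⇒≤ S.0<δ))))
                (slack fine))
           (0≤* 0≤N (slack (S.Q-x-small i)))))
      where
      0≤x : 0ℚ ≤ x i
      0≤x = S.0≤x i
      identity : ∀ r l x y n d a h →
        let Q = (r + 1ℚ) * (r + 1ℚ) * (2ℚ * 2ℚ * (r * (r * r)) + (r - 1ℚ) * (r - 1ℚ)) * (x * x * (x * x))
              - 2ℚ * ((r + 1ℚ) * (r + 1ℚ)) * ((r - 1ℚ) * (r - 1ℚ)) * (x * (x * x))
              - 2ℚ * (r + 1ℚ) * (r - 1ℚ) * l * x - l * l in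
        2ℚ * (r + 1ℚ) * r * x * x
          - 2ℚ * (r + 1ℚ) * r * x * (n * (2ℚ * (r + 1ℚ) * r * r * (x * x * x) - y * (l + (r * r - 1ℚ) * (x * x))))
        ≡ (x * x * ((r - 1ℚ) + r + 2ℚ * (r * r)) + (x - d) * (x + d) + (d * d - a * n * h) + n * (a * h - Q))
          + n * (l + (r * r - 1ℚ) * (x * x))
            * (2ℚ * (r + 1ℚ) * r * x * y - (l + (r * r - 1ℚ) * (2ℚ * x - x * x)))
      identity = solve-∀ ℚ-ring

    open Bounds 1≤n (x i) y (S.0<x i) (S.px≤1 i) xy 0≤slope public

    constant : ℚ
    constant = R + error + upper-error

    estimate : ∀ f → IsMinSat (suc (suc r)) n m f →
      ℚ.∣ cast f - Φ-form (R + 1ℚ) 1ℚ (x i) y * (N * N) ∣ ≤ constant * N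
    estimate f ((G , ¬clique , e , refl) , minimal) = ∣∣-≤
      (*-cancel-≤ 0<2r (≤-by-eq (N * N) (Φ-value R (x i) y 0<R)
        (upper-identity R (cast f) (Φ-form (R + 1ℚ) 1ℚ (x i) y) N (x i) y error upper-error)
        (0≤+ (0≤+ (slack f-upper) (0≤* (0≤* 0≤upper-error 0≤N) 0≤2r-1)) (0≤* (0≤* 0≤2r 0≤lower-error) 0≤N))))
      (*-cancel-≤ 0<2r (≤-by-eq (- (N * N)) (Φ-value R (x i) y 0<R)
        (lower-identity R (cast f) (Φ-form (R + 1ℚ) 1ℚ (x i) y) N (x i) y error upper-error)
        (0≤+ (0≤+ (slack (lower G ¬clique e slope-small)) (0≤* (0≤* 0≤lower-error 0≤N) 0≤2r-1))
             (0≤* (0≤* 0≤2r 0≤upper-error) 0≤N))))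
      where
      0<2r : 0ℚ < 2ℚ * R
      0<2r = 0<* 0<2 0<R
      0≤2r : 0ℚ ≤ 2ℚ * R
      0≤2r = ℚ.<⇒≤ 0<2r
      0≤2r-1 : 0ℚ ≤ (R - 1ℚ) + R
      0≤2r-1 = 0≤+ (slack 1≤R) 0≤R
      0≤lower-error : 0ℚ ≤ R + error
      0≤lower-error = 0≤+ 0≤R (0≤+ (0≤+ 0≤1 (0≤* 0≤R (0≤* 0≤R (0≤* 0≤P 0≤P)))) (0≤* 0≤P 0≤R))
      0≤upper-error : 0ℚ ≤ upper-error
      0≤upper-error = 0≤* 0≤P (0≤+ (0≤* 0≤2 0≤P) (0≤* 0≤P 0≤P))
      f-upper : 2ℚ * R * cast f ≤ value * (N * N) + upper-error * N
      f-upper = let G′ , ¬clique′ , e′ , bound = upper in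
        ℚ.≤-trans (ℚ.*-monoˡ-≤-nonNeg (2ℚ * R) {{ℚ.nonNegative 0≤2r}}
          (cast-≤ (minimal _ (G′ , ¬clique′ , e′ , refl)))) bound
      upper-identity : ∀ r f φ n x y e u →
        2ℚ * r * ((r + e + u) * n) - 2ℚ * r * (f - φ * (n * n))
        ≡ (((r * (x * x) + y * y) * (n * n) + u * n - 2ℚ * r * f) + u * n * ((r - 1ℚ) + r)
            + 2ℚ * r * (r + e) * n)
          + n * n * (2ℚ * r * φ - (r * (x * x) + y * y))
      upper-identity = solve-∀ ℚ-ring
      lower-identity : ∀ r f φ n x y e u →
        2ℚ * r * ((r + e + u) * n) - 2ℚ * r * - (f - φ * (n * n))
        ≡ ((2ℚ * r * f + (r + e) * n - (r * (x * x) + y * y) * (n * n)) + (r + e) * n * ((r - 1ℚ) + r)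
            + 2ℚ * r * u * n)
          + - (n * n) * (2ℚ * r * φ - (r * (x * x) + y * y))
      lower-identity = solve-∀ ℚ-ring

  fine-meshes : ∃[ k ] (∀ i → k ℕ.≤ i → four * α * N * step i ≤ δ * δ)
  fine-meshes = let k , small = S.steps-vanish (δ * δ * recip (four * α * N)) (0<÷ 0<c (0<* S.0<δ S.0<δ)) in
    k , λ i k≤i → ℚ.≤-trans
      (ℚ.*-monoˡ-≤-nonNeg (four * α * N) {{ℚ.nonNegative (ℚ.<⇒≤ 0<c)}} (small i k≤i))
      (ℚ.≤-reflexive (*-recip-cancel (δ * δ) 0<c))
    where
    0<c : 0ℚ < four * α * N
    0<c = 0<* (0<* S.0<four S.0<α) (ℚ.<-≤-trans (ℚ.positive⁻¹ 1ℚ) (cast-1≤ 1≤n))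

  exists-minimum : ∃[ f ] IsMinSat (suc (suc r)) n m f
  exists-minimum = let G , ¬clique , e , _ = At.upper (proj₁ fine-meshes) (proj₂ fine-meshes _ ℕ.≤-refl) in
    minimum (satValue? (suc (suc r)) n m) (G , ¬clique , e , refl)

open import Defs

error-constant : ℕ → ℚ
error-constant r = R ℚ.+ (1ℚ ℚ.+ R ℚ.* (R ℚ.* (P ℚ.* P)) ℚ.+ P ℚ.* R) ℚ.+ P ℚ.* (2ℚ ℚ.* P ℚ.+ P ℚ.* P)
  where
  R P : ℚ
  R = cast r
  P = cast r ℚ.+ 1ℚ

theorem1p3 : (p : ℕ) → 3 ℕ.≤ p →
    Σ[ C ∈ ℝ ] ((n m : ℕ) → 1 ℕ.≤ n → t (p ℕ.∸ 1) n ℕ.< m → m ℕ.≤ t p n →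
    Σ[ f ∈ ℕ ] (IsMinSat (ℕ.suc p) n m f ×
    (Σ[ x ∈ ℝ ] Σ[ isRoot ∈ IsUniquePositiveRoot p (density p n m) x ]
    abs (fromℕ f - Φ[ p ] (density p n m) x (positive isRoot) * fromℕ n ^ 2)
    ≤ C * fromℕ n)))
theorem1p3 (suc r) (s≤s 2≤r) = fromℚ (error-constant r) , λ n m 1≤n t<m m≤t →
  let module A = Asymptotics r n m 1≤r 1≤n t<m m≤t
      module Dn = Density r n m 1≤r t<m m≤t
      f , minimal = A.exists-minimum
      k , fine    = A.fine-meshes
  in f , minimal , subst (λ l → Σ[ x ∈ ℝ ] Σ[ isRoot ∈ IsUniquePositiveRoot (suc r) l x ]
       abs (fromℕ f - Φ[ suc r ] l x (positive isRoot) * fromℕ n ^ 2) ≤ fromℚ (error-constant r) * fromℕ n)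
     (sym Dn.density≡l)
     ( A.S.X , A.S.isRoot , λ ε 0<ε → k , λ i k≤i → ℚ.≤-trans
         (ℚ.≤-reflexive (cong₂ (λ F E → ℚ.∣ F ℚ.- E ∣) (cast-ℕ→ℚ f)
           (cong₂ (λ P N → Φ-form P 1ℚ (A.S.x i) (y-form P 1ℚ 2ℚ Dn.l (A.S.x i)) ℚ.* N) A.S.P≡
             (trans (cong (λ N → N ℚ.* (N ℚ.* 1ℚ)) (cast-ℕ→ℚ n))
               (cong (cast n ℚ.*_) (ℚ.*-identityʳ (cast n)))))))
         (ℚ.≤-trans (A.At.estimate i (fine i k≤i) f minimal) (ℚ.≤-trans
           (ℚ.≤-reflexive (cong (error-constant r ℚ.*_) (sym (cast-ℕ→ℚ n))))
           (ℚ.≤-trans (ℚ.≤-reflexive (sym (ℚ.+-identityʳ (error-constant r ℚ.* ℕ→ℚ n))))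
             (ℚ.+-monoʳ-≤ (error-constant r ℚ.* ℕ→ℚ n) (ℚ.<⇒≤ 0<ε))))) )
  where
  1≤r : 1 ℕ.≤ r
  1≤r = ℕ.≤-trans (s≤s z≤n) 2≤r
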